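{- (1) If $\le_T^{RS}\neq\le_T^{p}$, then $\mathrm{P}\neq\mathrm{NP}$. (2) If $\le_T^{RS}=\le_T^{p}$, then $\mathrm{P}=\mathrm{NP}\cap\mathrm{coNP}$. (Reducibilities are identified with the sets of pairs $(A,B)$ they relate.)
   Context: $\le_T^p$ is polynomial-time Turing reducibility. An NPTM is a nondeterministic oracle Turing machine $N$ each of whose computation paths ends in one of three outcomes $\mathbf{acc}$, $\mathbf{rej}$, $\mathbf{?}$, such that there is a polynomial $p$ with: for every oracle $D$ and every input $x$, every computation path of $N^D(x)$ has length at most $p(|x|)$. For an oracle $D$ and input $x$, let $out_{N^D}(x)$ be the set of outcomes occurring on some path of $N^D(x)$; $L(N^D)=\{x:\mathbf{acc}\in out_{N^D}(x)\}$. $N^D(x)$ is underproductive if $\{\mathbf{acc},\mathbf{rej}\}\not\subseteq out_{N^D}(x)$, and overproductive if $out_{N^D}(x)\neq\{\mathbf{?}\}$. $N$ is robustly underproductive (overproductive) if $N^D(x)$ is underproductive (overproductive) for every oracle $D$ and every $x$. $A\le_T^{RS}B$ if there is an NPTM $N$ that is robustly overproductive and robustly underproductive with $A=L(N^B)$. -}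

module Defs where

open import Data.Nat using (ℕ; zero; suc; _+_; _^_; _≤_)
open import Data.Bool using (Bool; true; false; if_then_else_)
open import Data.Fin using (Fin; _≟_)
open import Data.List using (List; []; _∷_; _++_; length; map)
open import Data.List.NonEmpty using (List⁺; toList)
open import Data.List.Membership.Propositional using (_∈_)
open import Data.Maybe using (Maybe; just; nothing)
open import Data.Product using (Σ; _×_; _,_; ∃; ∃₂)
open import Data.Sum using (_⊎_)
open import Relation.Nullary using (¬_; yes; no)
open import Relation.Binary.PropositionalEquality using (_≡_)
open import Function.Bundles using (_⇔_)

Word : Set
Word = List Bool

Lang : Set
Lang = Word → Bool

∅ : Lang
∅ _ = false

complement : Lang → Lang
complement A x = if A x then false else true

data Outcome : Set where
  acc rej unk : Outcome

-- Nondeterministic oracle Turing machines.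
-- One two-way infinite work tape over {0,1,blank} (input written there
-- initially, head on the first input symbol) and a write-only oracle
-- query tape (each step may append one bit).  In the query state the
-- machine moves to yesSt / noSt according to the oracle's answer on the
-- query word, and the query tape is erased.  Halting states carry an
-- outcome; every non-halting state has at least one successor (the
-- transition relation is a non-empty list), so a path ends exactly when
-- it reaches a halting state.

data Sym : Set where
  s0 s1 blank : Sym

data Move : Set where
  moveL moveR stay : Move

record Tape : Set where
  constructor tape
  field
    left  : List Sym   -- cells to the left of the head, nearest first
    head  : Sym
    right : List Sym   -- cells to the right of the head, nearest first

record NOTM : Set where
  field
    Q      : ℕ
    start  : Fin Q
    halt   : Fin Q → Maybe Outcome
    query  : Fin Q
    yesSt  : Fin Q
    noSt   : Fin Q
    δ      : Fin Q → Sym → List⁺ (Fin Q × Sym × Move × Maybe Bool)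

record Config (N : NOTM) : Set where
  constructor cfg
  field
    state : Fin (NOTM.Q N)
    work  : Tape
    qword : Word

bitSym : Bool → Sym
bitSym false = s0
bitSym true  = s1

writeT : Sym → Tape → Tape
writeT s (tape l _ r) = tape l s r

moveT : Move → Tape → Tape
moveT moveL (tape [] h r)       = tape [] blank (h ∷ r)
moveT moveL (tape (x ∷ l) h r)  = tape l x (h ∷ r)
moveT moveR (tape l h [])       = tape (h ∷ l) blank []
moveT moveR (tape l h (x ∷ r))  = tape (h ∷ l) x r
moveT stay  t                   = t

appendQ : Maybe Bool → Word → Word
appendQ nothing  w = w
appendQ (just b) w = w ++ (b ∷ [])

initTape : Word → Tape
initTape []       = tape [] blank []
initTape (b ∷ bs) = tape [] (bitSym b) (map bitSym bs)

initCfg : (N : NOTM) → Word → Config N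
initCfg N x = cfg (NOTM.start N) (initTape x) []

applyAct : (N : NOTM) → Tape → Word →
           Fin (NOTM.Q N) × Sym × Move × Maybe Bool → Config N
applyAct N t w (q , s , m , mb) = cfg q (moveT m (writeT s t)) (appendQ mb w)

succs : (N : NOTM) → Lang → Config N → List (Config N)
succs N D (cfg q t w) with NOTM.halt N q
... | just _  = []
... | nothing with q ≟ NOTM.query N
...   | yes _ = cfg (if D w then NOTM.yesSt N else NOTM.noSt N) t [] ∷ []
...   | no _  = map (applyAct N t w) (toList (NOTM.δ N q (Tape.head t)))

data Reaches (N : NOTM) (D : Lang) : Config N → Config N → ℕ → Set where
  done : ∀ {c} → Reaches N D c c zero
  step : ∀ {c c' c'' n} → c' ∈ succs N D c → Reaches N D c' c'' n →
         Reaches N D c c'' (suc n)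

Produces : NOTM → Lang → Word → Outcome → Set
Produces N D x o =
  ∃₂ λ (c : Config N) (n : ℕ) →
    Reaches N D (initCfg N x) c n × NOTM.halt N (Config.state c) ≡ just o

-- NPTM: every path of N^D(x), for every oracle D, has length ≤ p(|x|)
-- for a polynomial p (bounded by n^k + k).
PolyBounded : NOTM → Set
PolyBounded N = ∃ λ (k : ℕ) → ∀ (D : Lang) (x : Word) (c : Config N) (n : ℕ) →
  Reaches N D (initCfg N x) c n → n ≤ length x ^ k + k

Accepts : NOTM → Lang → Lang → Set
Accepts N D A = ∀ (x : Word) → (A x ≡ true) ⇔ Produces N D x acc

RobustlyUnderproductive : NOTM → Set
RobustlyUnderproductive N = ∀ (D : Lang) (x : Word) →
  ¬ (Produces N D x acc × Produces N D x rej)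

-- out ≠ {?}  (out is always non-empty, so this means acc or rej occurs)
RobustlyOverproductive : NOTM → Set
RobustlyOverproductive N = ∀ (D : Lang) (x : Word) →
  Produces N D x acc ⊎ Produces N D x rej

Deterministic : NOTM → Set
Deterministic N = ∀ q s → Data.List.NonEmpty.List⁺.tail (NOTM.δ N q s) ≡ []

_≤pT_ : Lang → Lang → Set
A ≤pT B = Σ NOTM λ N → Deterministic N × PolyBounded N × Accepts N B A

_≤RS_ : Lang → Lang → Set
A ≤RS B = Σ NOTM λ N → PolyBounded N × RobustlyOverproductive N ×
          RobustlyUnderproductive N × Accepts N B A

InP : Lang → Set
InP A = Σ NOTM λ N → Deterministic N × PolyBounded N × Accepts N ∅ A

InNP : Lang → Set
InNP A = Σ NOTM λ N → PolyBounded N × Accepts N ∅ A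

InCoNP : Lang → Set
InCoNP A = InNP (complement A)

RS≡pT : Set
RS≡pT = ∀ (A B : Lang) → (A ≤RS B) ⇔ (A ≤pT B)

P≡NP : Set
P≡NP = ∀ (A : Lang) → InP A ⇔ InNP A

P≡NP∩coNP : Set
P≡NP∩coNP = ∀ (A : Lang) → InP A ⇔ (InNP A × InCoNP A)

{-# OPTIONS --safe #-}
-- (1) Let P = NP and let N witness A ≤RS B. A table is a list of query words with answers, the first entry for a word being
-- the valid one. "Some extension of the table by r bits answers every query of an accepting path of N on x" is in NP, hence in P,
-- so an oracle machine can build such an extension bit by bit. It does this for polynomially many rounds, after each of which
-- it asks B every word of the table and corrects the answers. An accepting path and a rejecting path always
-- disagree on a common query, because otherwise one oracle would have both. So if B rejects x along ρ, then each successful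
-- round adds a query of ρ to the table, and after as many rounds as ρ has queries no extension is left. If B accepts x, the true
-- answers along an accepting path always extend the table. Hence the last table can be extended if and only if x ∈ A.
-- (2) For A in NP ∩ coNP, tossing a coin and simulating a machine for A or for its complement shows A ≤RS ∅.
-- A program over finitely many stacks runs on a one-tape machine with polynomial overhead, so programs suffice.
module Submission where

open import Defs
open import Data.Nat as ℕ using (ℕ; zero; suc; pred; _+_; _*_; _^_; _∸_; _⊔_; _≤_; _<_; _≤?_; _≤′_; ≤′-refl; ≤′-step; z≤n; s≤s)
open import Data.Nat.Properties hiding (_≟_; suc-injective)
open import Data.Bool using (Bool; true; false; if_then_else_)
import Data.Bool.Properties as Bool
open import Data.Unit using (⊤; tt)
open import Data.Empty using (⊥; ⊥-elim)
open import Data.Maybe as Maybe using (Maybe; just; nothing; fromMaybe; is-nothing)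
open import Data.Maybe.Properties using (just-injective)
open import Data.Fin as Fin using (Fin; _≟_; toℕ; #_) renaming (zero to fzero; suc to fsuc)
open import Data.Fin.Properties using (toℕ<n; toℕ-injective)
open import Data.List using (List; []; _∷_; _++_; _ʳ++_; length; map; concatMap; allFin; lookup; replicate; reverse)
open import Data.List.Properties
open import Data.List.NonEmpty as L⁺ using (List⁺; _∷_; toList)
open import Data.List.Membership.Propositional using (_∈_; lose)
open import Data.List.Membership.Propositional.Properties using (∈-map⁺; ∈-map⁻; ∈-++⁺ˡ; ∈-++⁺ʳ; ∈-concatMap⁺; ∈-allFin)
open import Data.List.Relation.Unary.Any using (here; there; index)
open import Data.List.Relation.Unary.Any.Properties using (lookup-index)
open import Data.Product using (Σ; ∃; _×_; _,_; proj₁; proj₂; map₁)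
open import Data.Sum using (_⊎_; inj₁; inj₂)
open import Data.Vec as Vec using (Vec; []; _∷_; _[_]≔_)
import Data.Vec.Properties as Vec
open import Function using (_∘_)
open import Function.Bundles using (_⇔_; mk⇔; Equivalence)
open import Relation.Nullary using (¬_; Dec; yes; no; does)
open import Relation.Binary.PropositionalEquality using (_≡_; _≢_; refl; sym; trans; cong; cong₂; subst; module ≡-Reasoning)

-- Polynomial bounds

-- P = NP decides oracle-free languages only, so the oracle must enter an instance as data: the
-- finite table. A table asks for accepting paths all of whose queries it answers, and that
-- condition mentions no oracle. Tables contradicting `B` still make sense, since `N` behaves well
-- under every oracle. An extension has 2p bits, where p bounds the path length: a path writes at
-- most p query symbols and answers, and each becomes a token of two bits. The bound on the rounds
-- is a potential argument. The potential counts the open queries of one rejecting path, which the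
-- machine never sees, and an extension of a later table yields one of every earlier table.
--
-- The bulk of the text exhibits actual machines. Nondeterministic choices are read from a list, so
-- that a program with a fixed list is deterministic. One proof of total correctness for all lists
-- then yields both the outcomes of the machine and its time bound, and the empty list alone
-- describes the deterministic machine. As a `Lang` is Boolean-valued, the NP language is obtained
-- by exhaustive search through bounded paths.

Poly : (ℕ → ℕ) → Set
Poly f = ∃ λ k → ∀ n → f n ≤ (2 + n) ^ k

^-raise : ∀ n {j k} → j ≤ k → (2 + n) ^ j ≤ (2 + n) ^ k
^-raise n = ^-monoʳ-≤ (2 + n)

n≤2^n : ∀ n → n ≤ 2 ^ n
n≤2^n zero = z≤n
n≤2^n (suc n) = begin
  1 + n            ≤⟨ +-mono-≤ (m^n>0 2 n) (n≤2^n n) ⟩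
  2 ^ n + 2 ^ n    ≡⟨ cong (2 ^ n +_) (+-identityʳ (2 ^ n)) ⟨
  2 ^ suc n        ∎
  where open ≤-Reasoning

poly-const : ∀ c → Poly (λ _ → c)
poly-const c = c , λ n → ≤-trans (n≤2^n c) (^-monoˡ-≤ c (m≤m+n 2 n))

poly-id : Poly (λ n → n)
poly-id = 1 , λ n → ≤-trans (m≤n+m n 2) (≤-reflexive (sym (*-identityʳ (2 + n))))

-- The base `2 + n` is at least 2 even for n = 0, so one further factor pays for the sum of two
-- equal powers. A bare base n would fail at 0 and 1.
poly-+ : ∀ {f g} → Poly f → Poly g → Poly (λ n → f n + g n)
poly-+ {f} {g} (j , p) (k , q) = suc (j + k) , λ n → begin
  f n + g n                                    ≤⟨ +-mono-≤ (≤-trans (p n) (^-raise n (m≤m+n j k))) (≤-trans (q n) (^-raise n (m≤n+m k j))) ⟩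
  (2 + n) ^ (j + k) + (2 + n) ^ (j + k)        ≤⟨ +-monoʳ-≤ ((2 + n) ^ (j + k)) (m≤m+n _ _) ⟩
  (2 + n) ^ suc (j + k)                        ∎
  where open ≤-Reasoning

poly-* : ∀ {f g} → Poly f → Poly g → Poly (λ n → f n * g n)
poly-* {f} {g} (j , p) (k , q) = j + k , λ n →
  ≤-trans (*-mono-≤ (p n) (q n)) (≤-reflexive (sym (^-distribˡ-+-* (2 + n) j k)))

poly-^ : ∀ {f} → Poly f → ∀ k → Poly (λ n → f n ^ k)
poly-^ p zero = poly-const 1
poly-^ p (suc k) = poly-* p (poly-^ p k)

-- For n at least 2, `2 + n` is at most n squared, so doubling the exponent suffices; for n = 0 and
-- n = 1 the additive constant `3 ^ k` covers the value.
poly⇒bound : ∀ {f} → Poly f → ∃ λ k → ∀ n → f n ≤ n ^ k + k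
poly⇒bound {f} (k , p) = 2 * k + 3 ^ k , λ n → ≤-trans (p n) (go n)
  where
  k' = 2 * k + 3 ^ k
  small : ∀ n → n ≤ 1 → (2 + n) ^ k ≤ n ^ k' + k'
  small n n≤1 = ≤-trans (^-monoˡ-≤ k (+-monoʳ-≤ 2 n≤1)) (≤-trans (m≤n+m (3 ^ k) (2 * k)) (m≤n+m k' (n ^ k')))
  go : ∀ n → (2 + n) ^ k ≤ n ^ k' + k'
  go 0 = small 0 z≤n
  go 1 = small 1 ≤-refl
  go n@(suc (suc i)) = begin
    (2 + n) ^ k      ≤⟨ ^-monoˡ-≤ k sq ⟩
    (n ^ 2) ^ k      ≡⟨ ^-*-assoc n 2 k ⟩
    n ^ (2 * k)      ≤⟨ ^-monoʳ-≤ n (m≤m+n (2 * k) (3 ^ k)) ⟩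
    n ^ k'           ≤⟨ m≤m+n _ _ ⟩
    n ^ k' + k'      ∎
    where
    open ≤-Reasoning
    sq : 2 + n ≤ n ^ 2
    sq = begin
      2 + n      ≤⟨ +-monoˡ-≤ n (m≤m+n 2 i) ⟩
      n + n      ≡⟨ cong (n +_) (+-identityʳ n) ⟨
      2 * n      ≤⟨ *-monoˡ-≤ n (m≤m+n 2 i) ⟩
      n * n      ≡⟨ cong (n *_) (*-identityʳ n) ⟨
      n ^ 2      ∎

-- Programs

record Finite (A : Set) : Set where
  field
    elements : List A
    complete : ∀ a → a ∈ elements

  encode : A → Fin (length elements)
  encode a = index (complete a)

  decode : Fin (length elements) → A
  decode = lookup elements

  decode-encode : ∀ a → decode (encode a) ≡ a
  decode-encode a = sym (lookup-index (complete a))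

open Finite

⊎-finite : ∀ {A B : Set} → Finite A → Finite B → Finite (A ⊎ B)
⊎-finite FA FB .elements = map inj₁ (elements FA) ++ map inj₂ (elements FB)
⊎-finite FA FB .complete (inj₁ a) = ∈-++⁺ˡ (∈-map⁺ inj₁ (complete FA a))
⊎-finite FA FB .complete (inj₂ b) = ∈-++⁺ʳ _ (∈-map⁺ inj₂ (complete FB b))

Σ-finite : ∀ {A : Set} {B : A → Set} → Finite A → (∀ a → Finite (B a)) → Finite (Σ A B)
Σ-finite FA FB .elements = concatMap (λ a → map (a ,_) (elements (FB a))) (elements FA)
Σ-finite FA FB .complete (a , b) =
  ∈-concatMap⁺ _ (lose (complete FA a) (∈-map⁺ (a ,_) (complete (FB a) b)))

instance
  fin-⊥ : Finite ⊥
  fin-⊥ = record { elements = [] ; complete = λ () }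

  fin-⊤ : Finite ⊤
  fin-⊤ = record { elements = tt ∷ [] ; complete = λ _ → here refl }

  fin-Bool : Finite Bool
  fin-Bool .elements = true ∷ false ∷ []
  fin-Bool .complete true = here refl
  fin-Bool .complete false = there (here refl)

  fin-Sym : Finite Sym
  fin-Sym .elements = s0 ∷ s1 ∷ blank ∷ []
  fin-Sym .complete s0 = here refl
  fin-Sym .complete s1 = there (here refl)
  fin-Sym .complete blank = there (there (here refl))

  fin-Outcome : Finite Outcome
  fin-Outcome .elements = acc ∷ rej ∷ unk ∷ []
  fin-Outcome .complete acc = here refl
  fin-Outcome .complete rej = there (here refl)
  fin-Outcome .complete unk = there (there (here refl))

  fin-Move : Finite Move
  fin-Move .elements = moveL ∷ moveR ∷ stay ∷ []
  fin-Move .complete moveL = here refl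
  fin-Move .complete moveR = there (here refl)
  fin-Move .complete stay = there (there (here refl))

  fin-Fin : ∀ {n} → Finite (Fin n)
  fin-Fin .elements = allFin _
  fin-Fin .complete = ∈-allFin

  fin-Maybe : ∀ {A : Set} {{_ : Finite A}} → Finite (Maybe A)
  fin-Maybe {{F}} .elements = nothing ∷ map just (elements F)
  fin-Maybe {{F}} .complete nothing = here refl
  fin-Maybe {{F}} .complete (just a) = there (∈-map⁺ just (complete F a))

  fin-⊎ : ∀ {A B : Set} {{_ : Finite A}} {{_ : Finite B}} → Finite (A ⊎ B)
  fin-⊎ {{F}} {{G}} = ⊎-finite F G

  fin-× : ∀ {A B : Set} {{_ : Finite A}} {{_ : Finite B}} → Finite (A × B)
  fin-× {{F}} {{G}} = Σ-finite F (λ _ → G)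

-- The elementary operations are a parameter because the same command language serves two levels:
-- tape actions and stack operations.
record Sig : Set₁ where
  field
    Op       : Set
    Res      : Op → Set

infixl 1 _>>=_ _>>_

-- Every type whose values a program has to remember is finite, so that the program has finitely many control points.
data Cmd (S : Sig) : Set → Set₁ where
  ret   : ∀ {A} → A → Cmd S A
  op    : (o : Sig.Op S) → Cmd S (Sig.Res S o)
  _>>=_ : ∀ {A B} {{_ : Finite A}} → Cmd S A → (A → Cmd S B) → Cmd S B
  iter  : ∀ {A B} {{_ : Finite A}} → (A → Cmd S (A ⊎ B)) → A → Cmd S B

_>>_ : ∀ {S A B} {{_ : Finite A}} → Cmd S A → Cmd S B → Cmd S B
c >> d = c >>= λ _ → d

record Sem (S : Sig) : Set₁ where
  field
    St     : Set
    effect : (o : Sig.Op S) → St → Sig.Res S o × St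
    qword  : St → Word
    clearQ : St → St

-- The last index is an upper bound on the running time.
data Exec {S : Sig} (M : Sem S) : ∀ {A} → Cmd S A → Sem.St M → A → Sem.St M → ℕ → Set₁ where
  ret  : ∀ {A} {a : A} {σ} → Exec M (ret a) σ a σ 0
  op   : ∀ {o σ} → Exec M (op o) σ (proj₁ (Sem.effect M o σ)) (proj₂ (Sem.effect M o σ)) 1
  bind : ∀ {A B} {{_ : Finite A}} {c : Cmd S A} {f : A → Cmd S B} {a b σ σ₁ σ₂ m n} →
         Exec M c σ a σ₁ m → Exec M (f a) σ₁ b σ₂ n → Exec M (c >>= f) σ b σ₂ (m + n)
  stop : ∀ {A B} {{_ : Finite A}} {f : A → Cmd S (A ⊎ B)} {a b σ σ₁ n} →
         Exec M (f a) σ (inj₂ b) σ₁ n → Exec M (iter f a) σ b σ₁ (suc n)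
  more : ∀ {A B} {{_ : Finite A}} {f : A → Cmd S (A ⊎ B)} {a a₁ b σ σ₁ σ₂ m n} →
         Exec M (f a) σ (inj₁ a₁) σ₁ m → Exec M (iter f a₁) σ₁ b σ₂ n →
         Exec M (iter f a) σ b σ₂ (suc m + n)
  weak : ∀ {A} {c : Cmd S A} {a σ σ₁ m n} → m ≤ n → Exec M c σ a σ₁ m → Exec M c σ a σ₁ n

-- A machine has a single query state, so control cannot survive a query:
-- a body ends with a jump to another body, with the query state (inj₂ nothing) or by halting.
record Program (S : Sig) : Set₁ where
  field
    Label  : Set
    labels : Finite Label
    start  : Label
    answer : Bool → Label
    body   : Label → Cmd S (Label ⊎ Maybe Outcome)

data Run {S : Sig} (M : Sem S) (P : Program S) (D : Lang) : Program.Label P → Sem.St M → Outcome → ℕ → Set₁ where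
  jump   : ∀ {l l₁ σ σ₁ o m n} → Exec M (Program.body P l) σ (inj₁ l₁) σ₁ m →
           Run M P D l₁ σ₁ o n → Run M P D l σ o (suc m + n)
  inquire : ∀ {l σ σ₁ o m n} → Exec M (Program.body P l) σ (inj₂ nothing) σ₁ m →
           Run M P D (Program.answer P (D (Sem.qword M σ₁))) (Sem.clearQ M σ₁) o n → Run M P D l σ o (suc m + suc n)
  finish : ∀ {l σ σ₁ o m} → Exec M (Program.body P l) σ (inj₂ (just o)) σ₁ m → Run M P D l σ o (suc m)
  weaken : ∀ {l σ o m n} → m ≤ n → Run M P D l σ o m → Run M P D l σ o n

-- Programs as nondeterministic oracle Turing machines

data TOp : Set where
  act  : (Sym → Sym × Move × Maybe Bool) → TOp
  flip : TOp

TRes : TOp → Set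
TRes (act _) = Sym
TRes flip = Bool

TSig : Sig
TSig = record { Op = TOp ; Res = TRes }

TCmd : Set → Set₁
TCmd = Cmd TSig

-- The nondeterministic choices still to be made are part of the state; when they are used up, every further choice is false.
record TSt : Set where
  constructor tst
  field
    tp : Tape
    qw : Word
    om : List Bool
open TSt

nextFlip : List Bool → Bool × List Bool
nextFlip [] = false , []
nextFlip (b ∷ ω) = b , ω

doAct : ∀ {X : Set} → Tape → Word → List Bool → X × Sym × Move × Maybe Bool → X × TSt
doAct t w ω (x , s , m , mb) = x , tst (moveT m (writeT s t)) (appendQ mb w) ω

effectT : (o : TOp) → TSt → TRes o × TSt
effectT (act f) (tst t w ω) = doAct t w ω (Tape.head t , f (Tape.head t))
effectT flip (tst t w ω) = proj₁ (nextFlip ω) , tst t w (proj₂ (nextFlip ω))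

TSem : Sem TSig
TSem = record { St = TSt ; effect = effectT ; qword = qw ; clearQ = λ σ → record σ { qw = [] } }

data Instr (X : Set) : Set where
  actI  : (Sym → X × Sym × Move × Maybe Bool) → Instr X
  flipI : (Bool → X) → Instr X

mapI : ∀ {X Y} → (X → Y) → Instr X → Instr Y
mapI g (actI f) = actI (λ s → map₁ g (f s))
mapI g (flipI k) = flipI (λ b → g (k b))

nop : ∀ {X} → X → Instr X
nop x = actI (λ s → x , s , stay , nothing)

runI : ∀ {X} → Instr X → TSt → X × TSt
runI (actI f) (tst t w ω) = doAct t w ω (f (Tape.head t))
runI (flipI k) (tst t w ω) = k (proj₁ (nextFlip ω)) , tst t w (proj₂ (nextFlip ω))

runI-map : ∀ {X Y} (g : X → Y) i σ → runI (mapI g i) σ ≡ map₁ g (runI i σ)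
runI-map g (actI f) σ = refl
runI-map g (flipI k) σ = refl

-- The control points of a command, from which the machine states are made. A point inside the
-- second half of `>>=` carries the value computed by the first half, and a point inside a loop the
-- current loop value; this is where finiteness of the types enters. `nothing` marks the head of a
-- loop.
Pos : ∀ {A} → TCmd A → Set
Pos (ret _) = ⊥
Pos (op _) = ⊤
Pos (c >>= f) = Pos c ⊎ Σ _ (λ a → Pos (f a))
Pos (iter f _) = Σ _ (λ a → Maybe (Pos (f a)))

pos-finite : ∀ {A} (c : TCmd A) → Finite (Pos c)
pos-finite (ret _) = fin-⊥
pos-finite (op _) = fin-⊤
pos-finite (_>>=_ {{F}} c f) = ⊎-finite (pos-finite c) (Σ-finite F (λ a → pos-finite (f a)))
pos-finite (iter {{F}} f _) = Σ-finite F (λ a → fin-Maybe {{pos-finite (f a)}})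

bindPos : ∀ {A B} {{_ : Finite A}} (c : TCmd A) (f : A → TCmd B) (a : A) → B ⊎ Pos (f a) → B ⊎ Pos (c >>= f)
bindPos c f a (inj₁ b) = inj₁ b
bindPos c f a (inj₂ p) = inj₂ (inj₂ (a , p))

iterPos : ∀ {A B : Set} {{_ : Finite A}} (f : A → TCmd (A ⊎ B)) (a : A) →
          (A ⊎ B) ⊎ Pos (f a) → B ⊎ Σ A (λ a → Maybe (Pos (f a)))
iterPos f a (inj₁ (inj₁ a₁)) = inj₂ (a₁ , nothing)
iterPos f a (inj₁ (inj₂ b)) = inj₁ b
iterPos f a (inj₂ p) = inj₂ (a , just p)

entry : ∀ {A} (c : TCmd A) → A ⊎ Pos c
contPos : ∀ {A B} {{_ : Finite A}} (c : TCmd A) (f : A → TCmd B) → A ⊎ Pos c → B ⊎ Pos (c >>= f)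

entry (ret a) = inj₁ a
entry (op _) = inj₂ tt
entry (c >>= f) = contPos c f (entry c)
-- The loop head is a state of its own, executing a `nop`. Otherwise `entry` would have to follow a
-- body that returns at once without any operation, possibly forever.
entry (iter f a) = inj₂ (a , nothing)

contPos c f (inj₁ a) = bindPos c f a (entry (f a))
contPos c f (inj₂ p) = inj₂ (inj₁ p)

next : ∀ {A} (c : TCmd A) → Pos c → Instr (A ⊎ Pos c)
next (op (act f)) _ = actI (λ s → inj₁ s , f s)
next (op flip) _ = flipI inj₁
next (c >>= f) (inj₁ p) = mapI (contPos c f) (next c p)
next (c >>= f) (inj₂ (a , p)) = mapI (bindPos c f a) (next (f a) p)
next (iter f a₀) (a , nothing) = nop (iterPos f a (entry (f a)))
next (iter f a₀) (a , just p) = mapI (iterPos f a) (next (f a) p)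

acts : ∀ {X : Set} → Bool → Instr X → Sym → List⁺ (X × Sym × Move × Maybe Bool)
acts nd (actI f) s = f s ∷ []
acts nd (flipI k) s = (k false , s , stay , nothing) ∷ (if nd then (k true , s , stay , nothing) ∷ [] else [])

-- The deterministic machine keeps only the `false` branch of a flip, which is also what a run takes
-- once its choices are used up. Hence it corresponds to runs with the empty list.
Allowed : Bool → List Bool → Set
Allowed nd ω = nd ≡ false → ω ≡ []

acts-sound : ∀ {X : Set} nd (i : Instr X) t w ω → Allowed nd ω →
  ∃ λ a → ∃ λ ω₁ → a ∈ toList (acts nd i (Tape.head t)) × Allowed nd ω₁ × runI i (tst t w ω) ≡ doAct t w ω₁ a
acts-sound nd (actI f) t w ω al = _ , ω , here refl , al , refl
acts-sound nd (flipI k) t w [] al = _ , [] , here refl , al , refl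
acts-sound true (flipI k) t w (false ∷ ω) al = _ , ω , here refl , (λ ()) , refl
acts-sound true (flipI k) t w (true ∷ ω) al = _ , ω , there (here refl) , (λ ()) , refl
acts-sound false (flipI k) t w (_ ∷ ω) al with al refl
... | ()

acts-complete : ∀ {X : Set} nd (i : Instr X) t w {a} → a ∈ toList (acts nd i (Tape.head t)) →
  ∀ ω₁ → Allowed nd ω₁ → ∃ λ ω → Allowed nd ω × runI i (tst t w ω) ≡ doAct t w ω₁ a
acts-complete nd (actI f) t w (here refl) ω₁ al = ω₁ , al , refl
acts-complete true (flipI k) t w (here refl) ω₁ al = false ∷ ω₁ , (λ ()) , refl
acts-complete true (flipI k) t w (there (here refl)) ω₁ al = true ∷ ω₁ , (λ ()) , refl
acts-complete false (flipI k) t w (here refl) ω₁ al with al refl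
... | refl = [] , al , refl

module Compiled (P : Program TSig) (nd : Bool) where
  open Program P

  State : Set
  State = Σ Label (λ l → Maybe (Pos (body l))) ⊎ Maybe Outcome

  stateFinite : Finite State
  stateFinite = ⊎-finite (Σ-finite labels (λ l → fin-Maybe {{pos-finite (body l)}})) fin-Maybe

  private
    enc = encode stateFinite
    dec = decode stateFinite
    dec-enc = decode-encode stateFinite

  goto : ∀ l → (Label ⊎ Maybe Outcome) ⊎ Pos (body l) → State
  goto l (inj₁ (inj₁ l₁)) = inj₁ (l₁ , nothing)
  goto l (inj₁ (inj₂ o)) = inj₂ o
  goto l (inj₂ p) = inj₁ (l , just p)

  instr : Σ Label (λ l → Maybe (Pos (body l))) → Instr State
  instr (l , nothing) = nop (goto l (entry (body l)))
  instr (l , just p) = mapI (goto l) (next (body l) p)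

  δState : State → Sym → List⁺ (State × Sym × Move × Maybe Bool)
  δState (inj₁ p) s = acts nd (instr p) s
  δState (inj₂ o) s = (inj₂ o , s , stay , nothing) ∷ []

  haltState : State → Maybe Outcome
  haltState (inj₂ (just o)) = just o
  haltState _ = nothing

  machine : NOTM
  machine = record
    { Q = length (elements stateFinite)
    ; start = enc (inj₁ (start , nothing))
    ; halt = λ q → haltState (dec q)
    ; query = enc (inj₂ nothing)
    ; yesSt = enc (inj₁ (answer true , nothing))
    ; noSt = enc (inj₁ (answer false , nothing))
    ; δ = λ q s → L⁺.map (map₁ enc) (δState (dec q) s)
    }

  config : State → Tape → Word → Config machine
  config s t w = cfg (enc s) t w

  mstep : Lang → State → TSt → Maybe (State × TSt)
  mstep D (inj₁ p) σ = just (runI (instr p) σ)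
  mstep D (inj₂ nothing) σ = just (inj₁ (answer (D (qw σ)) , nothing) , record σ { qw = [] })
  mstep D (inj₂ (just o)) σ = nothing

  data Steps (D : Lang) : State → TSt → State → TSt → ℕ → Set where
    done : ∀ {s σ} → Steps D s σ s σ 0
    step : ∀ {s σ s₁ σ₁ s₂ σ₂ n} → mstep D s σ ≡ just (s₁ , σ₁) → Steps D s₁ σ₁ s₂ σ₂ n → Steps D s σ s₂ σ₂ (suc n)

  steps-++ : ∀ {D s σ s₁ σ₁ s₂ σ₂ m n} → Steps D s σ s₁ σ₁ m → Steps D s₁ σ₁ s₂ σ₂ n → Steps D s σ s₂ σ₂ (m + n)
  steps-++ done q = q
  steps-++ (step e p) q = step e (steps-++ p q)

  StepsWithin : Lang → State → TSt → State → TSt → ℕ → Set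
  StepsWithin D s σ s₁ σ₁ n = ∃ λ m → m ≤ n × Steps D s σ s₁ σ₁ m

  within-++ : ∀ {D s σ s₁ σ₁ s₂ σ₂ m n} → StepsWithin D s σ s₁ σ₁ m → StepsWithin D s₁ σ₁ s₂ σ₂ n → StepsWithin D s σ s₂ σ₂ (m + n)
  within-++ (_ , le , p) (_ , le₁ , q) = _ , +-mono-≤ le le₁ , steps-++ p q

  within-step : ∀ {D s σ s₁ σ₁ s₂ σ₂ n} → mstep D s σ ≡ just (s₁ , σ₁) → StepsWithin D s₁ σ₁ s₂ σ₂ n → StepsWithin D s σ s₂ σ₂ (suc n)
  within-step e (_ , le , p) = _ , s≤s le , step e p

  -- κ places the control points of a subprogram among the states of the whole machine.
  Follows : ∀ {A} → Lang → (c : TCmd A) → (A ⊎ Pos c → State) → Set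
  Follows D c κ = ∀ p σ → mstep D (κ (inj₂ p)) σ ≡ just (map₁ κ (runI (next c p) σ))

  mapI-step : ∀ {D : Lang} {X Y : Set} (g : X → Y) (κ : Y → State) (i : Instr X) {s : State} {σ} →
    mstep D s σ ≡ just (map₁ κ (runI (mapI g i) σ)) →
    mstep D s σ ≡ just (map₁ (λ x → κ (g x)) (runI i σ))
  mapI-step g κ i {σ = σ} e = trans e (cong (λ r → just (map₁ κ r)) (runI-map g i σ))

  exec-steps : ∀ {A D} {c : TCmd A} {σ a σ₁ n} → Exec TSem c σ a σ₁ n →
    (κ : A ⊎ Pos c → State) → Follows D c κ →
    StepsWithin D (κ (entry c)) σ (κ (inj₁ a)) σ₁ n
  iter-steps : ∀ {A B D} {{_ : Finite A}} {f : A → TCmd (A ⊎ B)} {a₀ a : A} {b : B} {σ σ₁ n} →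
    Exec TSem (iter f a) σ b σ₁ n →
    (κ : B ⊎ Pos (iter f a₀) → State) → Follows D (iter f a₀) κ →
    StepsWithin D (κ (inj₂ (a , nothing))) σ (κ (inj₁ b)) σ₁ n

  exec-steps ret κ F = 0 , z≤n , done
  exec-steps (op {act f} {σ}) κ F = 1 , ≤-refl , step (F tt σ) done
  exec-steps (op {flip} {σ}) κ F = 1 , ≤-refl , step (F tt σ) done
  exec-steps (bind {c = c} {f} {a} e e₁) κ F =
    within-++ (exec-steps e (λ x → κ (contPos c f x)) (λ p σ → mapI-step (contPos c f) κ (next c p) (F (inj₁ p) σ)))
              (exec-steps e₁ (λ x → κ (bindPos c f a x)) (λ p σ → mapI-step (bindPos c f a) κ (next (f a) p) (F (inj₂ (a , p)) σ)))
  exec-steps e@(stop _) κ F = iter-steps e κ F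
  exec-steps e@(more _ _) κ F = iter-steps e κ F
  exec-steps (weak le e) κ F with exec-steps e κ F
  ... | _ , le₁ , p = _ , ≤-trans le₁ le , p

  iter-steps {f = f} {a = a} (stop e) κ F =
    within-step (F (a , nothing) _)
      (exec-steps e (λ x → κ (iterPos f a x)) (λ p σ → mapI-step (iterPos f a) κ (next (f a) p) (F (a , just p) σ)))
  iter-steps {f = f} {a = a} (more e e₁) κ F =
    within-step (F (a , nothing) _) (within-++
      (exec-steps e (λ x → κ (iterPos f a x)) (λ p σ → mapI-step (iterPos f a) κ (next (f a) p) (F (a , just p) σ)))
      (iter-steps e₁ κ F))
  iter-steps (weak le e) κ F with iter-steps e κ F
  ... | _ , le₁ , p = _ , ≤-trans le₁ le , p

  body-steps : ∀ {D l σ r σ₁ n} → Exec TSem (body l) σ r σ₁ n →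
    StepsWithin D (inj₁ (l , nothing)) σ (goto l (inj₁ r)) σ₁ (suc n)
  body-steps {D} {l} e = within-step refl
    (exec-steps e (goto l) (λ p σ → cong just (runI-map (goto l) (next (body l) p) σ)))

  run-steps : ∀ {D l σ o n} → Run TSem P D l σ o n →
    ∃ λ σ₁ → StepsWithin D (inj₁ (l , nothing)) σ (inj₂ (just o)) σ₁ n
  run-steps (jump e r) = _ , within-++ (body-steps e) (proj₂ (run-steps r))
  run-steps (inquire e r) = _ , within-++ (body-steps e) (within-step refl (proj₂ (run-steps r)))
  run-steps (finish e) = _ , body-steps e
  run-steps (weaken le r) with run-steps r
  ... | _ , _ , le₁ , p = _ , _ , ≤-trans le₁ le , p

  succs-instr : ∀ D p t w → succs machine D (config (inj₁ p) t w) ≡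
    map (applyAct machine t w) (toList (L⁺.map (map₁ enc) (acts nd (instr p) (Tape.head t))))
  succs-instr D p t w with NOTM.halt machine (enc (inj₁ p)) in eq
  ... | just o with trans (sym eq) (cong haltState (dec-enc (inj₁ p)))
  ...   | ()
  succs-instr D p t w | nothing with enc (inj₁ p) ≟ enc (inj₂ nothing)
  ... | yes e with trans (sym (dec-enc (inj₁ p))) (trans (cong dec e) (dec-enc (inj₂ nothing)))
  ...   | ()
  succs-instr D p t w | nothing | no _ =
    cong (λ s → map (applyAct machine t w) (toList (L⁺.map (map₁ enc) (δState s (Tape.head t))))) (dec-enc (inj₁ p))

  if-answer : ∀ b → (if b then NOTM.yesSt machine else NOTM.noSt machine) ≡ enc (inj₁ (answer b , nothing))
  if-answer true = refl
  if-answer false = refl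

  succs-query : ∀ D t w → succs machine D (config (inj₂ nothing) t w) ≡ config (inj₁ (answer (D w) , nothing)) t [] ∷ []
  succs-query D t w with NOTM.halt machine (enc (inj₂ nothing)) in eq
  ... | just o with trans (sym eq) (cong haltState (dec-enc (inj₂ nothing)))
  ...   | ()
  succs-query D t w | nothing with enc (inj₂ nothing) ≟ enc (inj₂ nothing)
  ... | yes _ = cong (λ q → cfg q t [] ∷ []) (if-answer (D w))
  ... | no ne = ⊥-elim (ne refl)

  succs-halted : ∀ D o t w → succs machine D (config (inj₂ (just o)) t w) ≡ []
  succs-halted D o t w with NOTM.halt machine (enc (inj₂ (just o))) in eq
  ... | just _ = refl
  ... | nothing with trans (sym eq) (cong haltState (dec-enc (inj₂ (just o))))
  ...   | ()

  mstep-sound : ∀ D s t w ω {s₁ σ₁} → Allowed nd ω → mstep D s (tst t w ω) ≡ just (s₁ , σ₁) →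
    config s₁ (tp σ₁) (qw σ₁) ∈ succs machine D (config s t w) × Allowed nd (om σ₁)
  mstep-sound D (inj₁ p) t w ω al refl with runI (instr p) (tst t w ω) | acts-sound nd (instr p) t w ω al
  ... | _ | a , ω₁ , i , al₁ , refl =
    subst (_ ∈_) (sym (succs-instr D p t w)) (∈-map⁺ (applyAct machine t w) (∈-map⁺ (map₁ enc) i)) , al₁
  mstep-sound D (inj₂ nothing) t w ω al refl = subst (config (inj₁ (answer (D w) , nothing)) t [] ∈_) (sym (succs-query D t w)) (here refl) , al
  mstep-sound D (inj₂ (just _)) t w ω al ()

  steps-reaches : ∀ {D s t w ω s₁ σ₁ n} → Allowed nd ω → Steps D s (tst t w ω) s₁ σ₁ n →
    Reaches machine D (config s t w) (config s₁ (tp σ₁) (qw σ₁)) n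
  steps-reaches al done = done
  steps-reaches {D} {s} {t} {w} {ω} al (step e p) with mstep-sound D s t w ω al e
  ... | i , al₁ = step i (steps-reaches al₁ p)

  -- Choices are recovered from the end of a path: whatever list the rest of the path needs, a list
  -- for one step more is obtained from it.
  Preceded : Lang → State → Tape → Word → Config machine → Set
  Preceded D s t w c = Σ State λ s₁ → ∃ λ t₁ → ∃ λ w₁ → c ≡ config s₁ t₁ w₁ ×
    (∀ ω₁ → Allowed nd ω₁ → ∃ λ ω → Allowed nd ω × mstep D s (tst t w ω) ≡ just (s₁ , tst t₁ w₁ ω₁))

  succs-complete : ∀ D s t w {c} → c ∈ succs machine D (config s t w) → Preceded D s t w c
  succs-complete D (inj₁ p) t w i with ∈-map⁻ (applyAct machine t w) (subst (_ ∈_) (succs-instr D p t w) i)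
  ... | _ , i₁ , refl with ∈-map⁻ (map₁ enc) i₁
  ... | a , i₂ , refl = _ , _ , _ , refl , λ ω₁ al →
    let ω , al₁ , e = acts-complete nd (instr p) t w i₂ ω₁ al in ω , al₁ , cong just e
  succs-complete D (inj₂ nothing) t w i with subst (_ ∈_) (succs-query D t w) i
  ... | here refl = _ , _ , _ , refl , λ ω₁ al → ω₁ , al , refl
  succs-complete D (inj₂ (just o)) t w i with subst (_ ∈_) (succs-halted D o t w) i
  ... | ()

  reaches-steps : ∀ {D s t w c n} → Reaches machine D (config s t w) c n →
    ∃ λ ω → Allowed nd ω × Σ State λ s₁ → ∃ λ σ₁ → c ≡ config s₁ (tp σ₁) (qw σ₁) × Steps D s (tst t w ω) s₁ σ₁ n
  reaches-steps done = [] , (λ _ → refl) , _ , _ , refl , done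
  reaches-steps {D} {s} {t} {w} (step i r) with succs-complete D s t w i
  ... | s₁ , t₁ , w₁ , refl , pre with reaches-steps r
  ... | ω₁ , al₁ , s₂ , σ₂ , e , p with pre ω₁ al₁
  ... | ω , al , e₁ = ω , al , s₂ , σ₂ , e , step e₁ p

  -- With the choices in the state, `mstep` is a partial function, so any computation is a prefix of
  -- the one that halts. This gives the time bound and the uniqueness of the outcome at once.
  steps-before-halt : ∀ {D s σ o σ₁ s₂ σ₂ m n} → Steps D s σ (inj₂ (just o)) σ₁ m → Steps D s σ s₂ σ₂ n →
    n ≤ m × (∀ {o₂} → s₂ ≡ inj₂ (just o₂) → o₂ ≡ o)
  steps-before-halt done done = z≤n , λ { refl → refl }
  steps-before-halt done (step () _)
  steps-before-halt (step e p) done = z≤n , λ { refl → ⊥-elim (no-step e) }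
    where
    no-step : ∀ {A : Set} {x : A} → nothing ≡ just x → ⊥
    no-step ()
  steps-before-halt (step e p) (step e₁ q) with just-injective (trans (sym e) e₁)
  ... | refl with steps-before-halt p q
  ... | le , u = s≤s le , u

  halt-outcome : ∀ {s o} → haltState s ≡ just o → s ≡ inj₂ (just o)
  halt-outcome {inj₂ (just _)} refl = refl

  initial : Word → List Bool → TSt
  initial x ω = tst (initTape x) [] ω

  run-produces : ∀ {D x ω o n} → Allowed nd ω → Run TSem P D start (initial x ω) o n → Produces machine D x o
  run-produces al r with run-steps r
  ... | _ , _ , _ , p = _ , _ , steps-reaches al p , cong haltState (dec-enc (inj₂ (just _)))

  -- That a run exists for the recovered choices is left to the correctness proof of the program;
  -- its outcome is then forced to be that of the path.
  produces-run : ∀ {D x o} → Produces machine D x o →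
    ∃ λ ω → Allowed nd ω × (∀ {o₁ n} → Run TSem P D start (initial x ω) o₁ n → o₁ ≡ o)
  produces-run (c , n , r , h) with reaches-steps r
  ... | ω , al , s , σ , refl , p with halt-outcome (trans (cong haltState (sym (dec-enc s))) h)
  ... | refl = ω , al , λ run → sym (proj₂ (steps-before-halt (proj₂ (proj₂ (proj₂ (run-steps run)))) p) refl)

  -- Every path is an initial part of the run under the choices made along it, so terminating runs
  -- for all allowed choices bound all paths.
  run-bounds : ∀ (t : ℕ → ℕ) → (∀ D x ω → Allowed nd ω → ∃ λ o → Run TSem P D start (initial x ω) o (t (length x))) →
    ∀ D x c n → Reaches machine D (initCfg machine x) c n → n ≤ t (length x)
  run-bounds t total D x c n r with reaches-steps r
  ... | ω , al , _ , _ , _ , p with total D x ω al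
  ... | o , run with run-steps run
  ... | _ , m , le , p₁ = ≤-trans (proj₁ (steps-before-halt p₁ p)) le

compiled-deterministic : ∀ P → Deterministic (Compiled.machine P false)
compiled-deterministic P q s with decode (Compiled.stateFinite P false) q
... | inj₂ _ = refl
... | inj₁ p with Compiled.instr P false p
...   | actI _ = refl
...   | flipI _ = refl

-- Stacks on a tape

-- Blank beyond the end of the list, so that explicit and implicit blanks are the same tape content.
cell : List Sym → ℕ → Sym
cell [] _ = blank
cell (s ∷ _) zero = s
cell (_ ∷ l) (suc d) = cell l d

-- Cell 0 lies at the right end and the numbers increase to the left; nothing is said about cells further to the right.
record At (t : Tape) (F : ℕ → Sym) (p : ℕ) : Set where
  field
    at-head  : Tape.head t ≡ F p
    at-left  : ∀ d → cell (Tape.left t) d ≡ F (suc (p + d))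
    at-right : ∀ d e → p ≡ suc (d + e) → cell (Tape.right t) d ≡ F e
open At

at-moveL : ∀ {t F p} → At t F p → At (moveT moveL t) F (suc p)
at-moveL {tape l h r} {F} {p} A = go l (at-head A) (at-left A) (at-right A)
  where
  rights : h ≡ F p → (∀ d e → p ≡ suc (d + e) → cell r d ≡ F e) →
           ∀ d e → suc p ≡ suc (d + e) → cell (h ∷ r) d ≡ F e
  rights hd rt zero e refl = hd
  rights hd rt (suc d) e eq = rt d e (cong pred eq)
  go : ∀ l → h ≡ F p → (∀ d → cell l d ≡ F (suc (p + d))) → (∀ d e → p ≡ suc (d + e) → cell r d ≡ F e) →
       At (moveT moveL (tape l h r)) F (suc p)
  go [] hd lf rt = record
    { at-head = trans (lf 0) (cong (F ∘ suc) (+-identityʳ p))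
    ; at-left = λ d → trans (lf (suc d)) (cong (F ∘ suc) (+-suc p d))
    ; at-right = rights hd rt }
  go (x ∷ l) hd lf rt = record
    { at-head = trans (lf 0) (cong (F ∘ suc) (+-identityʳ p))
    ; at-left = λ d → trans (lf (suc d)) (cong (F ∘ suc) (+-suc p d))
    ; at-right = rights hd rt }

at-moveR : ∀ {t F p} → At t F (suc p) → At (moveT moveR t) F p
at-moveR {tape l h r} {F} {p} A = go r (at-right A)
  where
  lefts : ∀ d → cell (h ∷ l) d ≡ F (suc (p + d))
  lefts zero = trans (at-head A) (cong (F ∘ suc) (sym (+-identityʳ p)))
  lefts (suc d) = trans (at-left A d) (cong (F ∘ suc) (sym (+-suc p d)))
  go : ∀ r → (∀ d e → suc p ≡ suc (d + e) → cell r d ≡ F e) → At (moveT moveR (tape l h r)) F p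
  go [] rt = record { at-head = rt 0 p refl ; at-left = lefts ; at-right = λ d e eq → rt (suc d) e (cong suc eq) }
  go (x ∷ r) rt = record { at-head = rt 0 p refl ; at-left = lefts ; at-right = λ d e eq → rt (suc d) e (cong suc eq) }

at-write : ∀ {t F F₁ p s} → At t F p → F₁ p ≡ s → (∀ e → e ≢ p → F₁ e ≡ F e) → At (writeT s t) F₁ p
at-write {tape l h r} {p = p} A here-s else-F = record
  { at-head = sym here-s
  ; at-left = λ d → trans (at-left A d) (sym (else-F _ λ eq → m≢1+m+n p (sym eq)))
  ; at-right = λ d e eq → trans (at-right A d e eq) (sym (else-F e λ { refl → m≢1+n+m e eq })) }

-- A timed Hoare triple over tape content and head position, for code that leaves the query word and
-- the choices alone.
TH : ∀ {A} → TCmd A → (ℕ → Sym) → ℕ → A → (ℕ → Sym) → ℕ → ℕ → Set₁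
TH c F p a F₁ p₁ n = ∀ {t w ω} → At t F p → ∃ λ t₁ → At t₁ F₁ p₁ × Exec TSem c (tst t w ω) a (tst t₁ w ω) n

infixl 1 _∙_
_∙_ : ∀ {A B} {{_ : Finite A}} {c : TCmd A} {f : A → TCmd B} {F p a F₁ p₁ b F₂ p₂ m n} →
      TH c F p a F₁ p₁ m → TH (f a) F₁ p₁ b F₂ p₂ n → TH (c >>= f) F p b F₂ p₂ (m + n)
(h ∙ k) A with h A
... | _ , A₁ , e with k A₁
... | _ , A₂ , e₁ = _ , A₂ , bind e e₁

th-weak : ∀ {A} {c : TCmd A} {F p a F₁ p₁ m n} → m ≤ n → TH c F p a F₁ p₁ m → TH c F p a F₁ p₁ n
th-weak le h A with h A
... | _ , A₁ , e = _ , A₁ , weak le e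

th-stop : ∀ {A B} {{_ : Finite A}} {f : A → TCmd (A ⊎ B)} {a b F p F₁ p₁ n} →
  TH (f a) F p (inj₂ b) F₁ p₁ n → TH (iter f a) F p b F₁ p₁ (suc n)
th-stop h A with h A
... | _ , A₁ , e = _ , A₁ , stop e

th-more : ∀ {A B} {{_ : Finite A}} {f : A → TCmd (A ⊎ B)} {a a₁ b F p F₁ p₁ F₂ p₂ m n} →
  TH (f a) F p (inj₁ a₁) F₁ p₁ m → TH (iter f a₁) F₁ p₁ b F₂ p₂ n → TH (iter f a) F p b F₂ p₂ (suc m + n)
th-more h k A with h A
... | _ , A₁ , e with k A₁
... | _ , A₂ , e₁ = _ , A₂ , more e e₁

th-ret : ∀ {A} {a : A} {F p} → TH (ret a) F p a F p 0
th-ret A = _ , A , ret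

goBy : Move → TCmd Sym
goBy m = op (act λ s → s , m , nothing)

put : Sym → TCmd Sym
put s = op (act λ _ → s , stay , nothing)

th-left : ∀ {F p s} → F p ≡ s → TH (goBy moveL) F p s F (suc p) 1
th-left e {tape l h r} A with trans (at-head A) e
... | refl = _ , at-moveL A , op

th-right : ∀ {F p s} → F (suc p) ≡ s → TH (goBy moveR) F (suc p) s F p 1
th-right e {tape l h r} A with trans (at-head A) e
... | refl = _ , at-moveR A , op

th-read : ∀ {F p s} → F p ≡ s → TH (goBy stay) F p s F p 1
th-read e {tape l h r} A with trans (at-head A) e
... | refl = _ , A , op

th-put : ∀ {F F₁ p s s₁} → F p ≡ s → F₁ p ≡ s₁ → (∀ e → e ≢ p → F₁ e ≡ F e) → TH (put s₁) F p s F₁ p 1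
th-put e here-s else-F {tape l h r} A with trans (at-head A) e
... | refl = _ , at-write A here-s else-F , op

moves : Move → ℕ → TCmd ⊤
moves m zero = ret tt
moves m (suc k) = goBy m >> moves m k

th-lefts : ∀ k {F p} → TH (moves moveL k) F p tt F (k + p) k
th-lefts zero = th-ret
th-lefts (suc k) {F} {p} = subst (λ q → TH (moves moveL (suc k)) F p tt F q (suc k)) (+-suc k p) (th-left refl ∙ th-lefts k)

th-rights : ∀ k {F p} → TH (moves moveR k) F (k + p) tt F p k
th-rights zero = th-ret
th-rights (suc k) = th-right refl ∙ th-rights k

-- The index counts from the bottom of the stack, which is the end of the list, so that a push or a
-- pop affects a single cell.
nthB : List Bool → ℕ → Sym
nthB [] j = blank
nthB (b ∷ s) j with j ℕ.≟ length s
... | yes _ = bitSym b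
... | no _ = nthB s j

nthB-top : ∀ b s → nthB (b ∷ s) (length s) ≡ bitSym b
nthB-top b s with length s ℕ.≟ length s
... | yes _ = refl
... | no ne = ⊥-elim (ne refl)

nthB-below : ∀ b s {j} → j ≢ length s → nthB (b ∷ s) j ≡ nthB s j
nthB-below b s {j} ne with j ℕ.≟ length s
... | yes e = ⊥-elim (ne e)
... | no _ = refl

nthB-blank : ∀ s {j} → length s ≤ j → nthB s j ≡ blank
nthB-blank [] le = refl
nthB-blank (b ∷ s) le = trans (nthB-below b s λ { refl → <-irrefl refl le }) (nthB-blank s (≤-trans (n≤1+n _) le))

nthB-bit : ∀ s {j} → j < length s → ∃ λ b → nthB s j ≡ bitSym b
nthB-bit (b ∷ s) {j} lt with j ℕ.≟ length s
... | yes _ = b , refl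
... | no ne = nthB-bit s (≤∧≢⇒< (≤-pred lt) ne)

record TrackCode : Set₁ where
  field enter up down leave : TCmd ⊤

-- `scanUp` tests before it moves, since on an empty stack it starts on the blank it looks for.
-- `scanDown` moves before it tests, since after a pop it starts on a cell that has just become
-- blank.
scanUp scanDown : TCmd ⊤ → TCmd ⊤
scanUp up = iter (λ _ → goBy stay >>= λ { blank → ret (inj₂ tt) ; _ → up >> ret (inj₁ tt) }) tt
scanDown down = iter (λ _ → down >> goBy stay >>= λ { blank → ret (inj₂ tt) ; _ → ret (inj₁ tt) }) tt

module _ (T : TrackCode) where
  open TrackCode T

  pushCode : Bool → TCmd ⊤
  pushCode b = enter >> (scanUp up >> (put (bitSym b) >> (scanDown down >> leave)))

  popResult : Sym → TCmd (Maybe Bool)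
  popResult blank = leave >> ret nothing
  popResult s0 = scanDown down >> (leave >> ret (just false))
  popResult s1 = scanDown down >> (leave >> ret (just true))

  -- One cell below the first blank lies the top symbol or, if the stack is empty, the sentinel.
  -- Reading a blank there therefore means an empty stack, and writing a blank there changes
  -- nothing.
  popCode : TCmd (Maybe Bool)
  popCode = enter >> (scanUp up >> (down >> (put blank >>= popResult)))

-- Cell pos 0 is a blank sentinel and cell pos (suc j) holds the j-th symbol from the bottom.
record Track (home c : ℕ) : Set₁ where
  field
    code     : TrackCode
    pos      : ℕ → ℕ
    Valid    : ℕ → Set
    valid↓   : ∀ {j} → Valid (suc j) → Valid j
    pos-inj  : ∀ {i j} → Valid i → Valid j → pos i ≡ pos j → i ≡ j
  open TrackCode code public
  field
    th-enter : ∀ {F} → Valid 1 → TH enter F home tt F (pos 1) c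
    th-up    : ∀ {F j} → Valid (2 + j) → TH up F (pos (1 + j)) tt F (pos (2 + j)) c
    th-down  : ∀ {F j} → Valid (1 + j) → TH down F (pos (1 + j)) tt F (pos j) c
    th-leave : ∀ {F} → TH leave F (pos 0) tt F home c

module _ {home c} (T : Track home c) where
  open Track T

  -- `cells` covers all valid cells, so those above the top are blank; `room` guarantees that there
  -- is one, on which `scanUp` stops.
  record Holds (F : ℕ → Sym) (s : List Bool) : Set where
    field
      sentinel : F (pos 0) ≡ blank
      cells    : ∀ j → Valid (suc j) → F (pos (suc j)) ≡ nthB s j
      room     : Valid (suc (length s))
  open Holds

  valid-≤ : ∀ {i j} → i ≤ j → Valid j → Valid i
  valid-≤ le = go (≤⇒≤′ le)
    where
    go : ∀ {i j} → i ≤′ j → Valid j → Valid i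
    go ≤′-refl v = v
    go (≤′-step le) v = go le (valid↓ v)

  scanBound : ℕ → ℕ
  scanBound H = H * suc (suc c) + suc (suc c)

  scanBound-mono : ∀ {d H} → d ≤ H → scanBound d ≤ scanBound H
  scanBound-mono le = +-monoˡ-≤ (suc (suc c)) (*-monoˡ-≤ (suc (suc c)) le)

  th-scanUp : ∀ {F s} d {j} → Holds F s → d + j ≡ length s →
    TH (scanUp up) F (pos (suc j)) tt F (pos (suc (length s))) (scanBound d)
  th-scanUp {F} {s} zero {j} h refl = th-weak (s≤s (s≤s z≤n))
    (th-stop (th-read (trans (cells h j (room h)) (nthB-blank s ≤-refl)) ∙ th-ret))
  th-scanUp {F} {s} (suc d) {j} h eq with nthB-bit s {j} (subst (suc j ≤_) eq (s≤s (m≤n+m j d)))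
  ... | b , e = th-weak (≤-reflexive (trans (cong (λ x → 2 + (x + scanBound d)) (+-identityʳ c)) (cong (2 +_) (sym (+-assoc c (d * suc (suc c)) _))))) (th-more (nonblank b e) (th-scanUp d h (trans (+-suc d j) eq)))
    where
    v : Valid (2 + j)
    v = valid-≤ (s≤s (subst (suc j ≤_) eq (s≤s (m≤n+m j d)))) (room h)
    nonblank : ∀ b → nthB s j ≡ bitSym b → TH _ F (pos (suc j)) (inj₁ tt) F (pos (2 + j)) (1 + (c + 0))
    nonblank false e = th-read (trans (cells h j (valid↓ v)) e) ∙ (th-up v ∙ th-ret)
    nonblank true e = th-read (trans (cells h j (valid↓ v)) e) ∙ (th-up v ∙ th-ret)

  th-scanDown : ∀ {F s} j → Holds F s → j ≤ length s →
    TH (scanDown down) F (pos (suc j)) tt F (pos 0) (scanBound j)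
  th-scanDown zero h le = th-weak (≤-reflexive (cong suc (trans (+-assoc c 1 0) (+-comm c 1))))
    (th-stop (th-down (valid-≤ (s≤s le) (room h)) ∙ th-read (sentinel h) ∙ th-ret))
  th-scanDown {F} {s} (suc j) h le with nthB-bit s {j} le
  ... | b , e = th-weak (≤-reflexive (trans (cong (λ x → 1 + (x + scanBound j)) (trans (+-assoc c 1 0) (+-comm c 1))) (cong (2 +_) (sym (+-assoc c (j * suc (suc c)) _))))) (th-more (nonblank b e) (th-scanDown j h (≤-trans (n≤1+n j) le)))
    where
    v : Valid (2 + j)
    v = valid-≤ (s≤s le) (room h)
    nonblank : ∀ b → nthB s j ≡ bitSym b → TH _ F (pos (2 + j)) (inj₁ tt) F (pos (suc j)) ((c + 1) + 0)
    nonblank false e = th-down v ∙ th-read (trans (cells h j (valid↓ v)) e) ∙ th-ret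
    nonblank true e = th-down v ∙ th-read (trans (cells h j (valid↓ v)) e) ∙ th-ret

  opBound : ℕ → ℕ
  opBound H = c + (scanBound H + (c + (1 + (scanBound H + (c + 0)))))

  th-push : ∀ {F F₁ s H} b → Holds F s → Holds F₁ (b ∷ s) → length s ≤ H →
    (∀ e → e ≢ pos (suc (length s)) → F₁ e ≡ F e) →
    TH (pushCode code b) F home tt F₁ home (opBound H)
  th-push {F} {F₁} {s} {H} b h h₁ le same = th-weak bound
    (th-enter (valid-≤ (s≤s z≤n) (room h)) ∙ (th-scanUp (length s) h (+-identityʳ _) ∙
      (th-put refl (trans (cells h₁ (length s) (room h)) (nthB-top b s)) same ∙
        (th-scanDown (length s) h₁ (n≤1+n _) ∙ th-leave))))
    where
    bound : c + (scanBound (length s) + (1 + (scanBound (length s) + c))) ≤ opBound H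
    bound = +-monoʳ-≤ c (+-mono-≤ (scanBound-mono le) (≤-trans (s≤s (+-mono-≤ (scanBound-mono le) (≤-reflexive (sym (+-identityʳ c))))) (m≤n+m _ c)))

  th-pop-empty : ∀ {F H} → Holds F [] → TH (popCode code) F home nothing F home (opBound H)
  th-pop-empty {F} {H} h = th-weak bound
    (th-enter (room h) ∙ (th-scanUp 0 h refl ∙ (th-down (room h) ∙
      (th-put (sentinel h) (sentinel h) (λ _ _ → refl) ∙ (th-leave ∙ th-ret)))))
    where
    bound : c + (scanBound 0 + (c + (1 + (c + 0)))) ≤ opBound H
    bound = +-monoʳ-≤ c (+-mono-≤ (scanBound-mono {0} {H} z≤n) (+-monoʳ-≤ c (s≤s (m≤n+m (c + 0) (scanBound H)))))

  th-pop : ∀ {F F₁ b s H} → Holds F (b ∷ s) → Holds F₁ s → length s < H →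
    (∀ e → e ≢ pos (suc (length s)) → F₁ e ≡ F e) →
    TH (popCode code) F home (just b) F₁ home (opBound H)
  th-pop {F} {F₁} {b} {s} {H} h h₁ lt same = th-weak bound
    (th-enter (valid-≤ (s≤s z≤n) (room h)) ∙ (th-scanUp (suc (length s)) h (+-identityʳ _) ∙ (th-down (room h) ∙
      (th-put (trans (cells h (length s) (room h₁)) (nthB-top b s)) (trans (cells h₁ (length s) (room h₁)) (nthB-blank s ≤-refl)) same ∙ result b))))
    where
    result : ∀ b → TH (popResult code (bitSym b)) F₁ (pos (suc (length s))) (just b) F₁ home (scanBound (length s) + (c + 0))
    result false = th-scanDown (length s) h₁ ≤-refl ∙ (th-leave ∙ th-ret)
    result true = th-scanDown (length s) h₁ ≤-refl ∙ (th-leave ∙ th-ret)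
    bound : c + (scanBound (suc (length s)) + (c + (1 + (scanBound (length s) + (c + 0))))) ≤ opBound H
    bound = +-monoʳ-≤ c (+-mono-≤ (scanBound-mono lt) (+-monoʳ-≤ c (s≤s (+-monoˡ-≤ _ (scanBound-mono (≤-trans (n≤1+n _) lt))))))

overwrite : (ℕ → Sym) → ℕ → Sym → ℕ → Sym
overwrite F p s e with e ℕ.≟ p
... | yes _ = s
... | no _ = F e

overwrite-here : ∀ F p s → overwrite F p s p ≡ s
overwrite-here F p s with p ℕ.≟ p
... | yes _ = refl
... | no ne = ⊥-elim (ne refl)

overwrite-other : ∀ F p s e → e ≢ p → overwrite F p s e ≡ F e
overwrite-other F p s e ne with e ℕ.≟ p
... | yes eq = ⊥-elim (ne eq)
... | no _ = refl

module _ {home c} (T : Track home c) where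
  open Track T
  open Holds

  holds-elsewhere : ∀ {F F₁ s p} → Holds T F s → (∀ j → Valid j → pos j ≢ p) → (∀ e → e ≢ p → F₁ e ≡ F e) → Holds T F₁ s
  holds-elsewhere h ne same = record
    { sentinel = trans (same _ (ne 0 (valid-≤ T z≤n (room h)))) (sentinel h)
    ; cells = λ j v → trans (same _ (ne (suc j) v)) (cells h j v)
    ; room = room h }

  top : List Bool → ℕ
  top s = pos (suc (length s))

  holds-push : ∀ {F s} b → Holds T F s → Valid (2 + length s) → Holds T (overwrite F (top s) (bitSym b)) (b ∷ s)
  holds-push {F} {s} b h v = record
    { sentinel = trans (overwrite-other F _ _ _ (λ e → 0≢1+n (pos-inj (valid-≤ T z≤n v) (room h) e))) (sentinel h)
    ; cells = cells₁
    ; room = v }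
    where
    cells₁ : ∀ j → Valid (suc j) → overwrite F (top s) (bitSym b) (pos (suc j)) ≡ nthB (b ∷ s) j
    cells₁ j w with j ℕ.≟ length s
    ... | yes refl = overwrite-here F (top s) (bitSym b)
    ... | no ne = trans (overwrite-other F _ _ _ (λ e → ne (cong pred (pos-inj w (room h) e)))) (cells h j w)

  holds-pop : ∀ {F s b} → Holds T F (b ∷ s) → Holds T (overwrite F (top s) blank) s
  holds-pop {F} {s} {b} h = record
    { sentinel = trans (overwrite-other F _ _ _ (λ e → 0≢1+n (pos-inj (valid-≤ T z≤n (room h)) (valid↓ (room h)) e))) (sentinel h)
    ; cells = cells₁
    ; room = valid↓ (room h) }
    where
    cells₁ : ∀ j → Valid (suc j) → overwrite F (top s) blank (pos (suc j)) ≡ nthB s j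
    cells₁ j w with j ℕ.≟ length s
    ... | yes refl = trans (overwrite-here F (top s) blank) (sym (nthB-blank s ≤-refl))
    ... | no ne = trans (overwrite-other F _ _ _ (λ e → ne (cong pred (pos-inj w (valid↓ (room h)) e))))
                    (trans (cells h j w) (nthB-below b s ne))

-- Uniqueness of quotient and remainder. It separates the cells of the interleaved stacks from each
-- other.
digits-unique : ∀ {K} i j (a b : Fin K) → i * K + toℕ a ≡ j * K + toℕ b → i ≡ j × a ≡ b
digits-unique zero zero a b e = refl , toℕ-injective e
digits-unique {K} zero (suc j) a b e =
  ⊥-elim (<-irrefl e (<-≤-trans (toℕ<n a) (≤-trans (m≤m+n K (j * K)) (m≤m+n (K + j * K) (toℕ b)))))
digits-unique {K} (suc i) zero a b e =
  ⊥-elim (<-irrefl (sym e) (<-≤-trans (toℕ<n b) (≤-trans (m≤m+n K (i * K)) (m≤m+n (K + i * K) (toℕ a)))))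
digits-unique {K} (suc i) (suc j) a b e with digits-unique i j a b
  (+-cancelˡ-≡ K _ _ (trans (sym (+-assoc K (i * K) (toℕ a))) (trans e (+-assoc K (j * K) (toℕ b)))))
... | refl , q = refl , q

-- Stack programs and the growth of their stacks

data SOp (K : ℕ) : Set where
  push     : Fin K → Bool → SOp K
  pop      : Fin K → SOp K
  popInput : SOp K
  choose   : SOp K
  emit     : Bool → SOp K

SRes : ∀ {K} → SOp K → Set
SRes (push _ _) = ⊤
SRes (pop _) = Maybe Bool
SRes popInput = Maybe Bool
SRes choose = Bool
SRes (emit _) = ⊤

SSig : ℕ → Sig
SSig K = record { Op = SOp K ; Res = SRes }

SCmd : ℕ → Set → Set₁
SCmd K = Cmd (SSig K)

-- The input is a stack that can only be popped; its top is the last input bit.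
record SSt (K : ℕ) : Set where
  constructor sst
  field
    stacks : Vec (List Bool) K
    input  : List Bool
    word   : Word
    flips  : List Bool
open SSt

popStack : ∀ {K} → Fin K → List Bool → SSt K → Maybe Bool × SSt K
popStack i [] σ = nothing , σ
popStack i (b ∷ s) σ = just b , record σ { stacks = stacks σ [ i ]≔ s }

popIn : ∀ {K} → List Bool → SSt K → Maybe Bool × SSt K
popIn [] σ = nothing , σ
popIn (b ∷ s) σ = just b , record σ { input = s }

effectS : ∀ {K} (o : SOp K) → SSt K → SRes o × SSt K
effectS (push i b) σ = tt , record σ { stacks = stacks σ [ i ]≔ (b ∷ Vec.lookup (stacks σ) i) }
effectS (pop i) σ = popStack i (Vec.lookup (stacks σ) i) σ
effectS popInput σ = popIn (input σ) σ
effectS choose σ = proj₁ (nextFlip (flips σ)) , record σ { flips = proj₂ (nextFlip (flips σ)) }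
effectS (emit b) σ = tt , record σ { word = word σ ++ (b ∷ []) }

SSem : ∀ K → Sem (SSig K)
SSem K = record { St = SSt K ; effect = effectS ; qword = word ; clearQ = λ σ → record σ { word = [] } }

ExecS : ∀ {K A} → SCmd K A → SSt K → A → SSt K → ℕ → Set₁
ExecS {K} = Exec (SSem K)

ends : ∀ {K A} {c : SCmd K A} {σ a σ₁ σ₂ n} → σ₁ ≡ σ₂ → ExecS c σ a σ₁ n → ExecS c σ a σ₂ n
ends refl d = d

returns : ∀ {K A} {c : SCmd K A} {σ a b σ₁ n} → a ≡ b → ExecS c σ a σ₁ n → ExecS c σ b σ₁ n
returns refl d = d

record Small {K} (h : ℕ) (σ : SSt K) : Set where
  field
    small-stacks : ∀ i → length (Vec.lookup (stacks σ) i) ≤ h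
    small-input  : length (input σ) ≤ h
open Small

small-weak : ∀ {K h h₁} {σ : SSt K} → h ≤ h₁ → Small h σ → Small h₁ σ
small-weak le S = record { small-stacks = λ i → ≤-trans (small-stacks S i) le ; small-input = ≤-trans (small-input S) le }

small-update : ∀ {K h} {σ : SSt K} i s → Small h σ → length s ≤ h → Small h (record σ { stacks = stacks σ [ i ]≔ s })
small-update {h = h} {σ} i s S le = record { small-stacks = go ; small-input = small-input S }
  where
  go : ∀ i₁ → length (Vec.lookup (stacks σ [ i ]≔ s) i₁) ≤ h
  go i₁ with i₁ ≟ i
  ... | yes refl = subst (λ l → length l ≤ h) (sym (Vec.lookup∘updateAt i (stacks σ))) le
  ... | no ne = subst (λ l → length l ≤ h) (sym (Vec.lookup∘updateAt′ i₁ i ne (stacks σ))) (small-stacks S i₁)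

small-op : ∀ {K} (o : SOp K) {h σ} → Small h σ → Small (h + 1) (proj₂ (effectS o σ))
small-op (push i b) {h} S =
  small-update i _ (small-weak (m≤m+n h 1) S) (≤-trans (s≤s (small-stacks S i)) (≤-reflexive (+-comm 1 h)))
small-op (pop i) {h} {σ} S with Vec.lookup (stacks σ) i | small-stacks S i
... | [] | _ = small-weak (m≤m+n h 1) S
... | b ∷ s | le = small-update i s (small-weak (m≤m+n h 1) S) (≤-trans (n≤1+n _) (≤-trans le (m≤m+n h 1)))
small-op popInput {h} {σ} S with input σ in eq | small-input S
... | [] | _ = small-weak (m≤m+n h 1) S
... | b ∷ s | le = record
  { small-stacks = λ i → ≤-trans (small-stacks S i) (m≤m+n h 1) ; small-input = ≤-trans (n≤1+n _) (≤-trans le (m≤m+n h 1)) }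
small-op choose {h} S = record { small-stacks = small-stacks S₁ ; small-input = small-input S₁ }
  where S₁ = small-weak (m≤m+n h 1) S
small-op (emit b) {h} S = record { small-stacks = small-stacks S₁ ; small-input = small-input S₁ }
  where S₁ = small-weak (m≤m+n h 1) S

-- A step pushes at most one symbol, so running time bounds growth. The heights in turn bound the
-- cost of a single stack operation on the tape.
small-exec : ∀ {K A} {c : SCmd K A} {σ a σ₁ m} → ExecS c σ a σ₁ m → ∀ {h} → Small h σ → Small (h + m) σ₁
small-exec ret {h} S = small-weak (m≤m+n h 0) S
small-exec (op {o}) S = small-op o S
small-exec (bind {m = m} {n} e e₁) {h} S = small-weak (≤-reflexive (+-assoc h m n)) (small-exec e₁ (small-exec e S))
small-exec (stop {n = m} e) {h} S = small-weak (+-monoʳ-≤ h (n≤1+n m)) (small-exec e S)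
small-exec (more {m = m} {n} e e₁) {h} S =
  small-weak (≤-trans (≤-reflexive (+-assoc h m n)) (+-monoʳ-≤ h (n≤1+n _))) (small-exec e₁ (small-exec e S))
small-exec (weak le e) {h} S = small-weak (+-monoʳ-≤ h le) (small-exec e S)

-- Translation of stack programs into tape programs

inputCode : TrackCode
inputCode = record { enter = moves moveR 1 ; up = moves moveR 1 ; down = moves moveL 1 ; leave = moves moveL 0 }

stackCode : ∀ {K} → Fin K → TrackCode
stackCode {K} i = record { enter = moves moveL (K + toℕ i) ; up = moves moveL K ; down = moves moveR K ; leave = moves moveR (toℕ i) }

opCode : ∀ {K} (o : SOp K) → TCmd (SRes o)
opCode (push i b) = pushCode (stackCode i) b
opCode (pop i) = popCode (stackCode i)
opCode popInput = popCode inputCode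
opCode choose = op flip
opCode (emit b) = op (act λ s → s , stay , just b) >> ret tt

lower : ∀ {K A} → SCmd K A → TCmd A
lower (ret a) = ret a
lower (op o) = opCode o
lower (c >>= f) = lower c >>= λ a → lower (f a)
lower (iter f a) = iter (λ a → lower (f a)) a

th-moved : ∀ {A} {c : TCmd A} {a F p p₁ q q₁ n} → p ≡ p₁ → q ≡ q₁ → TH c F p a F q n → TH c F p₁ a F q₁ n
th-moved refl refl h = h

-- The head rests at home. To the left the stacks are interleaved, cell j of stack i at distance (j + 1) * K + i, after a
-- sentinel row of K blanks; to the right lies the input. So the initial tape, one cell to the left, encodes empty stacks.
module Layout (K n : ℕ) where
  home = suc n
  pace = suc (K + K)

  -- The last valid cell, at position 0, is the blank behind the input. So the track has room for n
  -- symbols, the input and nothing more, and supports popping only.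
  inputTrack : Track home pace
  inputTrack = record
    { code = inputCode
    ; pos = home ∸_
    ; Valid = _≤ home
    ; valid↓ = ≤-trans (n≤1+n _)
    ; pos-inj = ∸-cancelˡ-≡
    ; th-enter = λ _ → th-weak (s≤s z≤n) (th-rights 1)
    ; th-up = λ {F} {j} v → th-weak (s≤s z≤n) (th-moved {F = F} (sym (+-∸-assoc 1 (≤-pred v))) refl (th-rights 1))
    ; th-down = λ {F} {j} v → th-weak (s≤s z≤n) (th-moved {F = F} refl (sym (+-∸-assoc 1 (≤-pred v))) (th-lefts 1))
    ; th-leave = th-weak z≤n (th-lefts 0)
    }

  stackPos : Fin K → ℕ → ℕ
  stackPos i j = home + (j * K + toℕ i)

  stackPos-suc : ∀ i j → K + stackPos i j ≡ stackPos i (suc j)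
  stackPos-suc i j = begin
    K + (home + (j * K + toℕ i))      ≡⟨ +-comm K _ ⟩
    home + (j * K + toℕ i) + K        ≡⟨ +-assoc home _ K ⟩
    home + (j * K + toℕ i + K)        ≡⟨ cong (home +_) (+-comm _ K) ⟩
    home + (K + (j * K + toℕ i))      ≡⟨ cong (home +_) (+-assoc K (j * K) (toℕ i)) ⟨
    home + (K + j * K + toℕ i)        ∎
    where open ≡-Reasoning

  stackTrack : Fin K → Track home pace
  stackTrack i = record
    { code = stackCode i
    ; pos = stackPos i
    ; Valid = λ _ → ⊤
    ; valid↓ = λ _ → tt
    ; pos-inj = λ {a} {b} _ _ e → proj₁ (digits-unique a b i i (+-cancelˡ-≡ home _ _ e))
    ; th-enter = λ {F} _ → th-weak (≤-trans (+-monoʳ-≤ K (<⇒≤ (toℕ<n i))) (n≤1+n _))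
        (th-moved {F = F} refl (trans (+-assoc K (toℕ i) home) (trans (cong (K +_) (+-comm (toℕ i) home)) (stackPos-suc i 0))) (th-lefts (K + toℕ i)))
    ; th-up = λ {F} {j} _ → th-weak K≤pace (th-moved {F = F} refl (stackPos-suc i (suc j)) (th-lefts K))
    ; th-down = λ {F} {j} _ → th-weak K≤pace (th-moved {F = F} (stackPos-suc i j) refl (th-rights K))
    ; th-leave = λ {F} → th-weak (≤-trans (<⇒≤ (toℕ<n i)) K≤pace) (th-moved {F = F} (+-comm (toℕ i) home) refl (th-rights (toℕ i)))
    }
    where
    K≤pace : K ≤ pace
    K≤pace = ≤-trans (m≤m+n K K) (n≤1+n _)

  record Encodes (σ : SSt K) (F : ℕ → Sym) : Set where
    field
      on-input  : Holds inputTrack F (input σ)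
      on-stacks : ∀ i → Holds (stackTrack i) F (Vec.lookup (stacks σ) i)
  open Encodes

  record Represents (σ : SSt K) (τ : TSt) : Set where
    field
      content : ℕ → Sym
      encodes : Encodes σ content
      at      : At (TSt.tp τ) content home
      same-qw : TSt.qw τ ≡ word σ
      same-om : TSt.om τ ≡ flips σ
  open Represents

  -- The sentinels of the input and of stack 0 are the same cell `home`, hence the `suc j₁`. Sharing
  -- is harmless because a sentinel is only ever overwritten by a blank.
  input≢stack : ∀ i j₁ j → home ∸ j ≢ stackPos i (suc j₁)
  input≢stack i j₁ j e = <-irrefl e (≤-<-trans (m∸n≤m home j)
    (m<m+n home (≤-trans (m<n⇒0<n (toℕ<n i)) (≤-trans (m≤m+n K (j₁ * K)) (m≤m+n _ (toℕ i))))))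

  stack≢input : ∀ i j j₁ → suc j₁ ≤ home → stackPos i j ≢ home ∸ suc j₁
  stack≢input i j j₁ (s≤s v) e = <-irrefl (sym e) (<-≤-trans (s≤s (m∸n≤m n j₁)) (m≤m+n home _))

  stack≢stack : ∀ i i₁ j j₁ → i ≢ i₁ → stackPos i j ≢ stackPos i₁ j₁
  stack≢stack i i₁ j j₁ ne e = ne (proj₂ (digits-unique j j₁ i i₁ (+-cancelˡ-≡ home _ _ e)))

  encodes-stack : ∀ {σ F F₁} i s j₁ → Encodes σ F → Holds (stackTrack i) F₁ s →
    (∀ e → e ≢ stackPos i (suc j₁) → F₁ e ≡ F e) → Encodes (record σ { stacks = stacks σ [ i ]≔ s }) F₁
  encodes-stack {σ} {F} {F₁} i s j₁ E h same = record
    { on-input = holds-elsewhere inputTrack (on-input E) (λ j _ → input≢stack i j₁ j) same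
    ; on-stacks = on }
    where
    on : ∀ i₁ → Holds (stackTrack i₁) F₁ (Vec.lookup (stacks σ [ i ]≔ s) i₁)
    on i₁ with i₁ ≟ i
    ... | yes refl = subst (Holds (stackTrack i) F₁) (sym (Vec.lookup∘updateAt i (stacks σ))) h
    ... | no ne = subst (Holds (stackTrack i₁) F₁) (sym (Vec.lookup∘updateAt′ i₁ i ne (stacks σ)))
      (holds-elsewhere (stackTrack i₁) (on-stacks E i₁) (λ j _ → stack≢stack i₁ i j (suc j₁) ne) same)

  encodes-input : ∀ {σ F F₁} s j₁ → suc j₁ ≤ home → Encodes σ F → Holds inputTrack F₁ s →
    (∀ e → e ≢ home ∸ suc j₁ → F₁ e ≡ F e) → Encodes (record σ { input = s }) F₁
  encodes-input s j₁ v E h same = record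
    { on-input = h
    ; on-stacks = λ i → holds-elsewhere (stackTrack i) (on-stacks E i) (λ j _ → stack≢input i j j₁ v) same }

  opCost : ℕ → ℕ
  opCost H = suc (opBound inputTrack H)

  Lowered : ∀ {A} → SCmd K A → TSt → A → SSt K → ℕ → Set₁
  Lowered c τ a σ₁ m = ∃ λ τ₁ → Represents σ₁ τ₁ × Exec TSem (lower c) τ a τ₁ m

  lower-op : ∀ o {h H σ τ} → Small h σ → h + 1 ≤ H → Represents σ τ →
    Lowered (op o) τ (proj₁ (effectS o σ)) (proj₂ (effectS o σ)) (opCost H)
  lower-op (push i b) {h} {H} {σ} S le R =
    let s = Vec.lookup (stacks σ) i
        hold = on-stacks (encodes R) i
        hold₁ = holds-push (stackTrack i) b hold tt
        same = overwrite-other (content R) _ _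
        _ , A , e = th-push (stackTrack i) {H = H} b hold hold₁ (≤-trans (small-stacks S i) (≤-trans (m≤m+n h 1) le)) same (at R)
    in _ , record { content = _ ; encodes = encodes-stack i (b ∷ s) (length s) (encodes R) hold₁ same ; at = A ; same-qw = same-qw R ; same-om = same-om R } , weak (n≤1+n _) e
  lower-op (pop i) {h} {H} {σ} S le R with Vec.lookup (stacks σ) i | on-stacks (encodes R) i | small-stacks S i
  ... | [] | hold | _ =
    let _ , A , e = th-pop-empty (stackTrack i) {H = H} hold (at R)
    in _ , record { content = _ ; encodes = encodes R ; at = A ; same-qw = same-qw R ; same-om = same-om R } , weak (n≤1+n _) e
  ... | b ∷ s | hold | le₁ =
    let hold₁ = holds-pop (stackTrack i) hold
        same = overwrite-other (content R) _ _
        _ , A , e = th-pop (stackTrack i) {H = H} hold hold₁ (≤-trans le₁ (≤-trans (m≤m+n h 1) le)) same (at R)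
    in _ , record { content = _ ; encodes = encodes-stack i s (length s) (encodes R) hold₁ same ; at = A ; same-qw = same-qw R ; same-om = same-om R } , weak (n≤1+n _) e
  lower-op popInput {h} {H} {σ} S le R with input σ in eq | on-input (encodes R) | small-input S
  ... | [] | hold | _ =
    let _ , A , e = th-pop-empty inputTrack {H = H} hold (at R)
    in _ , record { content = _ ; encodes = encodes R ; at = A ; same-qw = same-qw R ; same-om = same-om R } , weak (n≤1+n _) e
  ... | b ∷ s | hold | le₁ =
    let hold₁ = holds-pop inputTrack hold
        same = overwrite-other (content R) _ _
        _ , A , e = th-pop inputTrack {H = H} hold hold₁ (≤-trans le₁ (≤-trans (m≤m+n h 1) le)) same (at R)
    in _ , record { content = _ ; encodes = encodes-input s (length s) (Holds.room hold₁) (encodes R) hold₁ same ; at = A ; same-qw = same-qw R ; same-om = same-om R } , weak (n≤1+n _) e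
  lower-op choose {τ = tst t w ω} S le R with same-om R
  ... | refl = _ ,
    record { content = _ ; encodes = record { on-input = on-input (encodes R) ; on-stacks = on-stacks (encodes R) } ; at = at R ; same-qw = same-qw R ; same-om = refl } ,
    weak (s≤s z≤n) op
  lower-op (emit b) {τ = tst t w ω} S le R = _ ,
    record { content = _ ; encodes = record { on-input = on-input (encodes R) ; on-stacks = on-stacks (encodes R) } ; at = at R ; same-qw = cong (_++ (b ∷ [])) (same-qw R) ; same-om = same-om R } ,
    weak (s≤s z≤n) (bind op ret)

  -- `H` bounds every stack height during the whole execution, by `small-exec`, so each of the `m`
  -- steps costs at most `opCost H`.
  lower-exec : ∀ {A} {c : SCmd K A} {σ a σ₁ m} → ExecS c σ a σ₁ m →
    ∀ {h H τ} → Small h σ → h + m ≤ H → Represents σ τ → Lowered c τ a σ₁ (m * opCost H)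
  lower-exec ret S le R = _ , R , ret
  lower-exec (op {o}) S le R with lower-op o S le R
  ... | _ , R₁ , e = _ , R₁ , weak (≤-reflexive (sym (+-identityʳ _))) e
  lower-exec (bind {m = m} {n₁} e e₁) {h} {H} S le R
    with lower-exec e S (≤-trans (+-monoʳ-≤ h (m≤m+n m n₁)) le) R
  ... | _ , R₁ , d with lower-exec e₁ (small-exec e S) (≤-trans (≤-reflexive (+-assoc h m n₁)) le) R₁
  ... | _ , R₂ , d₁ = _ , R₂ , weak (≤-reflexive (sym (*-distribʳ-+ (opCost H) m n₁))) (bind d d₁)
  lower-exec (stop {n = m} e) {h} {H} S le R with lower-exec e S (≤-trans (+-monoʳ-≤ h (n≤1+n m)) le) R
  ... | _ , R₁ , d = _ , R₁ , weak (+-monoˡ-≤ (m * opCost H) (s≤s z≤n)) (stop d)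
  lower-exec (more {m = m} {n₁} e e₁) {h} {H} S le R
    with lower-exec e S (≤-trans (+-monoʳ-≤ h (≤-trans (m≤m+n m n₁) (n≤1+n _))) le) R
  ... | _ , R₁ , d with lower-exec e₁ (small-exec e S) (≤-trans (≤-reflexive (+-assoc h m n₁)) (≤-trans (+-monoʳ-≤ h (n≤1+n _)) le)) R₁
  ... | _ , R₂ , d₁ = _ , R₂ ,
    weak (≤-trans (≤-reflexive (cong suc (sym (*-distribʳ-+ (opCost H) m n₁)))) (+-monoˡ-≤ ((m + n₁) * opCost H) (s≤s z≤n))) (more d d₁)
  lower-exec (weak {m = m} m≤n e) {h} {H} S le R with lower-exec e S (≤-trans (+-monoʳ-≤ h m≤n) le) R
  ... | _ , R₁ , d = _ , R₁ , weak (*-monoˡ-≤ (opCost H) m≤n) d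

nthB-snoc-zero : ∀ s b → nthB (s ++ b ∷ []) 0 ≡ bitSym b
nthB-snoc-zero [] b = refl
nthB-snoc-zero (c ∷ s) b = trans (nthB-below c (s ++ b ∷ []) (λ e → 0≢1+n (trans e (length-snoc s)))) (nthB-snoc-zero s b)
  where
  length-snoc : ∀ s → length (s ++ b ∷ []) ≡ suc (length s)
  length-snoc s = trans (length-++ s) (+-comm (length s) 1)

nthB-snoc-suc : ∀ s b j → nthB (s ++ b ∷ []) (suc j) ≡ nthB s j
nthB-snoc-suc [] b j = refl
nthB-snoc-suc (c ∷ s) b j = go (j ℕ.≟ length s)
  where
  len : length (s ++ b ∷ []) ≡ suc (length s)
  len = trans (length-++ s) (+-comm (length s) 1)
  go : Dec (j ≡ length s) → nthB (c ∷ s ++ b ∷ []) (suc j) ≡ nthB (c ∷ s) j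
  go (yes refl) = trans (cong (nthB (c ∷ s ++ b ∷ [])) (sym len)) (trans (nthB-top c (s ++ b ∷ [])) (sym (nthB-top c s)))
  go (no ne) = trans (nthB-below c (s ++ b ∷ []) (λ e → ne (cong pred (trans e len))))
    (trans (nthB-snoc-suc s b j) (sym (nthB-below c s ne)))

nthB-reverse : ∀ x j → nthB (reverse x) j ≡ cell (map bitSym x) j
nthB-reverse [] j = refl
nthB-reverse (b ∷ x) zero = trans (cong (λ s → nthB s 0) (unfold-reverse b x)) (nthB-snoc-zero (reverse x) b)
nthB-reverse (b ∷ x) (suc j) = trans (cong (λ s → nthB s (suc j)) (unfold-reverse b x))
  (trans (nthB-snoc-suc (reverse x) b j) (nthB-reverse x j))

lookup-replicate-[] : ∀ {K} (i : Fin K) → Vec.lookup (Vec.replicate K (List.[] {A = Bool})) i ≡ []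
lookup-replicate-[] i = Vec.lookup-replicate i []

initialS : ∀ {K} → Word → List Bool → SSt K
initialS {K} x ω = sst (Vec.replicate K (List.[])) (reverse x) List.[] ω

module _ (K : ℕ) (x : Word) where
  open Layout K (length x)

  private
    n = length x

  initialContent : ℕ → Sym
  initialContent e with e ≤? n
  ... | yes _ = cell (map bitSym x) (n ∸ e)
  ... | no _ = blank

  content-inside : ∀ {e} → e ≤ n → initialContent e ≡ cell (map bitSym x) (n ∸ e)
  content-inside {e} le with e ≤? n
  ... | yes _ = refl
  ... | no ¬le = ⊥-elim (¬le le)

  content-outside : ∀ {e} → n < e → initialContent e ≡ blank
  content-outside {e} lt with e ≤? n
  ... | yes le = ⊥-elim (<⇒≱ lt le)
  ... | no _ = refl

  at-initial : At (initTape x) initialContent n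
  at-initial = record
    { at-head = trans (first x) (trans (cong (cell (map bitSym x)) (sym (n∸n≡0 n))) (sym (content-inside ≤-refl)))
    ; at-left = λ d → trans (lefts x d) (sym (content-outside (s≤s (m≤m+n n d))))
    ; at-right = λ d e eq → trans (rights x d) (trans (cong (cell (map bitSym x)) (sym (gap d e eq)))
        (sym (content-inside (≤-trans (≤-trans (m≤n+m e d) (n≤1+n _)) (≤-reflexive (sym eq)))))) }
    where
    gap : ∀ d e → n ≡ suc (d + e) → n ∸ e ≡ suc d
    gap d e eq = trans (cong (_∸ e) eq) (m+n∸n≡m (suc d) e)
    first : ∀ x → Tape.head (initTape x) ≡ cell (map bitSym x) 0
    first [] = refl
    first (b ∷ x) = refl
    lefts : ∀ x d → cell (Tape.left (initTape x)) d ≡ blank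
    lefts [] d = refl
    lefts (b ∷ x) d = refl
    rights : ∀ x d → cell (Tape.right (initTape x)) d ≡ cell (map bitSym x) (suc d)
    rights [] d = refl
    rights (b ∷ x) d = refl

  represents-initial : ∀ ω → Represents (initialS x ω) (tst (moveT moveL (initTape x)) [] ω)
  represents-initial ω = record
    { content = initialContent
    ; encodes = record
      { on-input = record
        { sentinel = content-outside ≤-refl
        ; cells = λ j v → trans (content-inside (m∸n≤m n j)) (trans (cong (cell (map bitSym x)) (m∸[m∸n]≡n (≤-pred v))) (sym (nthB-reverse x j)))
        ; room = s≤s (≤-reflexive (length-reverse x)) }
      ; on-stacks = λ i → subst (Holds (stackTrack i) initialContent) (sym (lookup-replicate-[] i)) record
        { sentinel = content-outside (m≤m+n home _)
        ; cells = λ j _ → content-outside (m≤m+n home _)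
        ; room = tt } }
    ; at = at-moveL at-initial
    ; same-qw = refl
    ; same-om = refl }

  small-initial : ∀ ω → Small n (initialS {K} x ω)
  small-initial ω = record
    { small-stacks = λ i → subst (λ s → length s ≤ n) (sym (lookup-replicate-[] i)) z≤n
    ; small-input = ≤-reflexive (length-reverse x) }

module Lowering {K} (P : Program (SSig K)) where
  open Program P

  relabel : Label ⊎ Maybe Outcome → Maybe Label ⊎ Maybe Outcome
  relabel (inj₁ l) = inj₁ (just l)
  relabel (inj₂ o) = inj₂ o

  -- The additional label `nothing` makes the single move to the left after which the initial tape
  -- has the required layout.
  bodyT : Maybe Label → TCmd (Maybe Label ⊎ Maybe Outcome)
  bodyT nothing = goBy moveL >> ret (inj₁ (just start))
  bodyT (just l) = _>>=_ {{fin-⊎ {{labels}}}} (lower (body l)) (λ r → ret (relabel r))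

  lowered : Program TSig
  lowered = record { Label = Maybe Label ; labels = fin-Maybe {{labels}} ; start = nothing ; answer = λ b → just (answer b) ; body = bodyT }

  module _ {n : ℕ} where
    open Layout K n

    run-lower : ∀ {D l σ o k} → Run (SSem K) P D l σ o k → ∀ {h H τ} → Small h σ → h + k ≤ H → Represents σ τ →
      Run TSem lowered D (just l) τ o (k * opCost H)
    run-lower (jump {m = m} {k} e r) {h} {H} S le R
      with lower-exec e S (≤-trans (+-monoʳ-≤ h (≤-trans (m≤m+n m k) (n≤1+n _))) le) R
    ... | τ₁ , R₁ , d = weaken bound (jump (bind {{fin-⊎ {{labels}}}} d ret)
      (run-lower r (small-exec e S) (≤-trans (≤-reflexive (+-assoc h m k)) (≤-trans (+-monoʳ-≤ h (n≤1+n _)) le)) R₁))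
      where
      bound : suc (m * opCost H + 0) + k * opCost H ≤ (suc m + k) * opCost H
      bound = ≤-trans (≤-reflexive (cong suc (trans (cong (_+ k * opCost H) (+-identityʳ (m * opCost H))) (sym (*-distribʳ-+ (opCost H) m k)))))
        (+-monoˡ-≤ _ (s≤s z≤n))
    run-lower (inquire {m = m} {k} e r) {h} {H} S le R
      with lower-exec e S (≤-trans (+-monoʳ-≤ h (≤-trans (m≤m+n m (suc k)) (n≤1+n _))) le) R
    ... | tst t w ω , R₁ , d with Represents.same-qw R₁
    ... | refl = weaken bound (inquire (bind {{fin-⊎ {{labels}}}} d ret)
      (run-lower r (record { small-stacks = Small.small-stacks (small-exec e S) ; small-input = Small.small-input (small-exec e S) })
        (≤-trans (≤-reflexive (+-assoc h m k)) (≤-trans (+-monoʳ-≤ h (≤-trans (+-monoʳ-≤ m (n≤1+n k)) (n≤1+n _))) le))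
        (record { content = Represents.content R₁ ; encodes = record { on-input = Encodes.on-input (Represents.encodes R₁) ; on-stacks = Encodes.on-stacks (Represents.encodes R₁) } ; at = Represents.at R₁ ; same-qw = refl ; same-om = Represents.same-om R₁ })))
      where
      C = opCost H
      1≤C : 1 ≤ C
      1≤C = s≤s z≤n
      bound : suc (m * C + 0) + suc (k * C) ≤ (suc m + suc k) * C
      bound = begin
        suc (m * C + 0) + suc (k * C)   ≡⟨ cong (λ z → suc z + suc (k * C)) (+-identityʳ (m * C)) ⟩
        suc (m * C) + suc (k * C)       ≤⟨ +-mono-≤ (+-monoˡ-≤ (m * C) 1≤C) (+-monoˡ-≤ (k * C) 1≤C) ⟩
        suc m * C + suc k * C           ≡⟨ *-distribʳ-+ C (suc m) (suc k) ⟨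
        (suc m + suc k) * C             ∎
        where open ≤-Reasoning
    run-lower (finish {m = m} e) {h} {H} S le R
      with lower-exec e S (≤-trans (+-monoʳ-≤ h (n≤1+n m)) le) R
    ... | _ , _ , d = weaken (≤-trans (≤-reflexive (cong suc (+-identityʳ _))) (+-monoˡ-≤ _ (s≤s z≤n)))
      (finish (bind {{fin-⊎ {{labels}}}} d ret))
    run-lower (weaken {m = m} m≤k r) {h} {H} S le R =
      weaken (*-monoˡ-≤ (opCost H) m≤k) (run-lower r S (≤-trans (+-monoʳ-≤ h m≤k) le) R)

  run-initial : ∀ {D x ω o k} → Run (SSem K) P D start (initialS x ω) o k →
    Run TSem lowered D nothing (tst (initTape x) [] ω) o (2 + k * Layout.opCost K (length x) (length x + k))
  run-initial {x = x} {ω} r = jump (bind op ret)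
    (run-lower r (small-initial K x ω) ≤-refl (represents-initial K x ω))

  lowerTime : (ℕ → ℕ) → ℕ → ℕ
  lowerTime t n = 2 + t n * Layout.opCost K n (n + t n)

  poly-lowerTime : ∀ {t} → Poly t → Poly (lowerTime t)
  poly-lowerTime p = poly-+ (poly-const 2) (poly-* p (poly-+ (poly-const 1)
    (poly-+ pc (poly-+ scan (poly-+ pc (poly-+ (poly-const 1) (poly-+ scan (poly-+ pc (poly-const 0)))))))))
    where
    pc = poly-const (suc (K + K))
    scan = poly-+ (poly-* (poly-+ poly-id p) (poly-const (suc (suc (suc (K + K)))))) (poly-const (suc (suc (suc (K + K)))))

  module Realized (nd : Bool) where
    machine : NOTM
    machine = Compiled.machine lowered nd

    run⇒produces : ∀ {D x ω o k} → Allowed nd ω → Run (SSem K) P D start (initialS x ω) o k → Produces machine D x o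
    run⇒produces al r = Compiled.run-produces lowered nd al (run-initial r)

    produces⇒run : ∀ {D x o} → Produces machine D x o →
      ∃ λ ω → Allowed nd ω × (∀ {o₁ k} → Run (SSem K) P D start (initialS x ω) o₁ k → o₁ ≡ o)
    produces⇒run p with Compiled.produces-run lowered nd p
    ... | ω , al , only = ω , al , λ r → only (run-initial r)

    polyBounded : ∀ {t} → Poly t →
      (∀ D x ω → Allowed nd ω → ∃ λ o → Run (SSem K) P D start (initialS x ω) o (t (length x))) → PolyBounded machine
    polyBounded {t} pt total with poly⇒bound (poly-lowerTime pt)
    ... | k , le = k , λ D x c n r → ≤-trans
      (Compiled.run-bounds lowered nd (lowerTime t) (λ D x ω al → let o , run = total D x ω al in o , run-initial run) D x c n r)
      (le (length x))

-- The interface through which later arguments use a compiled machine: runs under allowed choices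
-- determine its outcomes and its time bound.
record Implementation {K} (P : Program (SSig K)) (nd : Bool) : Set₁ where
  field
    machine       : NOTM
    deterministic : nd ≡ false → Deterministic machine
    run⇒produces  : ∀ {D x ω o k} → Allowed nd ω → Run (SSem K) P D (Program.start P) (initialS x ω) o k → Produces machine D x o
    produces⇒run  : ∀ {D x o} → Produces machine D x o →
      ∃ λ ω → Allowed nd ω × (∀ {o₁ k} → Run (SSem K) P D (Program.start P) (initialS x ω) o₁ k → o₁ ≡ o)
    polyBounded   : ∀ {t} → Poly t →
      (∀ D x ω → Allowed nd ω → ∃ λ o → Run (SSem K) P D (Program.start P) (initialS x ω) o (t (length x))) → PolyBounded machine

abstract
  implement : ∀ {K} (P : Program (SSig K)) nd → Implementation P nd
  implement P nd = record
    { machine = Lowering.Realized.machine P nd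
    ; deterministic = λ { refl → compiled-deterministic (Lowering.lowered P) }
    ; run⇒produces = Lowering.Realized.run⇒produces P nd
    ; produces⇒run = Lowering.Realized.produces⇒run P nd
    ; polyBounded = Lowering.Realized.polyBounded P nd }

-- Paths and their queries

module Paths (N : NOTM) where
  open NOTM N

  succs-halted : ∀ {D q t w o} → halt q ≡ just o → succs N D (cfg q t w) ≡ []
  succs-halted {q = q} e with halt q
  succs-halted refl | just _ = refl

  succs-query : ∀ {D q t w} → halt q ≡ nothing → q ≡ query →
    succs N D (cfg q t w) ≡ cfg (if D w then yesSt else noSt) t [] ∷ []
  succs-query {q = q} e e₁ with halt q
  succs-query {q = q} refl e₁ | nothing with q ≟ query
  ... | yes _ = refl
  ... | no ne = ⊥-elim (ne e₁)

  succs-step : ∀ {D q t w} → halt q ≡ nothing → q ≢ query →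
    succs N D (cfg q t w) ≡ map (applyAct N t w) (toList (δ q (Tape.head t)))
  succs-step {q = q} e ne with halt q
  succs-step {q = q} refl ne | nothing with q ≟ query
  ... | yes e₁ = ⊥-elim (ne e₁)
  ... | no _ = refl

  succ-action : ∀ {D q t w c} → halt q ≡ nothing → q ≢ query → c ∈ succs N D (cfg q t w) →
    ∃ λ a → a ∈ toList (δ q (Tape.head t)) × c ≡ applyAct N t w a
  succ-action {D} {q} {t} {w} {c} e ne i =
    ∈-map⁻ (applyAct N t w) {xs = toList (δ q (Tape.head t))} (subst (c ∈_) (succs-step {D} {q} {t} {w} e ne) i)

  data Kind (q : Fin Q) : Set where
    halted   : ∀ {o} → halt q ≡ just o → Kind q
    asking   : halt q ≡ nothing → q ≡ query → Kind q
    ordinary : halt q ≡ nothing → q ≢ query → Kind q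

  kind : ∀ q → Kind q
  kind q with halt q in e
  ... | just o = halted e
  ... | nothing with q ≟ query
  ...   | yes e₁ = asking e e₁
  ...   | no ne = ordinary e ne

  asked : ∀ {q} → Kind q → Word → List Word
  asked (asking _ _) w = w ∷ []
  asked _ w = []

  succs-agree : ∀ {D D₁ q t w} (k : Kind q) → (∀ {u} → u ∈ asked k w → D u ≡ D₁ u) →
    succs N D (cfg q t w) ≡ succs N D₁ (cfg q t w)
  succs-agree (halted e) ag = trans (succs-halted e) (sym (succs-halted e))
  succs-agree {t = t} (asking e e₁) ag = trans (succs-query e e₁)
    (trans (cong (λ b → cfg (if b then yesSt else noSt) t [] ∷ []) (ag (here refl))) (sym (succs-query e e₁)))
  succs-agree (ordinary e ne) ag = trans (succs-step e ne) (sym (succs-step e ne))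

  queries : ∀ {D c c₁ n} → Reaches N D c c₁ n → List Word
  queries done = []
  queries (step {cfg q t w} i r) = asked (kind q) w ++ queries r

  -- A path depends on its oracle only through the answers to its own queries. This transfers paths
  -- between oracles, in particular an accepting and a rejecting one to a common oracle.
  reaches-agree : ∀ {D D₁ c c₁ n} (r : Reaches N D c c₁ n) → (∀ {u} → u ∈ queries r → D u ≡ D₁ u) →
    ∃ λ (r₁ : Reaches N D₁ c c₁ n) → queries r₁ ≡ queries r
  reaches-agree done ag = done , refl
  reaches-agree (step {cfg q t w} i r) ag with reaches-agree r (λ m → ag (∈-++⁺ʳ (asked (kind q) w) m))
  ... | r₁ , e = step (subst (_ ∈_) (succs-agree (kind q) (λ m → ag (∈-++⁺ˡ m))) i) r₁ , cong (asked (kind q) w ++_) e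

  appendQ-length : ∀ mb w → length (appendQ mb w) ≤ suc (length w)
  appendQ-length nothing w = n≤1+n _
  appendQ-length (just b) w = ≤-reflexive (trans (length-++ w) (+-comm (length w) 1))

  -- The number of tokens that a list of queries takes up in a table: one per symbol and one per
  -- answer.
  codeLength : List Word → ℕ
  codeLength [] = 0
  codeLength (w ∷ ws) = suc (length w) + codeLength ws

  length≤codeLength : ∀ ws → length ws ≤ codeLength ws
  length≤codeLength [] = z≤n
  length≤codeLength (w ∷ ws) = s≤s (≤-trans (length≤codeLength ws) (m≤n+m _ (length w)))

  step-codeLength : ∀ {D q t w c} (k : Kind q) → c ∈ succs N D (cfg q t w) →
    codeLength (asked k w) + length (Config.qword c) ≤ suc (length w)
  step-codeLength (halted e) i with subst (_ ∈_) (succs-halted e) i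
  ... | ()
  step-codeLength (asking e e₁) i with subst (_ ∈_) (succs-query e e₁) i
  ... | here refl = ≤-reflexive (trans (+-identityʳ _) (+-identityʳ _))
  step-codeLength {w = w} (ordinary e ne) i with succ-action e ne i
  ... | (_ , _ , _ , mb) , _ , refl = appendQ-length mb w

  codeLength-++ : ∀ us vs → codeLength (us ++ vs) ≡ codeLength us + codeLength vs
  codeLength-++ [] vs = refl
  codeLength-++ (u ∷ us) vs = trans (cong (suc (length u) +_) (codeLength-++ us vs)) (sym (+-assoc (suc (length u)) _ _))

  -- The query tape pays for the queries: each step appends at most one symbol to it.
  queries-codeLength : ∀ {D c c₁ n} (r : Reaches N D c c₁ n) → codeLength (queries r) ≤ length (Config.qword c) + n
  queries-codeLength done = z≤n
  queries-codeLength (step {cfg q t w} {c} {n = n} i r) = begin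
    codeLength (asked (kind q) w ++ queries r)                          ≡⟨ codeLength-++ (asked (kind q) w) (queries r) ⟩
    codeLength (asked (kind q) w) + codeLength (queries r)              ≤⟨ +-monoʳ-≤ _ (queries-codeLength r) ⟩
    codeLength (asked (kind q) w) + (length (Config.qword c) + n)       ≡⟨ +-assoc _ (length (Config.qword c)) n ⟨
    codeLength (asked (kind q) w) + length (Config.qword c) + n         ≤⟨ +-monoˡ-≤ n (step-codeLength (kind q) i) ⟩
    suc (length w) + n                                                  ≡⟨ +-suc (length w) n ⟨
    length w + suc n                                                    ∎
    where open ≤-Reasoning

  ProducesFrom : Lang → Config N → Outcome → Set
  ProducesFrom D c o = ∃ λ c₁ → ∃ λ n → Reaches N D c c₁ n × halt (Config.state c₁) ≡ just o

  BoundedFrom : Lang → Config N → ℕ → Set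
  BoundedFrom D c m = ∀ {c₁ n} → Reaches N D c c₁ n → n ≤ m

  bounded-succ : ∀ {D c c₁ m} → BoundedFrom D c (suc m) → c₁ ∈ succs N D c → BoundedFrom D c₁ m
  bounded-succ bd i r = ≤-pred (bd (step i r))

  some-succ : ∀ D c → halt (Config.state c) ≡ nothing → ∃ λ c₁ → c₁ ∈ succs N D c
  some-succ D (cfg q t w) h with succs N D (cfg q t w) | nonempty (kind q)
    where
    nonempty : Kind q → succs N D (cfg q t w) ≢ []
    nonempty (halted e) with trans (sym h) e
    ... | ()
    nonempty (asking e e₁) s with trans (sym s) (succs-query e e₁)
    ... | ()
    nonempty (ordinary e ne) s with trans (sym s) (succs-step e ne)
    ... | ()
  ... | [] | ne = ⊥-elim (ne refl)
  ... | c ∷ _ | _ = c , here refl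

  -- Only a halting configuration lacks successors, and the bound forces every chain of successors
  -- to end.
  produces-some : ∀ {D c} m → BoundedFrom D c m → ∃ λ o → ProducesFrom D c o
  produces-some {c = c} m bd with halt (Config.state c) in h
  ... | just o = o , _ , _ , done , h
  produces-some {D} {c} m bd | nothing with some-succ D c h
  produces-some zero bd | nothing | _ , i with bd (step i done)
  ... | ()
  produces-some (suc m) bd | nothing | c₁ , i with produces-some m (bounded-succ bd i)
  ... | o , c₂ , n , r , h₁ = o , c₂ , suc n , step i r , h₁

  outcome? : ∀ (mo : Maybe Outcome) o → Dec (mo ≡ just o)
  outcome? nothing o = no λ ()
  outcome? (just acc) acc = yes refl
  outcome? (just acc) rej = no λ ()
  outcome? (just acc) unk = no λ ()
  outcome? (just rej) acc = no λ ()
  outcome? (just rej) rej = yes refl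
  outcome? (just rej) unk = no λ ()
  outcome? (just unk) acc = no λ ()
  outcome? (just unk) rej = no λ ()
  outcome? (just unk) unk = yes refl

  -- Exhaustive search of the bounded computation tree. It is what turns the set accepted by a
  -- nondeterministic machine into a Boolean-valued `Lang`.
  producesFrom? : ∀ D c m → BoundedFrom D c m → ∀ o → Dec (ProducesFrom D c o)
  producesFrom? D c m bd o with outcome? (halt (Config.state c)) o
  ... | yes h = yes (_ , _ , done , h)
  ... | no nh with m
  ...   | zero = no λ { (_ , _ , done , h) → nh h ; (_ , _ , step i r , h) → bad (bd (step i done)) }
    where
    bad : ¬ (1 ≤ 0)
    bad ()
  ...   | suc m with search (succs N D c) (λ i → bounded-succ bd i)
    where
    search : ∀ cs → (∀ {c₁} → c₁ ∈ cs → BoundedFrom D c₁ m) → Dec (∃ λ c₁ → c₁ ∈ cs × ProducesFrom D c₁ o)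
    search [] bds = no λ { (_ , () , _) }
    search (c₁ ∷ cs) bds with producesFrom? D c₁ m (bds (here refl)) o
    ... | yes p = yes (c₁ , here refl , p)
    ... | no np with search cs (λ i → bds (there i))
    ...   | yes (c₂ , i , p) = yes (c₂ , there i , p)
    ...   | no np₁ = no λ { (_ , here refl , p) → np p ; (_ , there i , p) → np₁ (_ , i , p) }
  ...     | yes (c₁ , i , c₂ , n , r , h) = yes (c₂ , suc n , step i r , h)
  ...     | no np = no λ { (_ , _ , done , h) → nh h ; (_ , _ , step i r , h) → np (_ , i , _ , _ , r , h) }

  produces? : PolyBounded N → ∀ D x o → Dec (Produces N D x o)
  produces? (k , bd) D x o = producesFrom? D (initCfg N x) (length x ^ k + k) (bd D x _ _) o

  module _ (det : Deterministic N) where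
    succ-unique : ∀ {D c c₁ c₂} → c₁ ∈ succs N D c → c₂ ∈ succs N D c → c₁ ≡ c₂
    succ-unique {D} {cfg q t w} i j with kind q
    ... | halted e with subst (_ ∈_) (succs-halted e) i
    ...   | ()
    succ-unique i j | asking e e₁ with subst (_ ∈_) (succs-query e e₁) i | subst (_ ∈_) (succs-query e e₁) j
    ... | here refl | here refl = refl
    succ-unique {D} {cfg q t w} i j | ordinary e ne
      with δ q (Tape.head t) | det q (Tape.head t) | subst (_ ∈_) (succs-step e ne) i | subst (_ ∈_) (succs-step e ne) j
    ... | _ ∷ .[] | refl | here refl | here refl = refl

    halted-no-succ : ∀ {D c c₁ o} → halt (Config.state c) ≡ just o → ¬ (c₁ ∈ succs N D c)
    halted-no-succ {c = cfg q t w} h i with subst (_ ∈_) (succs-halted h) i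
    ... | ()

    outcome-unique : ∀ {D c c₁ c₂ m n o o₁} → Reaches N D c c₁ m → halt (Config.state c₁) ≡ just o →
      Reaches N D c c₂ n → halt (Config.state c₂) ≡ just o₁ → o ≡ o₁
    outcome-unique done h done h₁ = just-injective (trans (sym h) h₁)
    outcome-unique done h (step i _) _ = ⊥-elim (halted-no-succ h i)
    outcome-unique (step i _) _ done h = ⊥-elim (halted-no-succ h i)
    outcome-unique (step i r) h (step j r₁) h₁ with succ-unique i j
    ... | refl = outcome-unique r h r₁ h₁

    produces-unique : ∀ {D x o o₁} → Produces N D x o → Produces N D x o₁ → o ≡ o₁
    produces-unique (_ , _ , r , h) (_ , _ , r₁ , h₁) = outcome-unique r h r₁ h₁

-- Tables of oracle answers

-- A table entry is written as the bits of its query word followed by `end a`, where `a` is the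
-- answer.
data Tok : Set where
  bit end : Bool → Tok

flat : List Tok → List Bool
flat [] = []
flat (bit b ∷ ts) = true ∷ b ∷ flat ts
flat (end a ∷ ts) = false ∷ a ∷ flat ts

-- Total on purpose: every bit string denotes a table, so guessed bits need no syntax check. A
-- single last bit is dropped.
toks : List Bool → List Tok
toks (true ∷ b ∷ l) = bit b ∷ toks l
toks (false ∷ a ∷ l) = end a ∷ toks l
toks _ = []

toks-flat : ∀ ts → toks (flat ts) ≡ ts
toks-flat [] = refl
toks-flat (bit b ∷ ts) = cong (bit b ∷_) (toks-flat ts)
toks-flat (end a ∷ ts) = cong (end a ∷_) (toks-flat ts)

flat-++ : ∀ ts us → flat (ts ++ us) ≡ flat ts ++ flat us
flat-++ [] us = refl
flat-++ (bit b ∷ ts) us = cong (λ l → true ∷ b ∷ l) (flat-++ ts us)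
flat-++ (end a ∷ ts) us = cong (λ l → false ∷ a ∷ l) (flat-++ ts us)

-- Even length matters here, because `toks` would lose the last bit of a string of odd length.
flat-toks : ∀ p g → length g ≡ p + p → flat (toks g) ≡ g
flat-toks zero [] e = refl
flat-toks (suc p) (_ ∷ []) e with trans (cong pred e) (+-suc p p)
... | ()
flat-toks (suc p) (true ∷ b ∷ g) e = cong (λ l → true ∷ b ∷ l)
  (flat-toks p g (cong pred (trans (cong pred e) (+-suc p p))))
flat-toks (suc p) (false ∷ b ∷ g) e = cong (λ l → false ∷ b ∷ l)
  (flat-toks p g (cong pred (trans (cong pred e) (+-suc p p))))

flat-length : ∀ ts → length (flat ts) ≡ length ts + length ts
flat-length [] = refl
flat-length (bit _ ∷ ts) = cong suc (trans (cong suc (flat-length ts)) (sym (+-suc (length ts) (length ts))))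
flat-length (end _ ∷ ts) = cong suc (trans (cong suc (flat-length ts)) (sym (+-suc (length ts) (length ts))))

Entry : Set
Entry = Word × Bool

entries : Word → List Tok → List Entry
entries u [] = []
entries u (bit b ∷ ts) = entries (u ++ b ∷ []) ts
entries u (end a ∷ ts) = (u , a) ∷ entries [] ts

-- The unfinished word at the end of a table. Entries appended later keep their query words only if
-- it is empty.
pending : Word → List Tok → Word
pending u [] = u
pending u (bit b ∷ ts) = pending (u ++ b ∷ []) ts
pending u (end a ∷ ts) = pending [] ts

entries-++ : ∀ u ts us → entries u (ts ++ us) ≡ entries u ts ++ entries (pending u ts) us
entries-++ u [] us = refl
entries-++ u (bit b ∷ ts) us = entries-++ (u ++ b ∷ []) ts us
entries-++ u (end a ∷ ts) us = cong ((u , a) ∷_) (entries-++ [] ts us)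

pending-++ : ∀ u ts us → pending u (ts ++ us) ≡ pending (pending u ts) us
pending-++ u [] us = refl
pending-++ u (bit b ∷ ts) us = pending-++ (u ++ b ∷ []) ts us
pending-++ u (end a ∷ ts) us = pending-++ [] ts us

_≟w_ : (u v : Word) → Dec (u ≡ v)
_≟w_ = ≡-dec Bool._≟_

answerIn : Word → List Entry → Maybe Bool
answerIn w [] = nothing
answerIn w ((u , a) ∷ es) with u ≟w w
... | yes _ = just a
... | no _ = answerIn w es

answerIn-++ : ∀ {w a} es fs → answerIn w es ≡ just a → answerIn w (es ++ fs) ≡ just a
answerIn-++ {w} ((u , _) ∷ es) fs e with u ≟w w
... | yes _ = e
... | no _ = answerIn-++ es fs e

table : List Tok → Word → Maybe Bool
table ts w = answerIn w (entries [] ts)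

Agrees : Lang → List Entry → Set
Agrees D es = ∀ {w a} → answerIn w es ≡ just a → D w ≡ a

record Good (B : Lang) (ts : List Tok) : Set where
  field
    closed : pending [] ts ≡ []
    agrees : Agrees B (entries [] ts)
open Good

good-[] : ∀ {B} → Good B []
good-[] = record { closed = refl ; agrees = λ () }

table-++ : ∀ ts us {w a} → table ts w ≡ just a → table (ts ++ us) w ≡ just a
table-++ ts us {w} {a} e = subst (λ es → answerIn w es ≡ just a) (sym (entries-++ [] ts us)) (answerIn-++ (entries [] ts) _ e)

correct : Lang → Word → List Tok → List Tok
correct B u [] = []
correct B u (bit b ∷ ts) = bit b ∷ correct B (u ++ b ∷ []) ts
correct B u (end a ∷ ts) = end (B u) ∷ correct B [] ts

truths : Lang → List Entry → List Entry
truths B = map (λ e → proj₁ e , B (proj₁ e))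

entries-correct : ∀ B u ts → entries u (correct B u ts) ≡ truths B (entries u ts)
entries-correct B u [] = refl
entries-correct B u (bit b ∷ ts) = entries-correct B (u ++ b ∷ []) ts
entries-correct B u (end a ∷ ts) = cong ((u , B u) ∷_) (entries-correct B [] ts)

pending-correct : ∀ B u ts → pending u (correct B u ts) ≡ pending u ts
pending-correct B u [] = refl
pending-correct B u (bit b ∷ ts) = pending-correct B (u ++ b ∷ []) ts
pending-correct B u (end a ∷ ts) = pending-correct B [] ts

length-correct : ∀ B u ts → length (correct B u ts) ≡ length ts
length-correct B u [] = refl
length-correct B u (bit b ∷ ts) = cong suc (length-correct B (u ++ b ∷ []) ts)
length-correct B u (end a ∷ ts) = cong suc (length-correct B [] ts)

truths-agree : ∀ B es → Agrees B (truths B es)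
truths-agree B ((u , _) ∷ es) {w} e with u ≟w w
truths-agree B ((u , _) ∷ es) refl | yes refl = refl
... | no _ = truths-agree B es e

truths-cover : ∀ B {w a} es → answerIn w es ≡ just a → answerIn w (truths B es) ≡ just (B w)
truths-cover B {w} ((u , _) ∷ es) e with u ≟w w
... | yes refl = refl
... | no _ = truths-cover B es e

correct-good : ∀ B ts → pending [] ts ≡ [] → Good B (correct B [] ts)
correct-good B ts e = record
  { closed = trans (pending-correct B [] ts) e
  ; agrees = subst (Agrees B) (sym (entries-correct B [] ts)) (truths-agree B (entries [] ts)) }

correct-covers : ∀ B ts {w a} → table ts w ≡ just a → table (correct B [] ts) w ≡ just (B w)
correct-covers B ts {w} e = trans (cong (answerIn w) (entries-correct B [] ts)) (truths-cover B (entries [] ts) e)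

code : Lang → List Word → List Tok
code D [] = []
code D (w ∷ ws) = map bit w ++ end (D w) ∷ code D ws

entries-bits : ∀ u w ts → entries u (map bit w ++ ts) ≡ entries (u ++ w) ts
entries-bits u [] ts = cong (λ v → entries v ts) (sym (++-identityʳ u))
entries-bits u (b ∷ w) ts = trans (entries-bits (u ++ b ∷ []) w ts) (cong (λ v → entries v ts) (++-assoc u (b ∷ []) w))

entries-code : ∀ D ws ts → entries [] (code D ws ++ ts) ≡ map (λ w → w , D w) ws ++ entries [] ts
entries-code D [] ts = refl
entries-code D (w ∷ ws) ts = trans (cong (entries []) (++-assoc (map bit w) (end (D w) ∷ code D ws) ts))
  (trans (entries-bits [] w (end (D w) ∷ code D ws ++ ts)) (cong ((w , D w) ∷_) (entries-code D ws ts)))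

answerIn-code : ∀ (D : Lang) ws fs {w} → w ∈ ws → answerIn w (map (λ w → w , D w) ws ++ fs) ≡ just (D w)
answerIn-code D (v ∷ ws) fs {w} i with v ≟w w
answerIn-code D (v ∷ ws) fs i | yes refl = refl
answerIn-code D (v ∷ ws) fs (here refl) | no ne = ⊥-elim (ne refl)
answerIn-code D (v ∷ ws) fs (there i) | no ne = answerIn-code D ws fs i

answerIn-skip : ∀ {w} es fs → answerIn w es ≡ nothing → answerIn w (es ++ fs) ≡ answerIn w fs
answerIn-skip [] fs e = refl
answerIn-skip {w} ((u , _) ∷ es) fs e with u ≟w w
... | no _ = answerIn-skip es fs e

-- The first entry for a word counts, so earlier entries may mask the appended ones; as they agree
-- with `D`, masking does not change the answer.
answerIn-agreeing : ∀ D es fs {w} → Agrees D es → answerIn w fs ≡ just (D w) → answerIn w (es ++ fs) ≡ just (D w)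
answerIn-agreeing D es fs {w} ag e with answerIn w es in eq
... | just a = trans (answerIn-++ es fs eq) (cong just (sym (ag eq)))
... | nothing = trans (answerIn-skip es fs eq) e

-- Extending and correcting a table in rounds

nextRound : Lang → (List Tok → List Tok) → List Tok → List Tok
-- `end false` closes a word that the extension may have left unfinished. Its answer is a
-- placeholder, replaced by `correct` like all others.
nextRound B ex ts = correct B [] ((ts ++ ex ts) ++ end false ∷ [])

nthRound : Lang → (List Tok → List Tok) → ℕ → List Tok → List Tok
nthRound B ex zero ts = ts
nthRound B ex (suc k) ts = nthRound B ex k (nextRound B ex ts)

module Certificates (N : NOTM) (x : Word) where
  open Paths N

  total : (Word → Maybe Bool) → Lang → Lang
  total T D w = fromMaybe (D w) (T w)

  -- As `T` answers every query of the path, the path persists under `total T D` for each `D`.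
  -- Taking the empty oracle behind `T` makes the condition oracle-free and thus an NP condition.
  AccPath : (Word → Maybe Bool) → Set
  AccPath T = ∃ λ c → ∃ λ n → Σ (Reaches N (total T ∅) (initCfg N x) c n) λ r →
    NOTM.halt N (Config.state c) ≡ just acc × (∀ {u} → u ∈ queries r → ∃ λ a → T u ≡ just a)

  Sat : List Bool → ℕ → Set
  Sat t r = ∃ λ g → length g ≡ r × AccPath (table (toks (t ++ g)))

  total-agree : ∀ T D D₁ {u a} → T u ≡ just a → total T D u ≡ total T D₁ u
  total-agree T D D₁ e = trans (cong (fromMaybe _) e) (sym (cong (fromMaybe _) e))

  accPath-produces : ∀ {T} D → AccPath T → Produces N (total T D) x acc
  accPath-produces {T} D (c , n , r , h , known) =
    c , n , proj₁ (reaches-agree r (λ i → total-agree T ∅ D (proj₂ (known i)))) , h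

module Rounds (N : NOTM) (B : Lang) (x : Word) (p : ℕ)
              (bounded : ∀ D → Paths.BoundedFrom N D (initCfg N x) p) where
  open Paths N
  open Good

  open Certificates N x

  -- Extensions have a fixed length. Trailing `bit` tokens form an unfinished word and no entry, so
  -- they fill up the length without affecting any answer.
  padding : ℕ → List Tok
  padding k = replicate k (bit true)

  entries-padding : ∀ u k → entries u (padding k) ≡ []
  entries-padding u zero = refl
  entries-padding u (suc k) = entries-padding (u ++ true ∷ []) k

  length-code : ∀ D ws → length (code D ws) ≡ codeLength ws
  length-code D [] = refl
  length-code D (w ∷ ws) = trans (length-++ (map bit w)) (trans (cong₂ _+_ (length-map bit w) (cong suc (length-code D ws))) (+-suc (length w) _))

  -- The queries of the accepting path with their answers under `D` are the extension; they fit into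
  -- p tokens by `queries-codeLength`. The oracle `D` is arbitrary because `sat-back` applies this
  -- to an oracle built from a later table.
  produces-sat : ∀ {D ts} → Good D ts → Produces N D x acc → Sat (flat ts) (p + p)
  produces-sat {D} {ts} good (c , n , r , h) = flat g , len , sat
    where
    ws = queries r
    le : codeLength ws ≤ p
    le = ≤-trans (queries-codeLength r) (bounded D r)
    g = code D ws ++ padding (p ∸ codeLength ws)
    len : length (flat g) ≡ p + p
    len = trans (flat-length g) (cong₂ _+_ len₁ len₁)
      where
      len₁ : length g ≡ p
      len₁ = trans (length-++ (code D ws)) (trans (cong₂ _+_ (length-code D ws) (length-replicate _)) (m+[n∸m]≡n le))
    T₁ = table (ts ++ g)
    entries₁ : entries [] (ts ++ g) ≡ entries [] ts ++ (map (λ w → w , D w) ws ++ [])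
    entries₁ = begin
      entries [] (ts ++ g)                         ≡⟨ entries-++ [] ts g ⟩
      entries [] ts ++ entries (pending [] ts) g   ≡⟨ cong (λ u → entries [] ts ++ entries u g) (closed good) ⟩
      entries [] ts ++ entries [] g                ≡⟨ cong (entries [] ts ++_) (entries-code D ws _) ⟩
      entries [] ts ++ (map (λ w → w , D w) ws ++ entries [] (padding (p ∸ codeLength ws)))
                                                   ≡⟨ cong (λ es → entries [] ts ++ (map (λ w → w , D w) ws ++ es)) (entries-padding [] (p ∸ codeLength ws)) ⟩
      entries [] ts ++ (map (λ w → w , D w) ws ++ []) ∎
      where open ≡-Reasoning
    known : ∀ {u} → u ∈ ws → T₁ u ≡ just (D u)
    known {u} i = trans (cong (answerIn u) entries₁) (answerIn-agreeing D (entries [] ts) _ (agrees good) (answerIn-code D ws [] i))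
    path₁ = reaches-agree {D₁ = total T₁ ∅} r (λ i → sym (cong (fromMaybe false) (known i)))
    path : AccPath T₁
    path = c , n , proj₁ path₁ , h , λ {u} i → D u , known (subst (u ∈_) (proj₂ path₁) i)
    sat : AccPath (table (toks (flat ts ++ flat g)))
    sat = subst (λ us → AccPath (table us)) (sym (trans (cong toks (sym (flat-++ ts g))) (toks-flat (ts ++ g)))) path

  module _ (ex : List Tok → List Tok) (ex-sat : ∀ ts → Sat (flat ts) (p + p) → AccPath (table (ts ++ ex ts))) where

    round : List Tok → List Tok
    round = nextRound B ex

    rounds : ℕ → List Tok → List Tok
    rounds = nthRound B ex

    round-good : ∀ ts → Good B (round ts)
    round-good ts = correct-good B _ (pending-++ [] (ts ++ ex ts) (end false ∷ []))

    round-covers : ∀ ts {w a} → table (ts ++ ex ts) w ≡ just a → table (round ts) w ≡ just (B w)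
    round-covers ts e = correct-covers B ((ts ++ ex ts) ++ end false ∷ []) (table-++ (ts ++ ex ts) (end false ∷ []) e)

    rounds-good : ∀ k ts → Good B ts → Good B (rounds k ts)
    rounds-good zero ts good = good
    rounds-good (suc k) ts good = rounds-good k (round ts) (round-good ts)

    rounds-sat : ∀ k → Produces N B x acc → Sat (flat (rounds k [])) (p + p)
    rounds-sat k prod = produces-sat (rounds-good k [] good-[]) prod

    -- An extension of the later table, with `B` behind it, is an oracle with an accepting path. It
    -- agrees with the earlier table, whose words recur in the later one with their true answers, so
    -- the queries of that path extend the earlier table too.
    sat-back : ∀ ts → Good B ts → Sat (flat (round ts)) (p + p) → Sat (flat ts) (p + p)
    sat-back ts good sat = produces-sat {ts = ts}
      (record { closed = closed good ; agrees = λ {w} {a} e → trans (cong (fromMaybe _) (table-++ (round ts) (ex (round ts))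
         (round-covers ts (table-++ ts (ex ts) e)))) (agrees good e) })
      (accPath-produces B (ex-sat (round ts) sat))

    module _ (under : RobustlyUnderproductive N) {c₀ n₀} (ρ : Reaches N B (initCfg N x) c₀ n₀)
             (rejects : NOTM.halt N (Config.state c₀) ≡ just rej) where

      Clash : (Word → Maybe Bool) → Set
      Clash T = ∃ λ u → u ∈ queries ρ × ∃ λ a → T u ≡ just a × B u ≢ a

      clash-or-agree : ∀ T ws → (∃ λ u → u ∈ ws × ∃ λ a → T u ≡ just a × B u ≢ a) ⊎ (∀ {u} → u ∈ ws → B u ≡ total T B u)
      clash-or-agree T [] = inj₂ λ ()
      clash-or-agree T (w ∷ ws) with T w in e | clash-or-agree T ws
      ... | _ | inj₁ (u , i , r) = inj₁ (u , there i , r)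
      ... | nothing | inj₂ ag = inj₂ λ { (here refl) → sym (cong (fromMaybe _) e) ; (there i) → ag i }
      ... | just a | inj₂ ag with B w Bool.≟ a
      ...   | no ne = inj₁ (w , here refl , a , e , ne)
      ...   | yes eq = inj₂ λ { (here refl) → trans eq (sym (cong (fromMaybe _) e)) ; (there i) → ag i }

      -- An accepting and a rejecting path that did not contradict each other would be paths under a common oracle.
      clash : ∀ T → AccPath T → Clash T
      clash T path with clash-or-agree T (queries ρ)
      ... | inj₁ c = c
      ... | inj₂ ag = ⊥-elim (under (total T B) x (accPath-produces B path , _ , _ , proj₁ (reaches-agree ρ ag) , rejects))

      -- The potential of the rounds, applied to the queries of the rejecting path `ρ`: the number
      -- of them, counted with repetition, that the table leaves open.
      unknown : List Tok → List Word → ℕ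
      unknown ts [] = 0
      unknown ts (w ∷ ws) = (if is-nothing (table ts w) then 1 else 0) + unknown ts ws

      unknown-≤-length : ∀ ts ws → unknown ts ws ≤ length ws
      unknown-≤-length ts [] = z≤n
      unknown-≤-length ts (w ∷ ws) with table ts w
      ... | nothing = s≤s (unknown-≤-length ts ws)
      ... | just _ = ≤-trans (unknown-≤-length ts ws) (n≤1+n _)

      module _ {ts us} (covers : ∀ {w a} → table ts w ≡ just a → ∃ λ b → table us w ≡ just b) where
        unknown-mono : ∀ ws → unknown us ws ≤ unknown ts ws
        unknown-mono [] = z≤n
        unknown-mono (w ∷ ws) with table ts w in e | table us w in e₁
        ... | nothing | nothing = s≤s (unknown-mono ws)
        ... | nothing | just _ = ≤-trans (unknown-mono ws) (n≤1+n _)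
        ... | just _ | just _ = unknown-mono ws
        ... | just _ | nothing with trans (sym e₁) (proj₂ (covers e))
        ...   | ()

        unknown-decreases : ∀ {u b} ws → u ∈ ws → table ts u ≡ nothing → table us u ≡ just b → unknown us ws < unknown ts ws
        unknown-decreases (w ∷ ws) (here refl) e e₁ rewrite e | e₁ = s≤s (unknown-mono ws)
        unknown-decreases (w ∷ ws) (there i) e e₁ =
          subst (_≤ unknown ts (w ∷ ws)) (+-suc (if is-nothing (table us w) then 1 else 0) (unknown us ws))
            (+-mono-≤ (head-mono w) (unknown-decreases ws i e e₁))
          where
          head-mono : ∀ w → (if is-nothing (table us w) then 1 else 0) ≤ (if is-nothing (table ts w) then 1 else 0)
          head-mono w with table ts w in e | table us w in e₁
          ... | nothing | nothing = ≤-refl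
          ... | nothing | just _ = z≤n
          ... | just _ | just _ = z≤n
          ... | just _ | nothing with trans (sym e₁) (proj₂ (covers e))
          ...   | ()

      -- The extended table answers some query of `ρ` wrongly. Since `ts` itself agrees with `B`,
      -- that query was open in `ts`; after the correction it is settled.
      round-progress : ∀ ts → Good B ts → Sat (flat ts) (p + p) → unknown (round ts) (queries ρ) < unknown ts (queries ρ)
      round-progress ts good sat with clash _ (ex-sat ts sat)
      ... | u , i , a , e , ne = unknown-decreases (λ {w} e → B w , round-covers ts (table-++ ts (ex ts) e)) (queries ρ) i fresh (round-covers ts e)
        where
        fresh : table ts u ≡ nothing
        fresh with table ts u in e₁
        ... | nothing = refl
        ... | just b = ⊥-elim (ne (trans (agrees good e₁) (just-injective (trans (sym (table-++ ts (ex ts) e₁)) e))))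

      -- Progress in a round requires its table to be extendable. This is known only after the last
      -- round and is carried back to the earlier ones by `sat-back`.
      rounds-progress : ∀ k ts → Good B ts → Sat (flat (rounds k ts)) (p + p) →
        Sat (flat ts) (p + p) × k < unknown ts (queries ρ)
      rounds-progress zero ts good sat = sat , ≤-trans (s≤s z≤n) (round-progress ts good sat)
      rounds-progress (suc k) ts good sat with rounds-progress k (round ts) (round-good ts) sat
      ... | sat₁ , lt = sat₂ , ≤-trans (s≤s lt) (round-progress ts good sat₂)
        where sat₂ = sat-back ts good sat₁

      -- `ρ` has at most p queries, and each round that starts from an extendable table settles one,
      -- so p rounds exhaust the potential.
      rounds-unsat : ∀ k → p ≤ k → ¬ Sat (flat (rounds k [])) (p + p)
      rounds-unsat k p≤k sat = <⇒≱ (proj₂ (rounds-progress k [] good-[] sat))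
        (≤-trans (unknown-≤-length [] (queries ρ)) (≤-trans (≤-trans (length≤codeLength (queries ρ)) (≤-trans (queries-codeLength ρ) (bounded B ρ))) p≤k))

-- Simulation of a machine by a stack program

symBits : Sym → Bool × Bool
symBits s0 = false , false
symBits s1 = false , true
symBits blank = true , false

bitsSym : Bool → Bool → Sym
bitsSym true _ = blank
bitsSym false true = s1
bitsSym false false = s0

bitsSym-symBits : ∀ s → bitsSym (proj₁ (symBits s)) (proj₂ (symBits s)) ≡ s
bitsSym-symBits s0 = refl
bitsSym-symBits s1 = refl
bitsSym-symBits blank = refl

symStack : List Sym → List Bool
symStack [] = []
symStack (s ∷ l) = proj₁ (symBits s) ∷ proj₂ (symBits s) ∷ symStack l

symStack-length : ∀ l → length (symStack l) ≡ length l + length l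
symStack-length [] = refl
symStack-length (s ∷ l) = cong suc (trans (cong suc (symStack-length l)) (sym (+-suc (length l) (length l))))

module _ {K : ℕ} where
  pushSym : Fin K → Sym → SCmd K ⊤
  pushSym i s = op (push i (proj₂ (symBits s))) >> op (push i (proj₁ (symBits s)))

  -- An empty stack reads as `blank`, like the cells beyond the listed part of a tape.
  popSym₂ : Fin K → Maybe Bool → SCmd K Sym
  popSym₂ i nothing = ret blank
  popSym₂ i (just a) = op (pop i) >>= λ { nothing → ret blank ; (just b) → ret (bitsSym a b) }

  popSym : Fin K → SCmd K Sym
  popSym i = op (pop i) >>= popSym₂ i

  chooseFrom : ∀ {A : Set} → A → List A → SCmd K A
  chooseFrom x [] = ret x
  chooseFrom x (y ∷ ys) = op choose >>= λ b → if b then chooseFrom y ys else ret x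

  withFlips : SSt K → List Bool → SSt K
  withFlips σ ω = record σ { flips = ω }

  chooseFrom-some : ∀ {A : Set} (x : A) xs σ ω →
    ∃ λ a → ∃ λ ω₁ → a ∈ x ∷ xs × ExecS (chooseFrom x xs) (withFlips σ ω) a (withFlips σ ω₁) (length xs)
  chooseFrom-some x [] σ ω = x , ω , here refl , ret
  chooseFrom-some x (y ∷ ys) σ [] = x , [] , here refl , weak (s≤s z≤n) (bind op ret)
  chooseFrom-some x (y ∷ ys) σ (false ∷ ω) = x , ω , here refl , weak (s≤s z≤n) (bind op ret)
  chooseFrom-some x (y ∷ ys) σ (true ∷ ω) with chooseFrom-some y ys σ ω
  ... | a , ω₁ , i , e = a , ω₁ , there i , bind op e

  chooseFrom-any : ∀ {A : Set} {a x : A} {xs} → a ∈ x ∷ xs → ∀ σ ω₁ →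
    ∃ λ ω → ExecS (chooseFrom x xs) (withFlips σ ω) a (withFlips σ ω₁) (length xs)
  chooseFrom-any {xs = []} (here refl) σ ω₁ = ω₁ , ret
  chooseFrom-any {xs = _ ∷ _} (here refl) σ ω₁ = false ∷ ω₁ , weak (s≤s z≤n) (bind op ret)
  chooseFrom-any {xs = _ ∷ _} (there i) σ ω₁ with chooseFrom-any i σ ω₁
  ... | ω , e = true ∷ ω , bind op e

finite-bound : ∀ {A : Set} → Finite A → (f : A → ℕ) → ∃ λ b → ∀ a → f a ≤ b
finite-bound FA f = maxOver (Finite.elements FA) , λ a → le (Finite.complete FA a)
  where
  maxOver : List _ → ℕ
  maxOver [] = 0
  maxOver (a ∷ as) = f a ⊔ maxOver as
  le : ∀ {a as} → a ∈ as → f a ≤ maxOver as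
  le (here refl) = m≤m⊔n _ _
  le (there i) = ≤-trans (le i) (m≤n⊔m _ _)

module Answers (N : NOTM) (T : Word → Maybe Bool) where
  open Paths N

  D : Lang
  D w = fromMaybe false (T w)

  Known : List Word → Set
  Known ws = ∀ {u} → u ∈ ws → ∃ λ a → T u ≡ just a

  known-++ : ∀ {us vs} → Known us → Known vs → Known (us ++ vs)
  known-++ {[]} k k₁ i = k₁ i
  known-++ {u ∷ us} k k₁ (here refl) = k (here refl)
  known-++ {u ∷ us} k k₁ (there i) = known-++ {us} (λ i → k (there i)) k₁ i

  -- An unanswered query ends the simulation with `unk`, so an accepting simulation certifies that
  -- every query on its path was answered.
  data SimResult (c : Config N) (o : Outcome) : Set where
    died     : o ≡ unk → (∃ λ u → T u ≡ nothing) → SimResult c o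
    finished : ∀ {c₁ n} (r : Reaches N D c c₁ n) → NOTM.halt N (Config.state c₁) ≡ just o → Known (queries r) → SimResult c o

-- Stacks 0 and 1 hold the two halves of the simulated tape, stack 2 the simulated query tape (last symbol on top).
module Simulation (N : NOTM) {K' : ℕ} (oracle : SCmd (3 + K') (Maybe Bool)) where
  open NOTM N
  open Paths N

  leftS rightS queryS : Fin (3 + K')
  leftS = fzero
  rightS = fsuc fzero
  queryS = fsuc (fsuc fzero)

  moveCode : Sym → Move → SCmd (3 + K') Sym
  moveCode s moveL = pushSym rightS s >> popSym leftS
  moveCode s moveR = pushSym leftS s >> popSym rightS
  moveCode s stay = ret s

  appendCode : Maybe Bool → SCmd (3 + K') ⊤
  appendCode nothing = ret tt
  appendCode (just b) = op (push queryS b)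

  Control : Set
  Control = Fin Q × Sym

  actCode : Fin Q × Sym × Move × Maybe Bool → SCmd (3 + K') (Control ⊎ Outcome)
  actCode (q , s , m , mb) = appendCode mb >> (moveCode s m >>= λ h → ret (inj₁ (q , h)))

  answered : Sym → Maybe Bool → SCmd (3 + K') (Control ⊎ Outcome)
  answered h nothing = ret (inj₂ unk)
  answered h (just b) = ret (inj₁ ((if b then yesSt else noSt) , h))

  stepCode : ∀ {q} → Kind q → Sym → SCmd (3 + K') (Control ⊎ Outcome)
  stepCode (halted {o} _) h = ret (inj₂ o)
  stepCode (asking _ _) h = oracle >>= answered h
  stepCode {q} (ordinary _ _) h = chooseFrom (List⁺.head (δ q h)) (List⁺.tail (δ q h)) >>= actCode

  simulate : Control → SCmd (3 + K') Outcome
  simulate = iter (λ (q , h) → stepCode (kind q) h)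

  -- The input is expected on the right stack, first symbol on top.
  simulateInput : SCmd (3 + K') Outcome
  simulateInput = popSym rightS >>= λ h → simulate (start , h)

  branching : ∃ λ b → ∀ (qs : Fin Q × Sym) → length (List⁺.tail (δ (proj₁ qs) (proj₂ qs))) ≤ b
  branching = finite-bound fin-× (λ (q , s) → length (List⁺.tail (δ q s)))

  -- `W` bounds the simulated query words and `E` the time of the oracle code on them. The oracle
  -- code has to leave the query stack empty, since the machine erases its query tape.
  module Correct (T : Word → Maybe Bool) (rest : Vec (List Bool) K') (inp : List Bool) (out : Word) (W E : ℕ)
    (oracle-correct : ∀ l r w ω → length w ≤ W →
      ExecS oracle (sst (l ∷ r ∷ reverse w ∷ rest) inp out ω) (T w) (sst (l ∷ r ∷ [] ∷ rest) inp out ω) E) where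

    open Answers N T

    rep : List Sym → List Sym → Word → List Bool → SSt (3 + K')
    rep l r w ω = sst (symStack l ∷ symStack r ∷ reverse w ∷ rest) inp out ω

    repC : Config N → List Bool → SSt (3 + K')
    repC (cfg q (tape l h r) w) ω = rep l r w ω

    control : Config N → Control
    control (cfg q (tape l h r) w) = q , h

    popSym-left : ∀ s l r w ω → ExecS (popSym leftS) (rep (s ∷ l) r w ω) s (rep l r w ω) 2
    popSym-left s l r w ω = returns (bitsSym-symBits s) (bind op (bind op ret))

    popSym-right : ∀ s l r w ω → ExecS (popSym rightS) (rep l (s ∷ r) w ω) s (rep l r w ω) 2
    popSym-right s l r w ω = returns (bitsSym-symBits s) (bind op (bind op ret))

    move-correct : ∀ s m l r w ω → let tape l₁ h₁ r₁ = moveT m (tape l s r) in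
      ExecS (moveCode s m) (rep l r w ω) h₁ (rep l₁ r₁ w ω) 4
    move-correct s moveL [] r w ω = weak (m≤m+n 3 1) (bind (bind op op) (bind op ret))
    move-correct s moveL (x ∷ l) r w ω = bind (bind op op) (popSym-left x l (s ∷ r) w ω)
    move-correct s moveR l [] w ω = weak (m≤m+n 3 1) (bind (bind op op) (bind op ret))
    move-correct s moveR l (x ∷ r) w ω = bind (bind op op) (popSym-right x (s ∷ l) r w ω)
    move-correct s stay l r w ω = weak z≤n ret

    append-correct : ∀ mb l r w ω → ExecS (appendCode mb) (rep l r w ω) tt (rep l r (appendQ mb w) ω) 1
    append-correct nothing l r w ω = weak z≤n ret
    append-correct (just b) l r w ω =
      ends (cong (λ q → sst (symStack l ∷ symStack r ∷ q ∷ rest) inp out ω) (sym (reverse-++ w (b ∷ [])))) op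

    act-correct : ∀ q l h r w ω a → let c = applyAct N (tape l h r) w a in
      ExecS (actCode a) (repC (cfg q (tape l h r) w) ω) (inj₁ (control c)) (repC c ω) 5
    act-correct q l h r w ω (q₁ , s , m , mb) =
      bind (append-correct mb l r w ω) (bind (move-correct s m l r (appendQ mb w) ω) ret)

    stepCost : ℕ
    stepCost = proj₁ branching + 5 + E

    StepExec : Config N → List Bool → Control ⊎ Outcome → SSt (3 + K') → Set₁
    StepExec c ω res σ = ExecS (stepCode (kind (proj₁ (control c))) (proj₂ (control c))) (repC c ω) res σ stepCost

    data StepResult (c : Config N) (ω : List Bool) : Set₁ where
      halts : ∀ {o} → halt (proj₁ (control c)) ≡ just o → StepExec c ω (inj₂ o) (repC c ω) → StepResult c ω
      dies  : ∀ {l r} → (∃ λ u → T u ≡ nothing) → StepExec c ω (inj₂ unk) (sst (l ∷ r ∷ [] ∷ rest) inp out ω) → StepResult c ω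
      continues : ∀ {c₁ ω₁} → c₁ ∈ succs N D c → Known (asked (kind (proj₁ (control c))) (Config.qword c)) →
              StepExec c ω (inj₁ (control c₁)) (repC c₁ ω₁) → StepResult c ω

    known-asked : ∀ {q w a} (k : Kind q) → T w ≡ just a → Known (asked k w)
    known-asked (asking _ _) e (here refl) = _ , e

    if-D : ∀ {w b} → T w ≡ just b → D w ≡ b
    if-D e = cong (fromMaybe false) e

    recognize : ∀ {q} {k k₁ : Kind q} {h σ res σ₁ n} → k ≡ k₁ →
      ExecS (stepCode k₁ h) σ res σ₁ n → ExecS (stepCode k h) σ res σ₁ n
    recognize refl d = d

    answer-known : ∀ {a b : Maybe Bool} {h σ res σ₁ n} → a ≡ b →
      ExecS (answered h b) σ res σ₁ n → ExecS (answered h a) σ res σ₁ n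
    answer-known refl d = d

    answer-exec : ∀ {q e e₁ l h r w ω b} → length w ≤ W → T w ≡ just b →
      ExecS (stepCode (asking {q = q} e e₁) h) (rep l r w ω) (inj₁ ((if D w then yesSt else noSt) , h)) (rep l r [] ω) stepCost
    answer-exec {h = h} {w = w} {ω} {b} le e = weak (≤-trans (≤-reflexive (+-identityʳ E)) (m≤n+m E _))
      (bind (oracle-correct _ _ w ω le) (answer-known e
        (subst (λ d → ExecS (answered h (just b)) _ (inj₁ ((if d then yesSt else noSt) , h)) _ 0) (sym (if-D e)) ret)))

    step-some : ∀ c ω → length (Config.qword c) ≤ W → StepResult c ω
    step-some (cfg q (tape l h r) w) ω le = go (kind q) refl
      where
      go : (k : Kind q) → kind q ≡ k → StepResult (cfg q (tape l h r) w) ω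
      go (halted e) eq = halts e (recognize eq (weak z≤n ret))
      go k@(asking e e₁) eq with T w in Tw
      ... | nothing = dies (w , Tw) (recognize eq
              (weak (≤-trans (≤-reflexive (+-identityʳ E)) (m≤n+m E _)) (bind (oracle-correct _ _ w ω le)
                (answer-known Tw ret))))
      ... | just b = continues {c₁ = cfg (if D w then yesSt else noSt) (tape l h r) []} (subst (_ ∈_) (sym (succs-query {D} {q} {tape l h r} {w} e e₁)) (here refl))
              (known-asked (kind q) Tw)
              (recognize eq (answer-exec {e = e} {e₁} {l} {h} {r} {w} {ω} le Tw))
      go (ordinary e ne) eq with chooseFrom-some (List⁺.head (δ q h)) (List⁺.tail (δ q h)) (rep l r w ω) ω
      ... | a , ω₁ , i , d = continues {c₁ = applyAct N (tape l h r) w a}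
              (subst (applyAct N (tape l h r) w a ∈_) (sym (succs-step {D} {q} {tape l h r} {w} e ne)) (∈-map⁺ (applyAct N (tape l h r) w) i))
              (λ {u} m → ⊥-elim (none (subst (λ k → u ∈ asked k w) eq m)))
              (recognize eq
                (weak (≤-trans (+-monoˡ-≤ 5 (proj₂ branching (q , h))) (m≤m+n _ E)) (bind d (act-correct q l h r w ω₁ a))))
        where
        none : ∀ {u} → ¬ (u ∈ [])
        none ()

    SimExec : Config N → List Bool → Outcome → ℕ → Set₁
    SimExec c ω o n = ∃ λ l → ∃ λ r → ∃ λ q → ∃ λ ω₁ → ExecS (simulate (control c)) (repC c ω) o (sst (l ∷ r ∷ q ∷ rest) inp out ω₁) n

    -- A step lengthens the query word by at most one symbol, so its length plus the remaining steps
    -- stays below `W`. Every word asked is thus in the range of `oracle-correct`.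
    qword-succ : ∀ c c₁ {m} → c₁ ∈ succs N D c → length (Config.qword c) + suc m ≤ W → length (Config.qword c₁) + m ≤ W
    qword-succ (cfg q t w) c₁ {m} i le = ≤-trans (+-monoˡ-≤ m (≤-trans (m≤n+m _ (codeLength (asked (kind q) w))) (step-codeLength (kind q) i)))
      (≤-trans (≤-reflexive (sym (+-suc (length w) m))) le)

    simulate-some : ∀ m c ω → BoundedFrom D c m → length (Config.qword c) + m ≤ W →
      ∃ λ o → SimResult c o × SimExec c ω o (suc m * suc stepCost)
    simulate-some m c@(cfg q (tape l h r) w) ω bd le with step-some c ω (≤-trans (m≤m+n _ m) le)
    ... | halts e d = _ , finished done e (λ ()) , _ , _ , _ , _ , weak (m≤m+n _ _) (stop d)
    ... | dies u d = unk , died refl u , _ , _ , _ , _ , weak (m≤m+n _ _) (stop d)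
    simulate-some zero c@(cfg q (tape l h r) w) ω bd le | continues i known d with bd (step i done)
    ... | ()
    simulate-some (suc m) c@(cfg q (tape l h r) w) ω bd le | continues {c₁} {ω₁} i known d
      with simulate-some m c₁ ω₁ (bounded-succ bd i) (qword-succ c c₁ i le)
    ... | o , died e u , _ , _ , _ , _ , d₁ = o , died e u , _ , _ , _ , _ , more d d₁
    ... | o , finished p e known₁ , _ , _ , _ , _ , d₁ =
      o , finished (step i p) e (known-++ {asked (kind q) w} known known₁) , _ , _ , _ , _ , more d d₁

    step-any : ∀ c {c₁} → c₁ ∈ succs N D c → length (Config.qword c) ≤ W →
      Known (asked (kind (Config.state c)) (Config.qword c)) → ∀ ω₁ → ∃ λ ω → StepExec c ω (inj₁ (control c₁)) (repC c₁ ω₁)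
    step-any (cfg q (tape l h r) w) {c₁} i le known ω₁ = go (kind q) refl
      where
      go : (k : Kind q) → kind q ≡ k → ∃ λ ω → StepExec (cfg q (tape l h r) w) ω (inj₁ (control c₁)) (repC c₁ ω₁)
      go (halted e) eq with subst (_ ∈_) (succs-halted {D} {q} {tape l h r} {w} e) i
      ... | ()
      go (asking e e₁) eq with subst (c₁ ∈_) (succs-query {D} {q} {tape l h r} {w} e e₁) i | known (subst (λ k → w ∈ asked k w) (sym eq) (here refl))
      ... | here refl | b , Tw = ω₁ , recognize eq (answer-exec {e = e} {e₁} {l} {h} {r} {w} {ω₁} le Tw)
      go (ordinary e ne) eq with succ-action {D} {q} {tape l h r} {w} e ne i
      ... | a , j , refl with chooseFrom-any j (rep l r w ω₁) ω₁
      ... | ω , d = ω , recognize eq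
        (weak (≤-trans (+-monoˡ-≤ 5 (proj₂ branching (q , h))) (m≤m+n _ E)) (bind d (act-correct q l h r w ω₁ a)))

    simulate-any : ∀ {c c₁ n o} (p : Reaches N D c c₁ n) → halt (Config.state c₁) ≡ just o → Known (queries p) →
      length (Config.qword c) + n ≤ W → ∃ λ ω → ∃ λ k → SimExec c ω o k
    simulate-any {cfg q (tape l h r) w} {o = o} done e known le =
      [] , _ , _ , _ , _ , _ , stop (go (kind q))
      where
      go : (k : Kind q) → ExecS (stepCode k h) (rep l r w []) (inj₂ o) (rep l r w []) 0
      go (halted e₁) with trans (sym e) e₁
      ... | refl = ret
      go (asking e₁ _) with trans (sym e) e₁
      ... | ()
      go (ordinary e₁ _) with trans (sym e) e₁
      ... | ()
    simulate-any {c@(cfg q (tape l h r) w)} (step {c' = c₁} {n = n} i p) e known le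
      with simulate-any p e (λ m → known (∈-++⁺ʳ (asked (kind q) w) m)) (qword-succ c c₁ i le)
    ... | ω₁ , _ , _ , _ , _ , _ , d with step-any c i (≤-trans (m≤m+n _ (suc n)) le) (λ m → known (∈-++⁺ˡ m)) ω₁
    ... | ω , d₁ = ω , _ , _ , _ , _ , _ , more d₁ d

    inputRep : Word → List Bool → SSt (3 + K')
    inputRep x ω = sst ([] ∷ symStack (map bitSym x) ∷ [] ∷ rest) inp out ω

    load : ∀ x ω → ExecS (popSym rightS) (inputRep x ω) (Tape.head (initTape x)) (repC (initCfg N x) ω) 2
    load [] ω = weak (s≤s z≤n) (bind op ret)
    load (b ∷ x) ω = popSym-right (bitSym b) [] (map bitSym x) [] ω

    control-initial : ∀ x → control (initCfg N x) ≡ (start , Tape.head (initTape x))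
    control-initial [] = refl
    control-initial (b ∷ x) = refl

    InputExec : Word → List Bool → Outcome → ℕ → Set₁
    InputExec x ω o n = ∃ λ l → ∃ λ r → ∃ λ q → ∃ λ ω₁ → ExecS simulateInput (inputRep x ω) o (sst (l ∷ r ∷ q ∷ rest) inp out ω₁) n

    input-exec : ∀ {x ω o n} → SimExec (initCfg N x) ω o n → InputExec x ω o (2 + n)
    input-exec {x} {ω} {o} {n} (l , r , q , ω₁ , d) = l , r , q , ω₁ ,
      bind (load x ω) (subst (λ ch → ExecS (simulate ch) (repC (initCfg N x) ω) o (sst (l ∷ r ∷ q ∷ rest) inp out ω₁) n) (control-initial x) d)

    simulateInput-some : ∀ m x ω → BoundedFrom D (initCfg N x) m → m ≤ W →
      ∃ λ o → SimResult (initCfg N x) o × InputExec x ω o (2 + suc m * suc stepCost)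
    simulateInput-some m x ω bd le with simulate-some m (initCfg N x) ω bd le
    ... | o , res , d = o , res , input-exec {x} {ω} d

    simulateInput-any : ∀ {x c n o} (p : Reaches N D (initCfg N x) c n) → halt (Config.state c) ≡ just o → Known (queries p) →
      n ≤ W → ∃ λ ω → ∃ λ k → InputExec x ω o k
    simulateInput-any {x} p e known le with simulate-any p e known le
    ... | ω , k , d = ω , _ , input-exec {x} {ω} d

-- NP ∩ coNP and reductions to the empty oracle

-- Renaming the outcomes of halting states leaves the computation paths as they are.
module MapOutcome (f : Outcome → Outcome) (N : NOTM) where
  open NOTM N

  mapped : NOTM
  mapped = record { Q = Q ; start = start ; halt = λ q → Maybe.map f (halt q) ; query = query ; yesSt = yesSt ; noSt = noSt ; δ = δ }

  image : Config N → Config mapped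
  image (cfg q t w) = cfg q t w

  succs-image : ∀ D c → succs mapped D (image c) ≡ map image (succs N D c)
  succs-image D (cfg q t w) with halt q
  ... | just _ = refl
  ... | nothing with q ≟ query
  ...   | yes _ = refl
  ...   | no _ = map-∘ (toList (δ q (Tape.head t)))

  reaches-image : ∀ {D c c₁ n} → Reaches N D c c₁ n → Reaches mapped D (image c) (image c₁) n
  reaches-image done = done
  reaches-image {D} {c} (step i r) = step (subst (_ ∈_) (sym (succs-image D c)) (∈-map⁺ image i)) (reaches-image r)

  succ-image⁻ : ∀ D c {d} → d ∈ succs mapped D (image c) → ∃ λ c₁ → c₁ ∈ succs N D c × d ≡ image c₁
  succ-image⁻ D c {d} i = ∈-map⁻ image {xs = succs N D c} (subst (d ∈_) (succs-image D c) i)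

  data Preimage (D : Lang) (c : Config N) (n : ℕ) : Config mapped → Set where
    preimage : ∀ c₁ → Reaches N D c c₁ n → Preimage D c n (image c₁)

  reaches-image⁻ : ∀ {D} c {d n} → Reaches mapped D (image c) d n → Preimage D c n d
  reaches-image⁻ c done = preimage c done
  reaches-image⁻ {D} c {d} {suc n} (step {c' = c'} i r) = go (succ-image⁻ D c i) r
    where
    prefix : ∀ {c₁ d} → c₁ ∈ succs N D c → Preimage D c₁ n d → Preimage D c (suc n) d
    prefix j (preimage c₂ r₁) = preimage c₂ (step j r₁)
    go : (∃ λ c₁ → c₁ ∈ succs N D c × c' ≡ image c₁) → Reaches mapped D c' d n → Preimage D c (suc n) d
    go (c₁ , j , refl) r = prefix j (reaches-image⁻ c₁ r)

  bounded-image : PolyBounded N → PolyBounded mapped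
  bounded-image (k , bd) = k , λ D x c n r → go D x n (reaches-image⁻ (initCfg N x) r)
    where
    go : ∀ D x n {d} → Preimage D (initCfg N x) n d → n ≤ length x ^ k + k
    go D x n (preimage c₁ r₁) = bd D x c₁ n r₁

  produces-image : ∀ {D x o} → Produces N D x o → Produces mapped D x (f o)
  produces-image (c , n , r , h) = image c , n , reaches-image r , cong (Maybe.map f) h

  produces-image⁻ : ∀ {D x o} → Produces mapped D x o → ∃ λ o₁ → Produces N D x o₁ × f o₁ ≡ o
  produces-image⁻ {D} {x} {o} (d , n , r , h) = go (reaches-image⁻ (initCfg N x) r) h
    where
    source : ∀ mo → Maybe.map f mo ≡ just o → ∃ λ o₁ → mo ≡ just o₁ × f o₁ ≡ o
    source (just o₁) refl = o₁ , refl , refl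
    go : ∀ {d} → Preimage D (initCfg N x) n d → NOTM.halt mapped (Config.state d) ≡ just o →
      ∃ λ o₁ → Produces N D x o₁ × f o₁ ≡ o
    go (preimage c r₁) h₁ = let o₁ , e , e₁ = source (halt (Config.state c)) h₁ in o₁ , (c , n , r₁ , e) , e₁

open Equivalence

bool-cases : ∀ b → b ≡ true ⊎ b ≡ false
bool-cases true = inj₁ refl
bool-cases false = inj₂ refl

complement-true : ∀ {A : Lang} {x} → A x ≡ false → complement A x ≡ true
complement-true e rewrite e = refl

complement-false : ∀ {A : Lang} {x} → complement A x ≡ true → A x ≡ false
complement-false {A} {x} e with A x
... | false = refl

module _ {N : NOTM} (pb : PolyBounded N) where
  outputs-some : ∀ D x → ∃ λ o → Produces N D x o
  outputs-some D x = Paths.produces-some N (length x ^ proj₁ pb + proj₁ pb) (proj₂ pb D x _ _)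

P⊆NP : ∀ {A} → InP A → InNP A
P⊆NP (N , _ , pb , ac) = N , pb , ac

refute : Outcome → Outcome
refute acc = rej
refute rej = acc
refute unk = acc

-- A deterministic machine has exactly one outcome, so accepting exactly when that outcome differs
-- from `acc` decides the complement.
P⊆coNP : ∀ {A} → InP A → InCoNP A
P⊆coNP {A} (N , det , pb , ac) = mapped , bounded-image pb , λ x → mk⇔ (there₁ x) (back x)
  where
  open MapOutcome refute N
  there₁ : ∀ x → complement A x ≡ true → Produces mapped ∅ x acc
  there₁ x e with outputs-some pb ∅ x
  ... | acc , p with trans (sym (from (ac x) p)) (complement-false {A} e)
  ...   | ()
  there₁ x e | rej , p = produces-image p
  there₁ x e | unk , p = produces-image p
  back : ∀ x → Produces mapped ∅ x acc → complement A x ≡ true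
  back x p with bool-cases (A x)
  ... | inj₂ e = complement-true {A} e
  ... | inj₁ e with produces-image⁻ p
  ... | o , p₁ , e₁ with Paths.produces-unique N det p₁ (to (ac x) e)
  back x p | inj₁ e | acc , p₁ , () | refl

decisive : Outcome → Outcome
decisive acc = acc
decisive rej = rej
decisive unk = rej

-- Under every oracle a deterministic machine has exactly one outcome. Once `unk` counts as `rej`,
-- it is robustly overproductive and underproductive.
pT⇒RS : ∀ {A B} → A ≤pT B → A ≤RS B
pT⇒RS {A} {B} (N , det , pb , ac) = mapped , bounded-image pb , over , under , λ x → mk⇔ (λ e → produces-image (to (ac x) e)) (back x)
  where
  open MapOutcome decisive N
  over : RobustlyOverproductive mapped
  over D x with outputs-some pb D x
  ... | acc , p = inj₁ (produces-image p)
  ... | rej , p = inj₂ (produces-image p)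
  ... | unk , p = inj₂ (produces-image p)
  acc-source : ∀ {D x} → Produces mapped D x acc → Produces N D x acc
  acc-source p with produces-image⁻ p
  ... | acc , p₁ , _ = p₁
  under : RobustlyUnderproductive mapped
  under D x (p , p₁) with produces-image⁻ p₁
  ... | o , p₂ , e with Paths.produces-unique N det (acc-source p) p₂
  under D x (p , p₁) | .acc , p₂ , () | refl
  back : ∀ x → Produces mapped B x acc → A x ≡ true
  back x p = from (ac x) (acc-source p)

module _ {K : ℕ} where
  setStack : Fin K → List Bool → SSt K → SSt K
  setStack i s σ = record σ { stacks = stacks σ [ i ]≔ s }

  pop-nonempty : ∀ {i : Fin K} {b s σ} → Vec.lookup (stacks σ) i ≡ b ∷ s → ExecS (op (pop i)) σ (just b) (setStack i s σ) 1
  pop-nonempty {i} {b} {s} {σ} e =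
    subst (λ l → ExecS (op (pop i)) σ (proj₁ (popStack i l σ)) (proj₂ (popStack i l σ)) 1) e op

  pop-empty : ∀ {i : Fin K} {σ} → Vec.lookup (stacks σ) i ≡ [] → ExecS (op (pop i)) σ nothing σ 1
  pop-empty {i} {σ} e =
    subst (λ l → ExecS (op (pop i)) σ (proj₁ (popStack i l σ)) (proj₂ (popStack i l σ)) 1) e op

  clear : Fin K → SCmd K ⊤
  clear i = iter (λ _ → op (pop i) >>= λ { nothing → ret (inj₂ tt) ; (just _) → ret (inj₁ tt) }) tt

  clear-exec : ∀ i s σ → Vec.lookup (stacks σ) i ≡ s → ExecS (clear i) σ tt (setStack i [] σ) (length s * 2 + 2)
  clear-exec i [] σ e = ends (cong (λ v → record σ { stacks = v }) (sym (trans (cong (stacks σ [ i ]≔_) (sym e)) (Vec.[]≔-lookup (stacks σ) i)))) (stop (bind (pop-empty e) ret))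
  clear-exec i (b ∷ s) σ e = more (bind (pop-nonempty e) ret)
    (ends (cong (λ v → record σ { stacks = v }) (Vec.[]≔-idempotent (stacks σ) i)) (clear-exec i s (setStack i s σ) (Vec.lookup∘updateAt i (stacks σ))))

  readInput : (Bool → SCmd K ⊤) → SCmd K ⊤
  readInput f = iter (λ _ → op popInput >>= λ { nothing → ret (inj₂ tt) ; (just b) → f b >> ret (inj₁ tt) }) tt

  moveStack : Fin K → Fin K → SCmd K ⊤
  moveStack i j = iter (λ _ → op (pop i) >>= λ { nothing → ret (inj₂ tt) ; (just b) → op (push j b) >> ret (inj₁ tt) }) tt

  moveStack-exec : ∀ i j → i ≢ j → ∀ s σ → Vec.lookup (stacks σ) i ≡ s →
    ExecS (moveStack i j) σ tt (setStack j (s ʳ++ Vec.lookup (stacks σ) j) (setStack i [] σ)) (length s * 3 + 2)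
  moveStack-exec i j ne [] σ e = ends (cong (λ v → record σ { stacks = v }) same) (stop (bind (pop-empty e) ret))
    where
    v₁ : stacks σ [ i ]≔ [] ≡ stacks σ
    v₁ = trans (cong (stacks σ [ i ]≔_) (sym e)) (Vec.[]≔-lookup (stacks σ) i)
    same : stacks σ ≡ (stacks σ [ i ]≔ []) [ j ]≔ Vec.lookup (stacks σ) j
    same = sym (trans (cong (_[ j ]≔ Vec.lookup (stacks σ) j) v₁) (Vec.[]≔-lookup (stacks σ) j))
  moveStack-exec i j ne (b ∷ s) σ e = more (bind (pop-nonempty e) (bind op ret))
    (ends (cong (λ v → record σ { stacks = v }) same)
      (moveStack-exec i j ne s σ₁ (trans (Vec.lookup∘updateAt′ i j ne (stacks σ [ i ]≔ s)) (Vec.lookup∘updateAt i (stacks σ)))))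
    where
    v = stacks σ
    t = Vec.lookup v j
    σ₁ = proj₂ (effectS (push j b) (setStack i s σ))
    top₁ : Vec.lookup (stacks σ₁) j ≡ b ∷ t
    top₁ = trans (Vec.lookup∘updateAt j (v [ i ]≔ s)) (cong (b ∷_) (Vec.lookup∘updateAt′ j i (λ q → ne (sym q)) v))
    same : (stacks σ₁ [ i ]≔ []) [ j ]≔ (s ʳ++ Vec.lookup (stacks σ₁) j) ≡ (v [ i ]≔ []) [ j ]≔ ((b ∷ s) ʳ++ t)
    same = trans (cong (λ l → (stacks σ₁ [ i ]≔ []) [ j ]≔ (s ʳ++ l)) top₁)
      (trans (cong (_[ j ]≔ (s ʳ++ (b ∷ t))) (trans (Vec.[]≔-commutes (v [ i ]≔ s) j i (λ q → ne (sym q)))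
         (cong (_[ j ]≔ (b ∷ Vec.lookup (v [ i ]≔ s) j)) (Vec.[]≔-idempotent v i))))
       (Vec.[]≔-idempotent (v [ i ]≔ []) j))

emptyOracle : ∀ {K'} → SCmd (3 + K') (Maybe Bool)
emptyOracle = clear (fsuc (fsuc fzero)) >> ret (just false)

emptyAnswers : Word → Maybe Bool
emptyAnswers _ = just false

emptyOracle-correct : ∀ {K'} (rest : Vec (List Bool) K') inp out W l r w ω → length w ≤ W →
  ExecS emptyOracle (sst (l ∷ r ∷ reverse w ∷ rest) inp out ω) (just false) (sst (l ∷ r ∷ [] ∷ rest) inp out ω) (W * 2 + 2)
emptyOracle-correct rest inp out W l r w ω le =
  weak (≤-trans (≤-reflexive (+-identityʳ _)) (+-monoˡ-≤ 2 (*-monoˡ-≤ 2 (≤-trans (≤-reflexive (length-reverse w)) le))))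
    (bind (clear-exec _ (reverse w) (sst (l ∷ r ∷ reverse w ∷ rest) inp out ω) refl) ret)

module EmptySim (N : NOTM) {K' : ℕ} (rest : Vec (List Bool) K') (inp : List Bool) (out : Word) (W : ℕ) =
  Simulation.Correct N emptyOracle emptyAnswers rest inp out W (W * 2 + 2) (emptyOracle-correct rest inp out W)

-- Toss a coin and simulate a machine for A or a machine for its complement; accepting there means acc here, respectively rej.
module CoinToss {A : Lang} (np : InNP A) (conp : InCoNP A) where
  N₁ = proj₁ np
  N₂ = proj₁ conp

  onlyAcc : Outcome → Outcome → Outcome
  onlyAcc o acc = o
  onlyAcc o rej = unk
  onlyAcc o unk = unk

  load : SCmd 3 ⊤
  load = readInput (λ b → pushSym (fsuc fzero) (bitSym b))

  branch : Bool → SCmd 3 Outcome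
  branch true = Simulation.simulateInput N₁ emptyOracle >>= λ o → ret (onlyAcc acc o)
  branch false = Simulation.simulateInput N₂ emptyOracle >>= λ o → ret (onlyAcc rej o)

  program : Program (SSig 3)
  program = record
    { Label = ⊤ ; labels = fin-⊤ ; start = tt ; answer = λ _ → tt
    ; body = λ _ → load >> (op choose >>= branch) >>= λ o → ret (inj₂ (just o)) }

  load-exec : ∀ s y ω → ExecS load (sst ([] ∷ symStack (map bitSym y) ∷ [] ∷ []) s [] ω) tt
    (sst ([] ∷ symStack (map bitSym (s ʳ++ y)) ∷ [] ∷ []) [] [] ω) (length s * 4 + 2)
  load-exec [] y ω = stop (bind op ret)
  load-exec (b ∷ s) y ω = more (bind op (bind (pushed b) ret)) (load-exec s (b ∷ y) ω)
    where
    pushed : ∀ b → ExecS (pushSym (fsuc fzero) (bitSym b)) (sst ([] ∷ symStack (map bitSym y) ∷ [] ∷ []) s [] ω) tt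
      (sst ([] ∷ symStack (map bitSym (b ∷ y)) ∷ [] ∷ []) s [] ω) 2
    pushed b = bind op op

  p : ℕ → ℕ
  p n = (n ^ proj₁ (proj₁ (proj₂ np)) + proj₁ (proj₁ (proj₂ np))) + (n ^ proj₁ (proj₁ (proj₂ conp)) + proj₁ (proj₁ (proj₂ conp)))

  simTime : NOTM → ℕ → ℕ
  simTime N n = 2 + suc (p n) * suc (proj₁ (Simulation.branching N {K' = 0} emptyOracle) + 5 + (p n * 2 + 2))

  time : ℕ → ℕ
  time n = suc (n * 4 + 2 + (1 + (simTime N₁ n + simTime N₂ n)))

  poly-time : Poly time
  poly-time = poly-+ (poly-const 1) (poly-+ (poly-+ (poly-* poly-id (poly-const 4)) (poly-const 2)) (poly-+ (poly-const 1) (poly-+ (poly-sim N₁) (poly-sim N₂))))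
    where
    poly-p : Poly p
    poly-p = poly-+ (poly-+ (poly-^ poly-id (proj₁ (proj₁ (proj₂ np)))) (poly-const _))
      (poly-+ (poly-^ poly-id (proj₁ (proj₁ (proj₂ conp)))) (poly-const _))
    poly-sim : ∀ N → Poly (simTime N)
    poly-sim N = poly-+ (poly-const 2) (poly-* (poly-+ (poly-const 1) poly-p)
      (poly-+ (poly-const 1) (poly-+ (poly-const (proj₁ (Simulation.branching N {K' = 0} emptyOracle) + 5)) (poly-+ (poly-* poly-p (poly-const 2)) (poly-const 2)))))

  -- What an outcome certifies. No oracle `D` occurs: the program asks nothing and simulates both
  -- machines with the empty oracle, so its behaviour, and with it both robustness properties, is
  -- the same under all oracles.
  Meaning : Word → Outcome → Set
  Meaning x acc = Produces N₁ ∅ x acc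
  Meaning x rej = Produces N₂ ∅ x acc
  Meaning x unk = ⊤

  loaded : Word → List Bool → SSt 3
  loaded x ω = sst ([] ∷ symStack (map bitSym x) ∷ [] ∷ []) [] [] ω

  load-input : ∀ x ω → ExecS load (initialS x ω) tt (loaded x ω) (length x * 4 + 2)
  load-input x ω = weak (≤-reflexive (cong (λ n → n * 4 + 2) (length-reverse x)))
    (ends (cong (λ y → loaded y ω) (trans (ʳ++-defn (reverse x)) (trans (++-identityʳ _) (reverse-involutive x))))
      (load-exec (reverse x) [] ω))

  branch-run : ∀ {x ω b ω₁ o σ n D} → nextFlip ω ≡ (b , ω₁) → ExecS (branch b) (loaded x ω₁) o σ n →
    Run (SSem 3) program D tt (initialS x ω) o (suc ((length x * 4 + 2) + (1 + n)))
  branch-run {x} {ω} refl d = weaken (s≤s (≤-reflexive (+-identityʳ _))) (finish (bind (bind (load-input x ω) (bind op d)) ret))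

  decide : ∀ N o₁ x ω → (∀ {c n} → Reaches N ∅ (initCfg N x) c n → n ≤ p (length x)) → ∃ λ o → ∃ λ σ →
    ExecS (Simulation.simulateInput N emptyOracle >>= λ o → ret (onlyAcc o₁ o)) (loaded x ω) (onlyAcc o₁ o) σ (simTime N (length x)) ×
    Produces N ∅ x o
  decide N o₁ x ω bd with EmptySim.simulateInput-some N [] [] [] (p (length x)) (p (length x)) x ω bd ≤-refl
  ... | o , Answers.finished r h _ , _ , _ , _ , _ , d =
    o , _ , weak (≤-reflexive (+-identityʳ _)) (bind d ret) , (_ , _ , r , h)
  ... | o , Answers.died _ (_ , ()) , _

  bound₁ : ∀ x {c n} → Reaches N₁ ∅ (initCfg N₁ x) c n → n ≤ p (length x)
  bound₁ x r = ≤-trans (proj₂ (proj₁ (proj₂ np)) ∅ x _ _ r) (m≤m+n _ _)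

  bound₂ : ∀ x {c n} → Reaches N₂ ∅ (initCfg N₂ x) c n → n ≤ p (length x)
  bound₂ x r = ≤-trans (proj₂ (proj₁ (proj₂ conp)) ∅ x _ _ r)
    (m≤n+m (length x ^ proj₁ (proj₁ (proj₂ conp)) + proj₁ (proj₁ (proj₂ conp))) (length x ^ proj₁ (proj₁ (proj₂ np)) + proj₁ (proj₁ (proj₂ np))))

  meaning₁ : ∀ {x} o → Produces N₁ ∅ x o → Meaning x (onlyAcc acc o)
  meaning₁ acc p = p
  meaning₁ rej _ = tt
  meaning₁ unk _ = tt

  meaning₂ : ∀ {x} o → Produces N₂ ∅ x o → Meaning x (onlyAcc rej o)
  meaning₂ acc p = p
  meaning₂ rej _ = tt
  meaning₂ unk _ = tt

  run-total : ∀ D x ω → ∃ λ o → Run (SSem 3) program D tt (initialS x ω) o (time (length x)) × Meaning x o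
  run-total D x ω with nextFlip ω in e
  ... | true , ω₁ with decide N₁ acc x ω₁ (bound₁ x)
  ...   | o , _ , d , pr = _ , weaken (s≤s (+-monoʳ-≤ (length x * 4 + 2) (s≤s (m≤m+n (simTime N₁ (length x)) (simTime N₂ (length x)))))) (branch-run {x} e d) , meaning₁ o pr
  run-total D x ω | false , ω₁ with decide N₂ rej x ω₁ (bound₂ x)
  ...   | o , _ , d , pr = _ , weaken (s≤s (+-monoʳ-≤ (length x * 4 + 2) (s≤s (m≤n+m (simTime N₂ (length x)) (simTime N₁ (length x)))))) (branch-run {x} e d) , meaning₂ o pr

  open Implementation (implement program true)

  produces⇒meaning : ∀ {D x o} → Produces machine D x o → Meaning x o
  produces⇒meaning {D} {x} pr with produces⇒run pr
  ... | ω , _ , only with run-total D x ω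
  ... | _ , run , m = subst (Meaning x) (only run) m

  sim-branch : ∀ N o₁ x → (∀ {c n} → Reaches N ∅ (initCfg N x) c n → n ≤ p (length x)) → Produces N ∅ x acc →
    ∃ λ ω → ∃ λ σ → ∃ λ n → ExecS (Simulation.simulateInput N emptyOracle >>= λ o → ret (onlyAcc o₁ o)) (loaded x ω) o₁ σ n
  sim-branch N o₁ x bd (_ , _ , r , h) with EmptySim.simulateInput-any N [] [] [] (p (length x)) r h (λ _ → false , refl) (bd r)
  ... | ω , _ , _ , _ , _ , _ , d = ω , _ , _ , bind d ret

  yes-produces : ∀ D x → A x ≡ true → Produces machine D x acc
  yes-produces D x e with sim-branch N₁ acc x (bound₁ x) (to (proj₂ (proj₂ np) x) e)
  ... | ω , _ , _ , d = run⇒produces {ω = true ∷ ω} (λ ()) (branch-run {x} refl d)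

  no-produces : ∀ D x → A x ≡ false → Produces machine D x rej
  no-produces D x e with sim-branch N₂ rej x (bound₂ x) (to (proj₂ (proj₂ conp) x) (complement-true {A} e))
  ... | ω , _ , _ , d = run⇒produces {ω = false ∷ ω} (λ ()) (branch-run {x} refl d)

  acc⇒true : ∀ {D x} → Produces machine D x acc → A x ≡ true
  acc⇒true {x = x} pr = from (proj₂ (proj₂ np) x) (produces⇒meaning pr)

  rej⇒false : ∀ {D x} → Produces machine D x rej → A x ≡ false
  rej⇒false {x = x} pr = complement-false {A} (from (proj₂ (proj₂ conp) x) (produces⇒meaning pr))

  reduces : A ≤RS ∅
  reduces = machine
    , polyBounded poly-time (λ D x ω _ → let o , run , _ = run-total D x ω in o , run)
    , (λ D x → over D x (bool-cases (A x)))
    , (λ { D x (pr , pr₁) → true≢false (trans (sym (acc⇒true pr)) (rej⇒false pr₁)) })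
    , λ x → mk⇔ (yes-produces ∅ x) acc⇒true
    where
    over : ∀ D x → A x ≡ true ⊎ A x ≡ false → Produces machine D x acc ⊎ Produces machine D x rej
    over D x (inj₁ e) = inj₁ (yes-produces D x e)
    over D x (inj₂ e) = inj₂ (no-produces D x e)
    true≢false : true ≢ false
    true≢false ()

RS≡pT⇒P≡NP∩coNP : RS≡pT → P≡NP∩coNP
-- `A ≤pT ∅` unfolds to `InP A`.
RS≡pT⇒P≡NP∩coNP same A = mk⇔ (λ p → P⊆NP p , P⊆coNP p) (λ (np , conp) → to (same A ∅) (CoinToss.reduces np conp))

-- The satisfiable tables form an NP language

itemize : Bool → Bool → List Bool → List Bool
itemize c d [] = []
itemize c d (b ∷ bs) = c ∷ d ∷ b ∷ itemize c d bs

takeFlips : ℕ → List Bool → List Bool × List Bool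
takeFlips zero ω = [] , ω
takeFlips (suc n) ω = (proj₁ (nextFlip ω) ∷ proj₁ (takeFlips n (proj₂ (nextFlip ω)))) , proj₂ (takeFlips n (proj₂ (nextFlip ω)))

takeFlips-length : ∀ n ω → length (proj₁ (takeFlips n ω)) ≡ n
takeFlips-length zero ω = refl
takeFlips-length (suc n) ω = cong suc (takeFlips-length n (proj₂ (nextFlip ω)))

takeFlips-++ : ∀ g ω → takeFlips (length g) (g ++ ω) ≡ (g , ω)
takeFlips-++ [] ω = refl
takeFlips-++ (b ∷ g) ω = cong (λ r → b ∷ proj₁ r , proj₂ r) (takeFlips-++ g ω)

record Parsed : Set where
  constructor parsed
  field
    tbl : List Bool
    arg : Word
    ome : List Bool
open Parsed

-- An item (1,_,b) is the table bit b, an item (0,1,b) the input bit b, and an item (0,0,_) asks for a guessed table bit.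
readItem : Bool → Bool → Bool → Parsed → Parsed
readItem true d b (parsed t y ω) = parsed (b ∷ t) y ω
readItem false true b (parsed t y ω) = parsed t (b ∷ y) ω
readItem false false b (parsed t y ω) = parsed (proj₁ (nextFlip ω) ∷ t) y (proj₂ (nextFlip ω))

readItems : List Bool → Parsed → Parsed
readItems (c ∷ d ∷ b ∷ s) P = readItems s (readItem c d b P)
readItems _ P = P

readItems-table : ∀ bs s t y ω → readItems (itemize true false bs ++ s) (parsed t y ω) ≡ readItems s (parsed (bs ʳ++ t) y ω)
readItems-table [] s t y ω = refl
readItems-table (b ∷ bs) s t y ω = readItems-table bs s (b ∷ t) y ω

readItems-input : ∀ bs s t y ω → readItems (itemize false true bs ++ s) (parsed t y ω) ≡ readItems s (parsed t (bs ʳ++ y) ω)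
readItems-input [] s t y ω = refl
readItems-input (b ∷ bs) s t y ω = readItems-input bs s t (b ∷ y) ω

readItems-guess : ∀ bs s t y ω → readItems (itemize false false bs ++ s) (parsed t y ω) ≡
  readItems s (parsed (proj₁ (takeFlips (length bs) ω) ʳ++ t) y (proj₂ (takeFlips (length bs) ω)))
readItems-guess [] s t y ω = refl
readItems-guess (b ∷ bs) s t y ω = readItems-guess bs s (proj₁ (nextFlip ω) ∷ t) y (proj₂ (nextFlip ω))

-- The stack t holds the known part of the table, last bit on top; r further bits are to be guessed.
instanceItems : Word → List Bool → ℕ → List Bool
instanceItems x t r = itemize false false (replicate r true) ++ (itemize true false t ++ itemize false true (reverse x))

instanceWord : Word → List Bool → ℕ → Word
instanceWord x t r = reverse (instanceItems x t r)

-- Guess items are read first, so the guessed bits end up below the known ones, that is, behind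
-- them. The known bits are read from last to first and regain their order. The guesses come out
-- reversed, which does not matter as they range over all strings of length `r`.
readInstance : ∀ x t r ω → readItems (instanceItems x t r) (parsed [] [] ω) ≡
  parsed (reverse t ++ reverse (proj₁ (takeFlips r ω))) x (proj₂ (takeFlips r ω))
readInstance x t r ω = begin
  readItems (instanceItems x t r) (parsed [] [] ω)
    ≡⟨ readItems-guess (replicate r true) _ [] [] ω ⟩
  readItems (itemize true false t ++ itemize false true (reverse x)) (parsed (g (length (replicate r true)) ʳ++ []) [] (rest (length (replicate r true))))
    ≡⟨ cong (λ k → readItems (itemize true false t ++ itemize false true (reverse x)) (parsed (g k ʳ++ []) [] (rest k))) (length-replicate r) ⟩
  readItems (itemize true false t ++ itemize false true (reverse x)) (parsed (g r ʳ++ []) [] (rest r))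
    ≡⟨ readItems-table t _ _ [] (rest r) ⟩
  readItems (itemize false true (reverse x)) (parsed (t ʳ++ (g r ʳ++ [])) [] (rest r))
    ≡⟨ cong (λ s → readItems s (parsed (t ʳ++ (g r ʳ++ [])) [] (rest r))) (sym (++-identityʳ (itemize false true (reverse x)))) ⟩
  readItems (itemize false true (reverse x) ++ []) (parsed (t ʳ++ (g r ʳ++ [])) [] (rest r))
    ≡⟨ readItems-input (reverse x) [] _ [] (rest r) ⟩
  parsed (t ʳ++ (g r ʳ++ [])) (reverse x ʳ++ []) (rest r)
    ≡⟨ cong₂ (λ u y → parsed u y (rest r)) (ʳ++-defn t) (reverse-involutive x) ⟩
  parsed (reverse t ++ reverse (g r)) x (rest r) ∎
  where
  open ≡-Reasoning
  g : ℕ → List Bool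
  g k = proj₁ (takeFlips k ω)
  rest : ℕ → List Bool
  rest k = proj₂ (takeFlips k ω)

readItem-length : ∀ c d b P → length (tbl (readItem c d b P)) ≤ suc (length (tbl P)) × length (arg (readItem c d b P)) ≤ suc (length (arg P))
readItem-length true d b P = ≤-refl , n≤1+n _
readItem-length false true b P = n≤1+n _ , ≤-refl
readItem-length false false b P = ≤-refl , n≤1+n _

readItems-length : ∀ s P → length (tbl (readItems s P)) ≤ length s + length (tbl P) × length (arg (readItems s P)) ≤ length s + length (arg P)
readItems-length [] P = ≤-refl , ≤-refl
readItems-length (_ ∷ []) P = n≤1+n _ , n≤1+n _
readItems-length (_ ∷ _ ∷ []) P = m≤n+m _ 2 , m≤n+m _ 2
readItems-length (c ∷ d ∷ b ∷ s) P with readItems-length s (readItem c d b P) | readItem-length c d b P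
... | le , le₁ | le₂ , le₃ = ≤-trans le (grow le₂) , ≤-trans le₁ (grow le₃)
  where
  grow : ∀ {k l} → k ≤ suc l → length s + k ≤ 3 + (length s + l)
  grow {k} {l} h = ≤-trans (+-monoʳ-≤ (length s) h) (≤-trans (≤-reflexive (+-suc (length s) l)) (m≤n+m _ 2))

orElse : Maybe Bool → Maybe Bool → Maybe Bool
orElse (just a) _ = just a
orElse nothing m = m

record-match : Bool → Bool → Maybe Bool → Maybe Bool
record-match true a f = orElse f (just a)
record-match false a f = f

cons≢[] : ∀ {b : Bool} {z} → List._∷_ b z ≢ List.[]
cons≢[] ()

same : Bool → Bool → Bool
same true true = true
same false false = true
same _ _ = false

-- Looking up a query in a table on a stack

module Lookup where
  tS uS pS vS qS : Fin 7
  qS = # 2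
  tS = # 3
  uS = # 4
  pS = # 5
  vS = # 6

  -- Whether the query still matches the current entry, and the answer of the first matching entry
  -- completed so far.
  ScanState : Set
  ScanState = Bool × Maybe Bool

  ScanCmd : Set₁
  ScanCmd = SCmd 7 (ScanState ⊎ Maybe Bool)

  compareBit : Bool → Maybe Bool → Maybe Bool → ScanCmd
  compareBit b f nothing = ret (inj₁ (false , f))
  compareBit b f (just d) = op (push vS d) >> ret (inj₁ (same d b , f))

  endEntry : Bool → Bool → Maybe Bool → Maybe Bool → ScanCmd
  endEntry a ok f nothing = moveStack vS pS >> ret (inj₁ (true , record-match ok a f))
  endEntry a ok f (just d) = op (push pS d) >> (moveStack vS pS >> ret (inj₁ (true , f)))

  scanTok : Bool → Bool → Bool → Maybe Bool → ScanCmd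
  scanTok true b true f = op (pop pS) >>= compareBit b f
  scanTok true b false f = ret (inj₁ (false , f))
  scanTok false a ok f = op (pop pS) >>= endEntry a ok f

  scanSecond : ScanState → Bool → Maybe Bool → ScanCmd
  scanSecond (ok , f) c nothing = op (push tS c) >> ret (inj₂ f)
  scanSecond (ok , f) c (just b) = op (push uS c) >> (op (push uS b) >> scanTok c b ok f)

  scanFirst : ScanState → Maybe Bool → ScanCmd
  scanFirst (ok , f) nothing = ret (inj₂ f)
  scanFirst st (just c) = op (pop tS) >>= scanSecond st c

  scan : ScanState → SCmd 7 (Maybe Bool)
  scan = iter (λ st → op (pop tS) >>= scanFirst st)

  lookupCode : SCmd 7 (Maybe Bool)
  lookupCode = moveStack qS pS >> (scan (true , nothing) >>= λ a → moveStack uS tS >> (clear pS >> (clear vS >> ret a)))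

  module _ (l r inp : List Bool) (out : Word) (ω : List Bool) (w : Word) where
    st : List Bool → List Bool → List Bool → List Bool → SSt 7
    st t u p v = sst (l ∷ r ∷ [] ∷ t ∷ u ∷ p ∷ v ∷ []) inp out ω

    -- e is the part of the current entry read so far; p the unread and v the read part of w, v reversed.
    data Compared (e p v : List Bool) : Bool → Set where
      agreeing : e ++ p ≡ w → v ≡ reverse e → Compared e p v true
      differing : (∀ d → e ++ d ≢ w) → v ʳ++ p ≡ w → Compared e p v false

    -- With or without a mismatch, the two parts still make up the query, so it can be restored at
    -- the end of each entry.
    compared-whole : ∀ {e p v ok} → Compared e p v ok → v ʳ++ p ≡ w
    compared-whole {e} {p} (agreeing q refl) =
      trans (ʳ++-defn (reverse e)) (trans (cong (_++ p) (reverse-involutive e)) q)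
    compared-whole (differing _ q) = q

    length-ʳ++′ : ∀ v (p : List Bool) → length v ≤ length (v ʳ++ p)
    length-ʳ++′ v p = ≤-trans (m≤m+n (length v) (length p)) (≤-reflexive (sym (length-ʳ++ v)))

    compared-v : ∀ {e p v ok} → Compared e p v ok → length v ≤ length w
    compared-v {v = v} {p} c = ≤-trans (length-ʳ++′ v _) (≤-reflexive (cong length (compared-whole c)))

    compared-p : ∀ {e p v ok} → Compared e p v ok → length p ≤ length w
    compared-p {p = p} {v} c = ≤-trans (≤-trans (m≤n+m (length p) (length v)) (≤-reflexive (sym (length-ʳ++ v)))) (≤-reflexive (cong length (compared-whole c)))

    same-true : ∀ b d → same d b ≡ true → d ≡ b
    same-true true true _ = refl
    same-true false false _ = refl

    same-false : ∀ b d → same d b ≡ false → b ≢ d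
    same-false true false _ ()
    same-false false true _ ()

    compared-next : ∀ {e d p v b ok} → same d b ≡ ok → Compared e (d ∷ p) v true → Compared (e ++ b ∷ []) p (d ∷ v) ok
    compared-next {e} {d} {p} {b = b} {true} s (agreeing q refl) with same-true b d s
    ... | refl = agreeing (trans (++-assoc e (b ∷ []) p) q) (sym (reverse-++ e (b ∷ [])))
    compared-next {e} {d} {p} {b = b} {false} s c@(agreeing q refl) =
      differing (λ z h → same-false b d s (proj₁ (∷-injective (++-cancelˡ e _ _ (trans (sym (++-assoc e (b ∷ []) z)) (trans h (sym q)))))))
        (compared-whole c)

    compared-short : ∀ {e v b} → Compared e [] v true → Compared (e ++ b ∷ []) [] v false
    compared-short {e} {v} {b} c@(agreeing q _) = differing (λ z h → cons≢[] (++-cancelˡ e _ _ (trans (sym (++-assoc e (b ∷ []) z)) (trans h (sym q))))) (compared-whole c)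

    -- A mismatch is stated for all continuations of `e`, hence it survives every further bit of the
    -- entry.
    compared-longer : ∀ {e p v b} → Compared e p v false → Compared (e ++ b ∷ []) p v false
    compared-longer {e} {b = b} (differing ne q) = differing (λ z h → ne (b ∷ z) (trans (sym (++-assoc e (b ∷ []) z)) h)) q

    compared-start : ∀ p v → v ʳ++ p ≡ w → Compared [] (v ʳ++ p) [] true
    compared-start p v q = agreeing q refl

    answer-hit : ∀ {e} a f es → e ≡ w → orElse (record-match true a f) (answerIn w es) ≡ orElse f (answerIn w ((e , a) ∷ es))
    answer-hit {e} a f es eq with e ≟w w
    answer-hit a (just _) es eq | yes _ = refl
    answer-hit a nothing es eq | yes _ = refl
    ... | no ne = ⊥-elim (ne eq)

    answer-miss : ∀ {e} a f es → e ≢ w → orElse f (answerIn w es) ≡ orElse f (answerIn w ((e , a) ∷ es))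
    answer-miss {e} a f es ne with e ≟w w
    ... | yes eq = ⊥-elim (ne eq)
    ... | no _ = refl

    end-hit : ∀ {e v ok} → Compared e [] v ok → ∀ a f es → orElse (record-match ok a f) (answerIn w es) ≡ orElse f (answerIn w ((e , a) ∷ es))
    end-hit {e} (agreeing q _) a f es = answer-hit a f es (trans (sym (++-identityʳ e)) q)
    end-hit {e} (differing ne _) a f es = answer-miss a f es (λ q → ne [] (trans (++-identityʳ e) q))

    end-miss : ∀ {e d p v ok} → Compared e (d ∷ p) v ok → ∀ a f es → orElse f (answerIn w es) ≡ orElse f (answerIn w ((e , a) ∷ es))
    end-miss {e} {d} {p} (agreeing q _) a f es = answer-miss a f es λ h → cons≢[] (++-cancelˡ e _ _ (trans q (trans (sym h) (sym (++-identityʳ e)))))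
    end-miss {e} (differing ne _) a f es = answer-miss a f es (λ q → ne [] (trans (++-identityʳ e) q))

    tokCost : ℕ
    tokCost = 9 + length w * 3

    scanCost : ℕ → ℕ
    scanCost n = n * tokCost + 4

    ScanResult : ScanState → List Bool → List Bool → List Bool → List Bool → List Bool → Set₁
    ScanResult (ok , f) e t u p v = ∃ λ t₁ → ∃ λ u₁ → ∃ λ p₁ → ∃ λ v₁ →
      u₁ ʳ++ t₁ ≡ u ʳ++ t × length u₁ ≤ length u + length t × length p₁ ≤ length w × length v₁ ≤ length w ×
      ExecS (scan (ok , f)) (st t u p v) (orElse f (answerIn w (entries e (toks t)))) (st t₁ u₁ p₁ v₁) (scanCost (length t))

    orElse-nothing : ∀ f → orElse f nothing ≡ f
    orElse-nothing (just _) = refl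
    orElse-nothing nothing = refl

    scan-more : ∀ {ok f c b t u p v ok₁ f₁ p₁ v₁ e e₁ k} →
      ExecS (scanTok c b ok f) (st t (b ∷ c ∷ u) p v) (inj₁ (ok₁ , f₁)) (st t (b ∷ c ∷ u) p₁ v₁) k → k ≤ 4 + length w * 3 →
      orElse f₁ (answerIn w (entries e₁ (toks t))) ≡ orElse f (answerIn w (entries e (toks (c ∷ b ∷ t)))) →
      ScanResult (ok₁ , f₁) e₁ t (b ∷ c ∷ u) p₁ v₁ → ScanResult (ok , f) e (c ∷ b ∷ t) u p v
    scan-more {ok} {f} {c} {b} {t} {u} {p} {v} {k = k} d le eq (t₁ , u₁ , p₁ , v₁ , whole , lu , lp , lv , rest) =
      t₁ , u₁ , p₁ , v₁ , whole , ≤-trans lu (≤-reflexive (trans (sym (+-suc (suc (length u)) (length t))) (sym (+-suc (length u) (suc (length t)))))) , lp , lv ,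
      returns eq
        (weak bound (more (bind op (bind op (bind op (bind op d)))) rest))
      where
      bound : suc (1 + (1 + (1 + (1 + k)))) + scanCost (length t) ≤ scanCost (2 + length t)
      bound = ≤-trans (+-monoˡ-≤ (scanCost (length t)) (+-monoʳ-≤ 5 le))
        (≤-trans (≤-reflexive (sym (+-assoc tokCost (length t * tokCost) 4)))
          (+-monoˡ-≤ 4 (m≤n+m (tokCost + length t * tokCost) tokCost)))

    restore : ∀ t u p v → length v ≤ length w → ExecS (moveStack vS pS) (st t u p v) tt (st t u (v ʳ++ p) []) (length w * 3 + 2)
    restore t u p v le = weak (+-monoˡ-≤ 2 (*-monoˡ-≤ 3 le)) (moveStack-exec vS pS (λ ()) v (st t u p v) refl)

    scan-exec : ∀ t {e u p v ok} f → Compared e p v ok → ScanResult (ok , f) e t u p v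
    scan-exec [] {e} {u} {p} {v} {ok} f c = [] , u , p , v , refl , m≤m+n _ 0 , compared-p c , compared-v c ,
      returns (sym (orElse-nothing f)) (weak (m≤m+n 2 2) (stop (bind op ret)))
    scan-exec (true ∷ []) {e} {u} {p} {v} {ok} f c = (true ∷ []) , u , p , v , refl , m≤m+n _ 1 , compared-p c , compared-v c ,
      returns (sym (orElse-nothing f)) (weak (m≤n+m 4 (tokCost + 0)) (stop (bind op (bind op (bind op ret)))))
    scan-exec (false ∷ []) {e} {u} {p} {v} {ok} f c = (false ∷ []) , u , p , v , refl , m≤m+n _ 1 , compared-p c , compared-v c ,
      returns (sym (orElse-nothing f)) (weak (m≤n+m 4 (tokCost + 0)) (stop (bind op (bind op (bind op ret)))))
    scan-exec (true ∷ b ∷ t) {e} {ok = false} f c = scan-more {e = e} ret z≤n refl (scan-exec t f (compared-longer c))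
    scan-exec (true ∷ b ∷ t) {e} {p = []} {ok = true} f c = scan-more {e = e} (bind op ret) (s≤s z≤n) refl (scan-exec t f (compared-short c))
    scan-exec (true ∷ b ∷ t) {e} {p = d ∷ p} {ok = true} f c = scan-more {e = e} (bind op (bind op ret)) (s≤s (s≤s z≤n)) refl (scan-exec t f (compared-next refl c))
    scan-exec (false ∷ a ∷ t) {e} {u} {[]} {v} f c = scan-more {e = e} (bind op (bind (restore t _ [] v (compared-v c)) ret))
      (≤-trans (≤-reflexive (cong suc (trans (+-identityʳ _) (+-comm _ 2)))) (n≤1+n _))
      (end-hit {e} c a f (entries [] (toks t))) (scan-exec t _ (compared-start [] v (compared-whole c)))
    scan-exec (false ∷ a ∷ t) {e} {u} {d ∷ p} {v} f c = scan-more {e = e} (bind op (bind op (bind (restore t _ (d ∷ p) v (compared-v c)) ret)))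
      (≤-reflexive (cong (2 +_) (trans (+-identityʳ _) (+-comm _ 2))))
      (end-miss {e} c a f (entries [] (toks t))) (scan-exec t f (compared-start (d ∷ p) v (compared-whole c)))

  lookupCost : ℕ → ℕ → ℕ
  lookupCost Z W = (W * 3 + 2) + ((Z * (9 + W * 3) + 4) + ((Z * 3 + 2) + ((W * 2 + 2) + ((W * 2 + 2) + 0))))

  lookup-correct : ∀ t inp out W l r w ω → length w ≤ W →
    ExecS lookupCode (sst (l ∷ r ∷ reverse w ∷ t ∷ [] ∷ [] ∷ [] ∷ []) inp out ω) (table (toks t) w)
      (sst (l ∷ r ∷ [] ∷ t ∷ [] ∷ [] ∷ [] ∷ []) inp out ω) (lookupCost (length t) W)
  lookup-correct t inp out W l r w ω le with scan-exec l r inp out ω w t {[]} {[]} {w} {[]} nothing (agreeing refl refl)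
  ... | t₁ , u₁ , p₁ , v₁ , whole , lu , lp , lv , d =
    bind (weak (+-monoˡ-≤ 2 (*-monoˡ-≤ 3 (≤-trans (≤-reflexive (length-reverse w)) le)))
      (ends (cong (λ p → sst (l ∷ r ∷ [] ∷ t ∷ [] ∷ p ∷ [] ∷ []) inp out ω) (reverse-involutive w)) (moveStack-exec qS pS (λ ()) (reverse w) (sst (l ∷ r ∷ reverse w ∷ t ∷ [] ∷ [] ∷ [] ∷ []) inp out ω) refl)))
    (bind (weak (+-monoˡ-≤ 4 (*-monoʳ-≤ (length t) (+-monoʳ-≤ 9 (*-monoˡ-≤ 3 le)))) d)
    (bind (weak (+-monoˡ-≤ 2 (*-monoˡ-≤ 3 lu))
      (ends (cong (λ t₂ → st l r inp out ω w t₂ [] p₁ v₁) whole) (moveStack-exec uS tS (λ ()) u₁ (st l r inp out ω w t₁ u₁ p₁ v₁) refl)))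
    (bind (weak (+-monoˡ-≤ 2 (*-monoˡ-≤ 2 (≤-trans lp le))) (clear-exec pS p₁ (st l r inp out ω w t [] p₁ v₁) refl))
    (bind (weak (+-monoˡ-≤ 2 (*-monoˡ-≤ 2 (≤-trans lv le))) (clear-exec vS v₁ (st l r inp out ω w t [] [] v₁) refl)) ret))))

does-⇔ : ∀ {P : Set} (d : Dec P) → (does d ≡ true) ⇔ P
does-⇔ (yes p) = mk⇔ (λ _ → p) (λ _ → refl)
does-⇔ (no np) = mk⇔ (λ ()) (λ p → ⊥-elim (np p))

-- The nondeterministic machine that guesses an extension

module Guesser (N : NOTM) (pb : PolyBounded N) where
  open Lookup using (lookupCode; lookupCost; lookup-correct)

  rS tS : Fin 7
  rS = # 1
  tS = # 3

  k = proj₁ pb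

  p : ℕ → ℕ
  p n = n ^ k + k

  readThird : Bool → Bool → Bool → SCmd 7 ⊤
  readThird true d b = op (push tS b)
  readThird false true b = pushSym rS (bitSym b)
  readThird false false b = op choose >>= λ g → op (push tS g)

  third : Bool → Bool → Maybe Bool → SCmd 7 (⊤ ⊎ ⊤)
  third c d nothing = ret (inj₂ tt)
  third c d (just b) = readThird c d b >> ret (inj₁ tt)

  second : Bool → Maybe Bool → SCmd 7 (⊤ ⊎ ⊤)
  second c nothing = ret (inj₂ tt)
  second c (just d) = op popInput >>= third c d

  first : Maybe Bool → SCmd 7 (⊤ ⊎ ⊤)
  first nothing = ret (inj₂ tt)
  first (just c) = op popInput >>= second c

  parse : SCmd 7 ⊤
  parse = iter (λ _ → op popInput >>= first) tt

  program : Program (SSig 7)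
  program = record
    { Label = ⊤ ; labels = fin-⊤ ; start = tt ; answer = λ _ → tt
    ; body = λ _ → parse >> Simulation.simulateInput N lookupCode >>= λ o → ret (inj₂ (just o)) }

  st : List Bool → Parsed → SSt 7
  st s (parsed t y ω) = sst ([] ∷ symStack (map bitSym y) ∷ [] ∷ t ∷ [] ∷ [] ∷ [] ∷ []) s [] ω

  readThird-exec : ∀ c d b s P → ExecS (readThird c d b) (st s P) tt (st s (readItem c d b P)) 2
  readThird-exec true d b s P = weak (s≤s z≤n) op
  readThird-exec false true b s P = bind op op
  readThird-exec false false b s P = bind op op

  parse-exec : ∀ s P → ExecS parse (st s P) tt (st [] (readItems s P)) (length s * 2 + 2)
  parse-exec [] P = stop (bind op ret)
  parse-exec (c ∷ []) P = weak (m≤m+n 3 1) (stop (bind op (bind op ret)))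
  parse-exec (c ∷ d ∷ []) P = weak (m≤m+n 4 2) (stop (bind op (bind op (bind op ret))))
  parse-exec (c ∷ d ∷ b ∷ s) P = more (bind op (bind op (bind op (bind (readThird-exec c d b s P) ret)))) (parse-exec s (readItem c d b P))

  read : Word → List Bool → Parsed
  read x ω = readItems (reverse x) (parsed [] [] ω)

  start-parse : ∀ x ω → ExecS parse (initialS x ω) tt (st [] (read x ω)) (length x * 2 + 2)
  start-parse x ω = weak (≤-reflexive (cong (λ n → n * 2 + 2) (length-reverse x))) (parse-exec (reverse x) (parsed [] [] ω))

  simTime : ℕ → ℕ
  simTime n = 2 + suc (p n) * suc (proj₁ (Simulation.branching N lookupCode) + 5 + lookupCost n (p n))

  time : ℕ → ℕ
  time n = suc (n * 2 + 2 + simTime n)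

  poly-time : Poly time
  poly-time = poly-+ (poly-const 1) (poly-+ (poly-+ (poly-* poly-id (poly-const 2)) (poly-const 2))
    (poly-+ (poly-const 2) (poly-* (poly-+ (poly-const 1) poly-p) (poly-+ (poly-const 1) (poly-+ (poly-const (proj₁ (Simulation.branching N lookupCode) + 5)) poly-lookup)))))
    where
    poly-p : Poly p
    poly-p = poly-+ (poly-^ poly-id k) (poly-const k)
    p*_+2 : ∀ c → Poly (λ n → p n * c + 2)
    p* c +2 = poly-+ (poly-* poly-p (poly-const c)) (poly-const 2)
    poly-lookup : Poly (λ n → lookupCost n (p n))
    poly-lookup = poly-+ (p* 3 +2) (poly-+ (poly-+ (poly-* poly-id (poly-+ (poly-const 9) (poly-* poly-p (poly-const 3)))) (poly-const 4))
      (poly-+ (poly-+ (poly-* poly-id (poly-const 3)) (poly-const 2)) (poly-+ (p* 2 +2) (poly-+ (p* 2 +2) (poly-const 0)))))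

  module TableSim (t : List Bool) (m : ℕ) (le : length t ≤ m) (W : ℕ) =
    Simulation.Correct N lookupCode (table (toks t)) (t ∷ [] ∷ [] ∷ [] ∷ []) [] [] W (lookupCost m W)
      (λ l r w ω le₁ → weak (+-monoʳ-≤ (W * 3 + 2) (+-mono-≤ (+-monoˡ-≤ 4 (*-monoˡ-≤ (9 + W * 3) le)) (+-monoˡ-≤ _ (+-monoˡ-≤ 2 (*-monoˡ-≤ 3 le)))))
        (lookup-correct t [] [] W l r w ω le₁))

  tbl-length : ∀ x ω → length (tbl (read x ω)) ≤ length x
  tbl-length x ω = ≤-trans (proj₁ (readItems-length (reverse x) (parsed [] [] ω))) (≤-reflexive (trans (+-identityʳ _) (length-reverse x)))

  arg-length : ∀ x ω → length (arg (read x ω)) ≤ length x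
  arg-length x ω = ≤-trans (proj₂ (readItems-length (reverse x) (parsed [] [] ω))) (≤-reflexive (trans (+-identityʳ _) (length-reverse x)))

  p-mono : ∀ {m n} → m ≤ n → p m ≤ p n
  p-mono le = +-monoˡ-≤ k (^-monoˡ-≤ k le)

  run-from : ∀ {D x ω o σ n} → ExecS (Simulation.simulateInput N lookupCode) (st [] (read x ω)) o σ n →
    Run (SSem 7) program D tt (initialS x ω) o (suc (length x * 2 + 2 + n))
  run-from {x = x} {ω} d = weaken (s≤s (≤-reflexive (+-identityʳ _))) (finish (bind (bind (start-parse x ω) d) ret))

  Certified : Word → List Bool → Set
  Certified x ω = Certificates.AccPath N (arg (read x ω)) (table (toks (tbl (read x ω))))

  abstract
    run-total : ∀ D x ω → ∃ λ o → Run (SSem 7) program D tt (initialS x ω) o (time (length x)) × (o ≡ acc → Certified x ω)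
    run-total D x ω with TableSim.simulateInput-some (tbl (read x ω)) (length x) (tbl-length x ω) (p (length x)) (p (length x)) (arg (read x ω)) (ome (read x ω))
      (λ r → ≤-trans (proj₂ pb _ (arg (read x ω)) _ _ r) (p-mono (arg-length x ω))) ≤-refl
    ... | o , res , _ , _ , _ , _ , d = o , run-from {x = x} d , meaning res
      where
      meaning : Answers.SimResult N (table (toks (tbl (read x ω)))) (initCfg N (arg (read x ω))) o → o ≡ acc → Certified x ω
      meaning (Answers.died refl _) ()
      meaning (Answers.finished r h known) refl = _ , _ , r , h , known

    from-parsed : ∀ {P P₁ o σ n} → P ≡ P₁ → ExecS (Simulation.simulateInput N lookupCode) (st [] P₁) o σ n →
      ExecS (Simulation.simulateInput N lookupCode) (st [] P) o σ n
    from-parsed refl d = d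

    -- The path fixes the choices `ω₁` of the simulation. Parsing comes earlier and consumes choices
    -- as well, so `supply` has to prepend some that leave exactly `ω₁`.
    run-any : ∀ {D} x (t : List Bool) (y : Word) → (∀ ω₁ → ∃ λ ω → read x ω ≡ parsed t y ω₁) →
      Certificates.AccPath N y (table (toks t)) → ∃ λ ω → ∃ λ n → Run (SSem 7) program D tt (initialS x ω) acc n
    run-any x t y supply (_ , _ , r , h , known) with TableSim.simulateInput-any t (length t) ≤-refl (p (length y)) r h known (proj₂ pb _ y _ _ r)
    ... | ω₁ , _ , _ , _ , _ , _ , d with supply ω₁
    ... | ω , e = ω , _ , run-from {x = x} {ω} (from-parsed e d)

  read-instance : ∀ x t r ω → read (instanceWord x t r) ω ≡ parsed (reverse t ++ reverse (proj₁ (takeFlips r ω))) x (proj₂ (takeFlips r ω))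
  read-instance x t r ω = trans (cong (λ s → readItems s (parsed [] [] ω)) (reverse-involutive (instanceItems x t r))) (readInstance x t r ω)

  flips-for : ∀ x t g ω₁ → ∃ λ ω → read (instanceWord x t (length g)) ω ≡ parsed (reverse t ++ g) x ω₁
  -- Parsing stacks the guesses and thereby reverses them.
  flips-for x t g ω₁ = reverse g ++ ω₁ , trans (read-instance x t (length g) (reverse g ++ ω₁))
    (trans (cong (λ q → parsed (reverse t ++ reverse (proj₁ q)) x (proj₂ q))
        (trans (cong (λ n → takeFlips n (reverse g ++ ω₁)) (sym (length-reverse g))) (takeFlips-++ (reverse g) ω₁)))
      (cong (λ z → parsed (reverse t ++ z) x ω₁) (reverse-involutive g)))

  certified-sat : ∀ x t r ω {w} → w ≡ instanceWord x t r → Certified w ω → Certificates.Sat N x (reverse t) r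
  certified-sat x t r ω refl cert = reverse g , trans (length-reverse g) (takeFlips-length r ω) ,
    subst (λ P → Certificates.AccPath N (arg P) (table (toks (tbl P)))) (read-instance x t r ω) cert
    where g = proj₁ (takeFlips r ω)

  open Implementation (implement program true)

  bounded : PolyBounded machine
  bounded = polyBounded poly-time (λ D x ω _ → proj₁ (run-total D x ω) , proj₁ (proj₂ (run-total D x ω)))

  accepted-certified : ∀ w → Produces machine ∅ w acc → ∃ λ ω → Certified w ω
  accepted-certified w pr =
    let ω , _ , only = produces⇒run pr
        _ , run , meaning = run-total ∅ w ω
    in ω , meaning (only run)

  accepts-instance : ∀ x t r {w} → w ≡ instanceWord x t r → Produces machine ∅ w acc ⇔ Certificates.Sat N x (reverse t) r
  accepts-instance x t r {w} eq = mk⇔ (λ pr → let ω , cert = accepted-certified w pr in certified-sat x t r ω eq cert) (sat-produces eq)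
    where
    sat-produces : ∀ {w} → w ≡ instanceWord x t r → Certificates.Sat N x (reverse t) r → Produces machine ∅ w acc
    sat-produces {w} eq (g , refl , path) =
      let _ , _ , run = run-any w (reverse t ++ g) x (λ ω₁ → subst (λ w → ∃ λ ω → read w ω ≡ parsed (reverse t ++ g) x ω₁) (sym eq) (flips-for x t g ω₁)) path
      in run⇒produces (λ ()) run

  language : Lang
  language x = does (Paths.produces? machine bounded ∅ x acc)

  language-produces : ∀ x → (language x ≡ true) ⇔ Produces machine ∅ x acc
  language-produces x = does-⇔ (Paths.produces? machine bounded ∅ x acc)

  language-NP : InNP language
  language-NP = machine , bounded , language-produces

  language-instance : ∀ x t r → (language (instanceWord x t r) ≡ true) ⇔ Certificates.Sat N x (reverse t) r
  language-instance x t r = mk⇔ (λ e → to (accepts-instance x t r refl) (to (language-produces _) e))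
    (λ s → from (language-produces _) (from (accepts-instance x t r refl) s))

-- Membership is specified on instance words, the only words on which the oracle machine tests it.
record SatLanguage (N : NOTM) : Set where
  field
    language : Lang
    in-NP    : InNP language
    instances : ∀ x t r → (language (instanceWord x t r) ≡ true) ⇔ Certificates.Sat N x (reverse t) r

abstract
  satLanguage : ∀ N → PolyBounded N → SatLanguage N
  satLanguage N pb = record
    { language = Guesser.language N pb ; in-NP = Guesser.language-NP N pb ; instances = Guesser.language-instance N pb }

-- The deterministic oracle machine

op-effect : ∀ {K} {o : SOp K} {σ a σ₁} → effectS o σ ≡ (a , σ₁) → ExecS (op o) σ a σ₁ 1
op-effect refl = op

-- Stacks: 3 holds the input (last symbol on top), 4 the table (last bit on top), 6 the number of bits to be guessed in unary,
-- 7 the number of rounds and of bits per round in unary, 8 the remaining rounds in unary; 5 is auxiliary.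
xS tS vS rS uS cS : Fin 9
xS = # 3
tS = # 4
vS = # 5
rS = # 6
uS = # 7
cS = # 8

module _ (S : Fin 9) (c d : Bool) where
  emitBody : Maybe Bool → SCmd 9 (⊤ ⊎ ⊤)
  emitBody nothing = ret (inj₂ tt)
  emitBody (just b) = pushSym (# 1) (bitSym c) >> (pushSym (# 1) (bitSym d) >> (pushSym (# 1) (bitSym b) >> (op (push vS b) >> ret (inj₁ tt))))

  emitStack : SCmd 9 ⊤
  emitStack = iter (λ _ → op (pop S) >>= emitBody) tt

  -- st s y v is a state with s on stack S, the symbols y on stack 1 and v on the auxiliary stack.
  module _ (st : List Bool → List Bool → List Bool → SSt 9)
    (pop-[] : ∀ r v → effectS (pop S) (st [] r v) ≡ (nothing , st [] r v))
    (pop-∷ : ∀ b s r v → effectS (pop S) (st (b ∷ s) r v) ≡ (just b , st s r v))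
    (push-r : ∀ b s r v → effectS (push (# 1) b) (st s r v) ≡ (tt , st s (b ∷ r) v))
    (push-v : ∀ b s r v → effectS (push vS b) (st s r v) ≡ (tt , st s r (b ∷ v))) where

    emit-sym : ∀ b s y v → ExecS (pushSym (# 1) (bitSym b)) (st s (symStack (map bitSym y)) v) tt (st s (symStack (map bitSym (b ∷ y))) v) 2
    emit-sym b s y v = bind (op-effect (push-r _ s _ v)) (op-effect (push-r _ s _ v))

    emitStack-exec : ∀ s y v → ExecS emitStack (st s (symStack (map bitSym y)) v) tt
      (st [] (symStack (map bitSym (itemize c d s ʳ++ y))) (s ʳ++ v)) (length s * 9 + 2)
    emitStack-exec [] y v = stop (bind (op-effect (pop-[] _ v)) ret)
    emitStack-exec (b ∷ s) y v = more
      (bind (op-effect (pop-∷ b s _ v)) (bind (emit-sym c s y v) (bind (emit-sym d s (c ∷ y) v) (bind (emit-sym b s (d ∷ c ∷ y) v) (bind (op-effect (push-v b s _ v)) ret)))))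
      (emitStack-exec s (b ∷ d ∷ c ∷ y) (b ∷ v))

itemize-length : ∀ c d s → length (itemize c d s) ≡ length s * 3
itemize-length c d [] = refl
itemize-length c d (b ∷ s) = cong (3 +_) (itemize-length c d s)

-- The auxiliary stacks 0, 1, 2 and 5 are empty between the steps of the algorithm.
st : List Bool → List Bool → List Bool → List Bool → List Bool → Word → List Bool → SSt 9
st X t r U C out ω = sst ([] ∷ [] ∷ [] ∷ X ∷ t ∷ [] ∷ r ∷ U ∷ C ∷ []) [] out ω

record Sized (z : ℕ) (X t r U C : List Bool) : Set where
  field
    total : length X + (length t + length r) ≤ z
    sizeU : length U ≤ z
    sizeC : length C ≤ z

-- Testing a table with a polynomial-time machine as a subroutine

module Decider (M : NOTM) (det : Deterministic M) (pb : PolyBounded M) where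

  isAcc : Outcome → Bool
  isAcc acc = true
  isAcc rej = false
  isAcc unk = false

  finishCode : Outcome → SCmd 9 Bool
  finishCode o = clear (# 0) >> (clear (# 1) >> (clear (# 2) >> ret (isAcc o)))

  -- An instance word is the reversal of its items, so pushing the guess, table and input items in
  -- this order leaves its first symbol on top of stack 1. Each source stack is emptied meanwhile
  -- and then restored from the auxiliary stack.
  decide : SCmd 9 Bool
  decide = emitStack rS false false >> (moveStack vS rS >> (emitStack tS true false >> (moveStack vS tS >>
    (emitStack xS false true >> (moveStack vS xS >> (Simulation.simulateInput M emptyOracle >>= finishCode))))))

  pM : ℕ → ℕ
  pM n = n ^ proj₁ pb + proj₁ pb

  simTime : ℕ → ℕ
  simTime z = 2 + suc (pM (z * 3)) * suc (proj₁ (Simulation.branching M {K' = 6} emptyOracle) + 5 + (pM (z * 3) * 2 + 2))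

  sweep : ℕ → ℕ
  sweep z = z * 9 + 2

  -- The instance has at most 3z symbols of two bits each, and the simulation adds at most one bit
  -- per step. This bounds the cost of clearing its stacks afterwards.
  heights : ℕ → ℕ
  heights z = z * 6 + simTime z

  decideTime : ℕ → ℕ
  decideTime z = sweep z + (sweep z + (sweep z + (sweep z + (sweep z + (sweep z + (simTime z + ((heights z * 2 + 2) + ((heights z * 2 + 2) + ((heights z * 2 + 2) + 0)))))))))

  poly-decideTime : ∀ {f} → Poly f → Poly (λ n → decideTime (f n))
  poly-decideTime {f} pf = poly-+ psweep (poly-+ psweep (poly-+ psweep (poly-+ psweep (poly-+ psweep (poly-+ psweep
    (poly-+ psim (poly-+ pheight (poly-+ pheight (poly-+ pheight (poly-const 0))))))))))
    where
    psweep : Poly (λ n → sweep (f n))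
    psweep = poly-+ (poly-* pf (poly-const 9)) (poly-const 2)
    pp : Poly (λ n → pM (f n * 3))
    pp = poly-+ (poly-^ (poly-* pf (poly-const 3)) (proj₁ pb)) (poly-const (proj₁ pb))
    psim : Poly (λ n → simTime (f n))
    psim = poly-+ (poly-const 2) (poly-* (poly-+ (poly-const 1) pp) (poly-+ (poly-const 1)
      (poly-+ (poly-const (proj₁ (Simulation.branching M {K' = 6} emptyOracle) + 5)) (poly-+ (poly-* pp (poly-const 2)) (poly-const 2)))))
    pheight : Poly (λ n → heights (f n) * 2 + 2)
    pheight = poly-+ (poly-* (poly-+ (poly-* pf (poly-const 6)) psim) (poly-const 2)) (poly-const 2)

  mid : List Bool → List Bool → List Bool → List Bool → List Bool → List Bool → List Bool → Word → List Bool → SSt 9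
  mid y X t v r U C out ω = sst ([] ∷ symStack (map bitSym y) ∷ [] ∷ X ∷ t ∷ v ∷ r ∷ U ∷ C ∷ []) [] out ω

  sim-exec : ∀ w (rest : Vec (List Bool) 6) out ω z → length w ≤ z * 3 →
    ∃ λ o → Produces M ∅ w o × ∃ λ l → ∃ λ r → ∃ λ q → ∃ λ ω₁ →
    ExecS (Simulation.simulateInput M emptyOracle) (sst ([] ∷ symStack (map bitSym w) ∷ [] ∷ rest) [] out ω) o (sst (l ∷ r ∷ q ∷ rest) [] out ω₁) (simTime z)
  sim-exec w rest out ω z le with EmptySim.simulateInput-some M rest [] out (pM (z * 3)) (pM (z * 3)) w ω
    (λ r → ≤-trans (proj₂ pb ∅ w _ _ r) (+-monoˡ-≤ (proj₁ pb) (^-monoˡ-≤ (proj₁ pb) le))) ≤-refl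
  ... | o , Answers.finished r h _ , l , r₁ , q , ω₁ , d = o , (_ , _ , r , h) , l , r₁ , q , ω₁ , d
  ... | o , Answers.died _ (_ , ()) , _

  clear-upTo : ∀ i (σ : SSt 9) {h} → length (Vec.lookup (stacks σ) i) ≤ h → ExecS (clear i) σ tt (setStack i [] σ) (h * 2 + 2)
  clear-upTo i σ le = weak (+-monoˡ-≤ 2 (*-monoˡ-≤ 2 le)) (clear-exec i _ σ refl)

  sum-≤₁ : ∀ {a b c z} → a + (b + c) ≤ z → a ≤ z
  sum-≤₁ le = ≤-trans (m≤m+n _ _) le

  sum-≤₂ : ∀ {a b c z} → a + (b + c) ≤ z → b ≤ z
  sum-≤₂ {a} le = ≤-trans (≤-trans (m≤m+n _ _) (m≤n+m _ a)) le

  sum-≤₃ : ∀ {a b c z} → a + (b + c) ≤ z → c ≤ z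
  sum-≤₃ {a} {b} le = ≤-trans (≤-trans (m≤n+m _ b) (m≤n+m _ a)) le

  items-length : ∀ X t r → length (itemize false true X ʳ++ (itemize true false t ʳ++ (itemize false false r ʳ++ []))) ≡ (length X + (length t + length r)) * 3
  items-length X t r = begin
    length (itemize false true X ʳ++ (itemize true false t ʳ++ (itemize false false r ʳ++ [])))
      ≡⟨ length-ʳ++ (itemize false true X) ⟩
    length (itemize false true X) + length (itemize true false t ʳ++ (itemize false false r ʳ++ []))
      ≡⟨ cong₂ _+_ (itemize-length false true X) (length-ʳ++ (itemize true false t)) ⟩
    length X * 3 + (length (itemize true false t) + length (itemize false false r ʳ++ []))
      ≡⟨ cong (length X * 3 +_) (cong₂ _+_ (itemize-length true false t) (trans (length-ʳ++ (itemize false false r)) (trans (+-identityʳ _) (itemize-length false false r)))) ⟩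
    length X * 3 + (length t * 3 + length r * 3)
      ≡⟨ cong (length X * 3 +_) (*-distribʳ-+ 3 (length t) (length r)) ⟨
    length X * 3 + (length t + length r) * 3
      ≡⟨ *-distribʳ-+ 3 (length X) (length t + length r) ⟨
    (length X + (length t + length r)) * 3 ∎
    where open ≡-Reasoning

  items-instance : ∀ x t n → itemize false true (reverse x) ʳ++ (itemize true false t ʳ++ (itemize false false (replicate n true) ʳ++ [])) ≡ instanceWord x t n
  items-instance x t n = sym (trans (++-ʳ++ (itemize false false (replicate n true))) (++-ʳ++ (itemize true false t)))

  ʳ++-twice : ∀ (s : List Bool) → (s ʳ++ []) ʳ++ [] ≡ s
  ʳ++-twice = reverse-involutive

  sweep-≤ : ∀ {a z} → a ≤ z → a * 9 + 2 ≤ sweep z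
  sweep-≤ le = +-monoˡ-≤ 2 (*-monoˡ-≤ 9 le)

  back-≤ : ∀ {a z} → a ≤ z → a * 3 + 2 ≤ sweep z
  back-≤ {a} le = ≤-trans (+-monoˡ-≤ 2 (*-monoʳ-≤ a (m≤m+n 3 6))) (sweep-≤ le)

  emit-r : ∀ X t r U C out ω {z} → length r ≤ z →
    ExecS (emitStack rS false false) (mid [] X t [] r U C out ω) tt (mid (itemize false false r ʳ++ []) X t (r ʳ++ []) [] U C out ω) (sweep z)
  emit-r X t r U C out ω le = weak (sweep-≤ le) (emitStack-exec rS false false (λ r y v → sst ([] ∷ y ∷ [] ∷ X ∷ t ∷ v ∷ r ∷ U ∷ C ∷ []) [] out ω)
    (λ _ _ → refl) (λ _ _ _ _ → refl) (λ _ _ _ _ → refl) (λ _ _ _ _ → refl) r [] [])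

  emit-t : ∀ y X t r U C out ω {z} → length t ≤ z →
    ExecS (emitStack tS true false) (mid y X t [] r U C out ω) tt (mid (itemize true false t ʳ++ y) X [] (t ʳ++ []) r U C out ω) (sweep z)
  emit-t y X t r U C out ω le = weak (sweep-≤ le) (emitStack-exec tS true false (λ t y v → sst ([] ∷ y ∷ [] ∷ X ∷ t ∷ v ∷ r ∷ U ∷ C ∷ []) [] out ω)
    (λ _ _ → refl) (λ _ _ _ _ → refl) (λ _ _ _ _ → refl) (λ _ _ _ _ → refl) t y [])

  emit-x : ∀ y X t r U C out ω {z} → length X ≤ z →
    ExecS (emitStack xS false true) (mid y X t [] r U C out ω) tt (mid (itemize false true X ʳ++ y) [] t (X ʳ++ []) r U C out ω) (sweep z)
  emit-x y X t r U C out ω le = weak (sweep-≤ le) (emitStack-exec xS false true (λ X y v → sst ([] ∷ y ∷ [] ∷ X ∷ t ∷ v ∷ r ∷ U ∷ C ∷ []) [] out ω)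
    (λ _ _ → refl) (λ _ _ _ _ → refl) (λ _ _ _ _ → refl) (λ _ _ _ _ → refl) X y [])

  back : ∀ j {z} s σ {σ₁} → vS ≢ j → Vec.lookup (stacks σ) vS ≡ s ʳ++ [] → length s ≤ z →
    setStack j ((s ʳ++ []) ʳ++ Vec.lookup (stacks σ) j) (setStack vS [] σ) ≡ σ₁ → ExecS (moveStack vS j) σ tt σ₁ (sweep z)
  back j s σ ne e le refl = weak (back-≤ (≤-trans (≤-reflexive (trans (length-ʳ++ s) (+-identityʳ _))) le)) (moveStack-exec vS j ne (s ʳ++ []) σ e)

  decide-exec : ∀ x t n U C out ω z → Sized z (reverse x) t (replicate n true) U C →
    ∃ λ o → Produces M ∅ (instanceWord x t n) o × ∃ λ ω₁ →
    ExecS decide (st (reverse x) t (replicate n true) U C out ω) (isAcc o) (st (reverse x) t (replicate n true) U C out ω₁) (decideTime z)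
  decide-exec x t n U C out ω z sz with sim-exec (instanceWord x t n) (reverse x ∷ t ∷ [] ∷ replicate n true ∷ U ∷ C ∷ []) out ω z
    (subst (λ w → length w ≤ z * 3) (items-instance x t n) (≤-trans (≤-reflexive (items-length (reverse x) t (replicate n true))) (*-monoˡ-≤ 3 (Sized.total sz))))
  ... | o , pr , l , r₁ , q , ω₁ , d = o , pr , ω₁ , chain
    where
    open Sized sz
    X = reverse x
    r = replicate n true
    W = instanceWord x t n
    y₁ = itemize false false r ʳ++ []
    y₂ = itemize true false t ʳ++ y₁
    y₃ = itemize false true X ʳ++ y₂
    before : SSt 9
    before = mid W X t [] r U C out ω
    small : Small (z * 6) before
    small = record { small-stacks = heights₀ ; small-input = z≤n }
      where
      z≤6z : ∀ {a} → a ≤ z → a ≤ z * 6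
      z≤6z le = ≤-trans le (m≤m*n z 6)
      heights₀ : ∀ i → length (Vec.lookup (stacks before) i) ≤ z * 6
      heights₀ fzero = z≤n
      heights₀ (fsuc fzero) = ≤-trans (≤-reflexive (symStack-length (map bitSym W))) (≤-trans (+-mono-≤ w≤ w≤)
        (≤-reflexive (sym (*-distribˡ-+ z 3 3))))
        where
        w≤ : length (map bitSym W) ≤ z * 3
        w≤ = ≤-trans (≤-reflexive (trans (length-map bitSym W) (trans (cong length (sym (items-instance x t n))) (items-length X t r)))) (*-monoˡ-≤ 3 total)
      heights₀ (fsuc (fsuc fzero)) = z≤n
      heights₀ (fsuc (fsuc (fsuc fzero))) = z≤6z (sum-≤₁ {length X} {length t} total)
      heights₀ (fsuc (fsuc (fsuc (fsuc fzero)))) = z≤6z (sum-≤₂ {length X} total)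
      heights₀ (fsuc (fsuc (fsuc (fsuc (fsuc fzero))))) = z≤n
      heights₀ (fsuc (fsuc (fsuc (fsuc (fsuc (fsuc fzero)))))) = z≤6z (sum-≤₃ {length X} {length t} total)
      heights₀ (fsuc (fsuc (fsuc (fsuc (fsuc (fsuc (fsuc fzero))))))) = z≤6z sizeU
      heights₀ (fsuc (fsuc (fsuc (fsuc (fsuc (fsuc (fsuc (fsuc fzero)))))))) = z≤6z sizeC
    after = small-exec d small
    after₁ : SSt 9
    after₁ = sst (l ∷ r₁ ∷ q ∷ X ∷ t ∷ [] ∷ r ∷ U ∷ C ∷ []) [] out ω₁
    simulated : ExecS (Simulation.simulateInput M emptyOracle >>= finishCode) before (isAcc o) (st X t r U C out ω₁) _
    simulated = bind d (bind (clear-upTo (# 0) after₁ (Small.small-stacks after (# 0)))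
      (bind (clear-upTo (# 1) (setStack (# 0) [] after₁) (Small.small-stacks after (# 1)))
      (bind (clear-upTo (# 2) (setStack (# 1) [] (setStack (# 0) [] after₁)) (Small.small-stacks after (# 2))) ret)))
    chain : ExecS decide (st X t r U C out ω) (isAcc o) (st X t r U C out ω₁) (decideTime z)
    chain =
      bind (emit-r X t r U C out ω (sum-≤₃ {length X} {length t} total))
      (bind (back rS r (mid y₁ X t (r ʳ++ []) [] U C out ω) (λ ()) refl (sum-≤₃ {length X} {length t} total) (cong (λ s → mid y₁ X t [] s U C out ω) (ʳ++-twice r)))
      (bind (emit-t y₁ X t r U C out ω (sum-≤₂ {length X} total))
      (bind (back tS t (mid y₂ X [] (t ʳ++ []) r U C out ω) (λ ()) refl (sum-≤₂ {length X} total) (cong (λ s → mid y₂ X s [] r U C out ω) (ʳ++-twice t)))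
      (bind (emit-x y₂ X t r U C out ω (sum-≤₁ {length X} {length t} total))
      (bind (back xS X (mid y₃ [] t (X ʳ++ []) r U C out ω) (λ ()) refl (sum-≤₁ {length X} {length t} total)
        (trans (cong (λ s → mid y₃ s t [] r U C out ω) (ʳ++-twice X)) (cong (λ w → mid w X t [] r U C out ω) (items-instance x t n)))) simulated)))))

  isAcc-language : ∀ {A : Lang} {w o} → (A w ≡ true) ⇔ Produces M ∅ w acc → Produces M ∅ w o → isAcc o ≡ A w
  isAcc-language {A} {w} {o} ac pr with A w in e
  ... | true with Paths.produces-unique M det (to ac refl) pr
  ...   | refl = refl
  isAcc-language {A} {w} {acc} ac pr | false = sym (from ac pr)
  isAcc-language {A} {w} {rej} ac pr | false = refl
  isAcc-language {A} {w} {unk} ac pr | false = refl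

record TableDecider (A : Lang) : Set₁ where
  field
    decide     : SCmd 9 Bool
    decideTime : ℕ → ℕ
    poly-time  : ∀ {f} → Poly f → Poly (λ n → decideTime (f n))
    decides    : ∀ x t n U C out ω z → Sized z (reverse x) t (replicate n true) U C → ∃ λ ω₁ →
      ExecS decide (st (reverse x) t (replicate n true) U C out ω) (A (instanceWord x t n)) (st (reverse x) t (replicate n true) U C out ω₁) (decideTime z)

abstract
  tableDecider : ∀ {A} → InP A → TableDecider A
  tableDecider {A} (M , det , pb , ac) = record
    { decide = Decider.decide M det pb
    ; decideTime = Decider.decideTime M det pb
    ; poly-time = Decider.poly-decideTime M det pb
    ; decides = λ x t n U C out ω z sz →
        let o , pr , ω₁ , d = Decider.decide-exec M det pb x t n U C out ω z sz
        in ω₁ , returns (Decider.isAcc-language M det pb {A} (ac (instanceWord x t n)) pr) d }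

full : List Bool → List Bool → List Bool → List Bool → List Bool → List Bool → Word → List Bool → SSt 9
full X t v r U C out ω = sst ([] ∷ [] ∷ [] ∷ X ∷ t ∷ v ∷ r ∷ U ∷ C ∷ []) [] out ω

-- The prefix found greedily: a bit is set if the table so far, extended by 1, can still be completed.
chosen : (List Bool → ℕ → Bool) → ℕ → List Bool → List Bool
chosen sat zero t = []
chosen sat (suc n) t = sat (true ∷ t) n ∷ chosen sat n (sat (true ∷ t) n ∷ t)

chosen-length : ∀ sat n t → length (chosen sat n t) ≡ n
chosen-length sat zero t = refl
chosen-length sat (suc n) t = cong suc (chosen-length sat n _)

trues : ℕ → List Bool
trues n = replicate n true

trues-ʳ++ : ∀ m n → trues m ʳ++ trues n ≡ trues (m + n)
trues-ʳ++ zero n = refl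
trues-ʳ++ (suc m) n = trans (trues-ʳ++ m (suc n)) (cong trues (+-suc m n))

copyBody : Fin 9 → Maybe Bool → SCmd 9 (⊤ ⊎ ⊤)
copyBody j nothing = ret (inj₂ tt)
copyBody j (just b) = op (push uS b) >> (op (push j b) >> ret (inj₁ tt))

copyLoop copy : Fin 9 → SCmd 9 ⊤
copyLoop j = iter (λ _ → op (pop vS) >>= copyBody j) tt
copy j = moveStack uS vS >> copyLoop j

copyCost : ℕ → ℕ
copyCost u = (u * 3 + 2) + (u * 4 + 2)

copy-r : ∀ X t U C out ω → ExecS (copy rS) (full X t [] [] U C out ω) tt (full X t [] U U C out ω) (copyCost (length U))
copy-r X t U C out ω = bind (moveStack-exec uS vS (λ ()) U (full X t [] [] U C out ω) refl)
  (ends (cong (λ V → full X t [] V V C out ω) (reverse-involutive U))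
    (weak (≤-reflexive (cong (λ n → n * 4 + 2) (length-reverse U)))
      (loop (reverse U) [] [])))
  where
  loop : ∀ v r u → ExecS (copyLoop rS) (full X t v r u C out ω) tt (full X t [] (v ʳ++ r) (v ʳ++ u) C out ω) (length v * 4 + 2)
  loop [] r u = stop (bind op ret)
  loop (b ∷ v) r u = more (bind op (bind op (bind op ret))) (loop v (b ∷ r) (b ∷ u))

copy-c : ∀ X t U out ω → ExecS (copy cS) (full X t [] [] U [] out ω) tt (full X t [] [] U U out ω) (copyCost (length U))
copy-c X t U out ω = bind (moveStack-exec uS vS (λ ()) U (full X t [] [] U [] out ω) refl)
  (ends (cong (λ V → full X t [] [] V V out ω) (reverse-involutive U))
    (weak (≤-reflexive (cong (λ n → n * 4 + 2) (length-reverse U)))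
      (loop (reverse U) [] [])))
  where
  loop : ∀ v c u → ExecS (copyLoop cS) (full X t v [] u c out ω) tt (full X t [] [] (v ʳ++ u) (v ʳ++ c) out ω) (length v * 4 + 2)
  loop [] c u = stop (bind op ret)
  loop (b ∷ v) c u = more (bind op (bind op (bind op ret))) (loop v (b ∷ c) (b ∷ u))

-- Computing the number of rounds in unary

module Clock where
  innerBody : Maybe Bool → SCmd 9 (⊤ ⊎ ⊤)
  innerBody nothing = ret (inj₂ tt)
  innerBody (just b) = op (push rS b) >> (op (push uS true) >> ret (inj₁ tt))

  inner : SCmd 9 ⊤
  inner = iter (λ _ → op (pop xS) >>= innerBody) tt

  multBody : Maybe Bool → SCmd 9 (⊤ ⊎ ⊤)
  multBody nothing = ret (inj₂ tt)
  multBody (just _) = inner >> (moveStack rS xS >> ret (inj₁ tt))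

  multLoop mult : SCmd 9 ⊤
  multLoop = iter (λ _ → op (pop vS) >>= multBody) tt
  mult = moveStack uS vS >> multLoop

  powers : ℕ → SCmd 9 ⊤
  powers zero = ret tt
  powers (suc k) = mult >> powers k

  pushes : ℕ → SCmd 9 ⊤
  pushes zero = ret tt
  pushes (suc k) = op (push uS true) >> pushes k

  -- The counter starts at 2, is multiplied `k` times by the input length n and is increased by
  -- `k + k`. The result is twice n^k + k, the step bound of the simulated reduction.
  setup : ℕ → SCmd 9 ⊤
  setup k = readInput (λ b → op (push vS b)) >> (moveStack vS xS >> (pushes 2 >> (powers k >> (pushes (k + k) >> copy cS))))

  multStep multCost : ℕ → ℕ → ℕ
  multStep m n = suc (1 + ((n * 4 + 2) + ((n * 3 + 2) + 0)))
  multCost m n = (m * 3 + 2) + (m * multStep m n + 2)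

  powersCost : ℕ → ℕ → ℕ → ℕ
  powersCost zero m n = 0
  powersCost (suc k) m n = multCost m n + powersCost k (m * n) n

  module _ (X : List Bool) (ω : List Bool) where
    n = length X

    inner-exec : ∀ s v r u → ExecS inner (full s [] v r u [] [] ω) tt (full [] [] v (s ʳ++ r) (trues (length s) ʳ++ u) [] [] ω) (length s * 4 + 2)
    inner-exec [] v r u = stop (bind op ret)
    inner-exec (b ∷ s) v r u = more (bind op (bind op (bind op ret))) (inner-exec s v (b ∷ r) (true ∷ u))

    multLoop-exec : ∀ v u → ExecS multLoop (full X [] v [] (trues u) [] [] ω) tt (full X [] [] [] (trues (length v * n + u)) [] [] ω) (length v * multStep 0 n + 2)
    multLoop-exec [] u = stop (bind op ret)
    multLoop-exec (b ∷ v) u = weak (≤-reflexive (sym (+-assoc (multStep 0 n) (length v * multStep 0 n) 2)))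
      (more (bind op (bind once (bind restored ret)))
        (ends (cong (λ c → full X [] [] [] (trues c) [] [] ω) (trans (sym (+-assoc (length v * n) n u)) (cong (_+ u) (+-comm (length v * n) n)))) (multLoop-exec v (n + u))))
      where
      once : ExecS inner (full X [] v [] (trues u) [] [] ω) tt (full [] [] v (reverse X) (trues (n + u)) [] [] ω) (n * 4 + 2)
      once = ends (cong (λ U → full [] [] v (reverse X) U [] [] ω) (trues-ʳ++ n u)) (inner-exec X v [] (trues u))
      restored : ExecS (moveStack rS xS) (full [] [] v (reverse X) (trues (n + u)) [] [] ω) tt (full X [] v [] (trues (n + u)) [] [] ω) (n * 3 + 2)
      restored = ends (cong (λ Y → full Y [] v [] (trues (n + u)) [] [] ω) (reverse-involutive X))
        (weak (≤-reflexive (cong (λ l → l * 3 + 2) (length-reverse X))) (moveStack-exec rS xS (λ ()) (reverse X) (full [] [] v (reverse X) (trues (n + u)) [] [] ω) refl))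

    mult-exec : ∀ m → ExecS mult (full X [] [] [] (trues m) [] [] ω) tt (full X [] [] [] (trues (m * n)) [] [] ω) (multCost m n)
    mult-exec m = bind
      (ends (cong (λ V → full X [] V [] [] [] [] ω) (trans (trues-ʳ++ m 0) (cong trues (+-identityʳ m))))
        (weak (≤-reflexive (cong (λ l → l * 3 + 2) (length-replicate m))) (moveStack-exec uS vS (λ ()) (trues m) (full X [] [] [] (trues m) [] [] ω) refl)))
      (ends (cong (λ c → full X [] [] [] (trues c) [] [] ω) (+-identityʳ (m * n)))
        (subst (λ l → ExecS multLoop (full X [] (trues m) [] [] [] [] ω) tt (full X [] [] [] (trues (l * n + 0)) [] [] ω) (l * multStep 0 n + 2)) (length-replicate m) (multLoop-exec (trues m) 0)))

    powers-exec : ∀ k m → ExecS (powers k) (full X [] [] [] (trues m) [] [] ω) tt (full X [] [] [] (trues (m * n ^ k)) [] [] ω) (powersCost k m n)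
    powers-exec zero m = ends (cong (λ c → full X [] [] [] (trues c) [] [] ω) (sym (*-identityʳ m))) ret
    powers-exec (suc k) m = bind (mult-exec m)
      (ends (cong (λ c → full X [] [] [] (trues c) [] [] ω) (*-assoc m n (n ^ k))) (powers-exec k (m * n)))

    pushes-exec : ∀ k u → ExecS (pushes k) (full X [] [] [] (trues u) [] [] ω) tt (full X [] [] [] (trues (k + u)) [] [] ω) k
    pushes-exec zero u = ret
    pushes-exec (suc k) u = ends (cong (λ c → full X [] [] [] (trues c) [] [] ω) (+-suc k u)) (bind op (pushes-exec k (suc u)))

  read-exec : ∀ s v ω → ExecS (readInput (λ b → op (push vS b))) (record (full [] [] v [] [] [] [] ω) { input = s }) tt (full [] [] (s ʳ++ v) [] [] [] [] ω) (length s * 3 + 2)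
  read-exec [] v ω = stop (bind op ret)
  read-exec (b ∷ s) v ω = more (bind op (bind op ret)) (read-exec s (b ∷ v) ω)

  double : ℕ → ℕ → ℕ
  double k n = (n ^ k + k) + (n ^ k + k)

  double-count : ∀ k n → (k + k) + 2 * n ^ k ≡ double k n
  double-count k n = begin
    (k + k) + (a + (a + 0))  ≡⟨ cong (λ z → (k + k) + (a + z)) (+-identityʳ a) ⟩
    (k + k) + (a + a)        ≡⟨ +-assoc k k (a + a) ⟩
    k + (k + (a + a))        ≡⟨ cong (k +_) (trans (sym (+-assoc k a a)) (trans (cong (_+ a) (+-comm k a)) (trans (+-assoc a k a) (cong (a +_) (+-comm k a))))) ⟩
    k + (a + (a + k))        ≡⟨ trans (sym (+-assoc k a (a + k))) (cong (_+ (a + k)) (+-comm k a)) ⟩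
    (a + k) + (a + k)        ∎
    where
    open ≡-Reasoning
    a = n ^ k

  setupCost : ℕ → ℕ → ℕ
  setupCost k n = (n * 3 + 2) + ((n * 3 + 2) + (2 + (powersCost k 2 n + ((k + k) + copyCost (double k n)))))

  setup-exec : ∀ k x ω → ExecS (setup k) (initialS x ω) tt
    (full (reverse x) [] [] [] (trues (double k (length x))) (trues (double k (length x))) [] ω) (setupCost k (length x))
  setup-exec k x ω =
    bind (weak (≤-reflexive (cong (λ l → l * 3 + 2) (length-reverse x)))
      (ends (cong (λ v → full [] [] v [] [] [] [] ω) (reverse-involutive x)) (read-exec (reverse x) [] ω)))
    (bind (moveStack-exec vS xS (λ ()) x (full [] [] x [] [] [] [] ω) refl)
    (bind (pushes-exec X ω 2 0)
    (bind (subst (λ m → ExecS (powers k) (full X [] [] [] (trues 2) [] [] ω) tt (full X [] [] [] (trues (2 * m ^ k)) [] [] ω) (powersCost k 2 m)) (length-reverse x) (powers-exec X ω k 2))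
    (bind (ends (cong (λ c → full X [] [] [] (trues c) [] [] ω) (double-count k (length x))) (pushes-exec X ω (k + k) (2 * length x ^ k)))
    (weak (≤-reflexive (cong copyCost (length-replicate (double k (length x))))) (copy-c X [] (trues (double k (length x))) [] ω))))))
    where X = reverse x

  poly-double : ∀ k → Poly (double k)
  poly-double k = poly-+ pk pk
    where
    pk : Poly (λ n → n ^ k + k)
    pk = poly-+ (poly-^ poly-id k) (poly-const k)

  poly-copyCost : ∀ {f} → Poly f → Poly (λ n → copyCost (f n))
  poly-copyCost pf = poly-+ (poly-+ (poly-* pf (poly-const 3)) (poly-const 2)) (poly-+ (poly-* pf (poly-const 4)) (poly-const 2))

  poly-powersCost : ∀ k {f} → Poly f → Poly (λ n → powersCost k (f n) n)
  poly-powersCost zero pf = poly-const 0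
  poly-powersCost (suc k) pf = poly-+
    (poly-+ (poly-+ (poly-* pf (poly-const 3)) (poly-const 2)) (poly-+ (poly-* pf
      (poly-+ (poly-const 1) (poly-+ (poly-const 1) (poly-+ (poly-+ (poly-* poly-id (poly-const 4)) (poly-const 2)) (poly-+ (poly-+ (poly-* poly-id (poly-const 3)) (poly-const 2)) (poly-const 0)))))) (poly-const 2)))
    (poly-powersCost k (poly-* pf poly-id))

  poly-setupCost : ∀ k → Poly (setupCost k)
  poly-setupCost k = poly-+ p3 (poly-+ p3 (poly-+ (poly-const 2) (poly-+ (poly-powersCost k (poly-const 2)) (poly-+ (poly-const (k + k)) (poly-copyCost (poly-double k))))))
    where
    p3 : Poly (λ n → n * 3 + 2)
    p3 = poly-+ (poly-* poly-id (poly-const 3)) (poly-const 2)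

-- The rounds as an oracle program

data Phase : Set where
  init round pass : Phase
  answered : Bool → Phase

phase-finite : Finite Phase
phase-finite = record
  { elements = init ∷ round ∷ pass ∷ answered true ∷ answered false ∷ []
  ; complete = λ { init → here refl ; round → there (here refl) ; pass → there (there (here refl))
                 ; (answered true) → there (there (there (here refl))) ; (answered false) → there (there (there (there (here refl)))) } }

module RoundProgram {A : Lang} (TD : TableDecider A) (k : ℕ) where
  open TableDecider TD
  open Clock using (setup; setupCost; setup-exec; poly-setupCost; double; poly-double; poly-copyCost)

  extendBody : Maybe Bool → SCmd 9 (⊤ ⊎ ⊤)
  extendBody nothing = ret (inj₂ tt)
  extendBody (just _) = op (push tS true) >> (decide >>= λ b → op (pop tS) >> (op (push tS b) >> ret (inj₁ tt)))

  extend : SCmd 9 ⊤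
  extend = iter (λ _ → op (pop rS) >>= extendBody) tt

  Next : Set
  Next = Phase ⊎ Maybe Outcome

  instance
    fin-Phase : Finite Phase
    fin-Phase = phase-finite

  verdict : Bool → Outcome
  verdict b = if b then acc else rej

  roundCode : Maybe Bool → SCmd 9 Next
  roundCode nothing = copy rS >> (decide >>= λ b → ret (inj₂ (just (verdict b))))
  -- The two pushed bits are the token `end false`. Moving the table reverses it, so that the pass
  -- meets its first token first.
  roundCode (just _) = copy rS >> (extend >> (op (push tS false) >> (op (push tS false) >> (moveStack tS vS >> ret (inj₁ pass)))))

  -- A `bit` token is copied to the query tape. At an `end` token the query word is complete: the
  -- old answer `b` is discarded, and the phase `answered` pushes the one given by the oracle.
  passTok : Bool → Bool → SCmd 9 Next
  passTok true b = op (emit b) >> (op (push tS true) >> (op (push tS b) >> ret (inj₁ pass)))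
  passTok false b = op (push tS false) >> ret (inj₂ nothing)

  passSecond : Bool → Maybe Bool → SCmd 9 Next
  passSecond c nothing = ret (inj₁ round)
  passSecond c (just b) = passTok c b

  passFirst : Maybe Bool → SCmd 9 Next
  passFirst nothing = ret (inj₁ round)
  passFirst (just c) = op (pop vS) >>= passSecond c

  phaseCode : Phase → SCmd 9 Next
  phaseCode init = setup k >> ret (inj₁ round)
  phaseCode round = op (pop cS) >>= roundCode
  phaseCode pass = op (pop vS) >>= passFirst
  phaseCode (answered a) = op (push tS a) >> ret (inj₁ pass)

  program : Program (SSig 9)
  program = record { Label = Phase ; labels = phase-finite ; start = init ; answer = answered ; body = phaseCode }

  -- The query tape holds the unfinished word `u` of `correct`, so each `end` token asks exactly the
  -- word of its entry. As no word is pending at the end, the query tape is empty when the next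
  -- round begins.
  pass-run : ∀ {D X U C o n ω} ts u t → pending u ts ≡ [] →
    Run (SSem 9) program D round (full X (flat (correct D u ts) ʳ++ t) [] [] U C [] ω) o n →
    Run (SSem 9) program D pass (full X t (flat ts) [] U C u ω) o (length ts * 7 + (2 + n))
  pass-run [] u t refl r = jump (bind op ret) r
  pass-run (bit b ∷ ts) u t e r = weaken (n≤1+n _)
    (jump (bind op (bind op (bind op (bind op (bind op ret))))) (pass-run ts (u ++ b ∷ []) (b ∷ true ∷ t) e r))
  pass-run {D} (end a ∷ ts) u t e r =
    inquire (bind op (bind op (bind op ret))) (jump (bind op ret) (pass-run ts [] (D u ∷ false ∷ t) e r))

  extendStep : ℕ → ℕ
  extendStep z = suc (1 + (1 + (decideTime z + (1 + (1 + 0)))))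

  -- Each of the `double k n` rounds appends `double k n` chosen bits and the two bits of
  -- `end false`.
  tableBound sizeBound finalCostAt roundCostAt time : ℕ → ℕ
  tableBound n = double k n * (double k n + 2)
  sizeBound n = n + (tableBound n + double k n)
  finalCostAt n = suc (1 + (copyCost (double k n) + (decideTime (sizeBound n) + 0)))
  roundCostAt n = suc (1 + (copyCost (double k n) + ((double k n * extendStep (sizeBound n) + 2) + (1 + (1 + ((tableBound n * 3 + 2) + 0)))))) + (tableBound n * 7 + 2)
  time n = suc (setupCost k n + 0) + (double k n * roundCostAt n + finalCostAt n)

  poly-programTime : Poly time
  poly-programTime = poly-+ (poly-+ (poly-const 1) (poly-+ (poly-setupCost k) (poly-const 0))) (poly-+ (poly-* pu pround) pfinal)
    where
    pu : Poly (double k)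
    pu = poly-double k
    ptable : Poly tableBound
    ptable = poly-* pu (poly-+ pu (poly-const 2))
    psize : Poly sizeBound
    psize = poly-+ poly-id (poly-+ ptable pu)
    pdecide : Poly (λ n → decideTime (sizeBound n))
    pdecide = poly-time psize
    pfinal : Poly finalCostAt
    pfinal = poly-+ (poly-const 1) (poly-+ (poly-const 1) (poly-+ (poly-copyCost pu) (poly-+ pdecide (poly-const 0))))
    pstep : Poly (λ n → extendStep (sizeBound n))
    pstep = poly-+ (poly-const 1) (poly-+ (poly-const 1) (poly-+ (poly-const 1) (poly-+ pdecide (poly-const 2))))
    pround : Poly roundCostAt
    pround = poly-+ (poly-+ (poly-const 1) (poly-+ (poly-const 1) (poly-+ (poly-copyCost pu) (poly-+ (poly-+ (poly-* pu pstep) (poly-const 2))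
      (poly-+ (poly-const 1) (poly-+ (poly-const 1) (poly-+ (poly-+ (poly-* ptable (poly-const 3)) (poly-const 2)) (poly-const 0))))))))
      (poly-+ (poly-* ptable (poly-const 7)) (poly-const 2))

  module _ (x : Word) where
    n = length x
    u = double k n
    X = reverse x
    U = trues u

    sat : List Bool → ℕ → Bool
    sat t m = A (instanceWord x t m)

    extend-exec : ∀ m t C out ω z → n + (length t + m) ≤ z → u ≤ z → length C ≤ z → ∃ λ ω₁ →
      ExecS extend (st X t (trues m) U C out ω) tt (st X (chosen sat m t ʳ++ t) [] U C out ω₁) (m * extendStep z + 2)
    extend-exec zero t C out ω z le leU leC = ω , stop (bind op ret)
    extend-exec (suc m) t C out ω z le leU leC with decides x (true ∷ t) m U C out ω z sized
      where
      sized : Sized z X (true ∷ t) (trues m) U C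
      sized = record
        { total = ≤-trans (≤-reflexive (cong₂ _+_ (length-reverse x) (trans (cong (suc (length t) +_) (length-replicate m)) (sym (+-suc (length t) m))))) le
        ; sizeU = ≤-trans (≤-reflexive (length-replicate u)) leU
        ; sizeC = leC }
    ... | ω₁ , d with extend-exec m (sat (true ∷ t) m ∷ t) C out ω₁ z (≤-trans (≤-reflexive (cong (n +_) (sym (+-suc (length t) m)))) le) leU leC
    ... | ω₂ , e = ω₂ , weak (≤-reflexive (sym (+-assoc (extendStep z) (m * extendStep z) 2))) (more (bind op (bind op (bind d (bind op (bind op ret))))) e)

    ex : List Tok → List Tok
    ex ts = toks (chosen sat u (reverse (flat ts)))

    Λ z roundCost finalCost : ℕ
    Λ = tableBound n
    z = sizeBound n
    roundCost = roundCostAt n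
    finalCost = finalCostAt n

    flat-ex : ∀ ts → flat (ex ts) ≡ chosen sat u (reverse (flat ts))
    flat-ex ts = flat-toks (n ^ k + k) _ (chosen-length sat u _)

    next-table : ∀ ts → reverse (false ∷ false ∷ (chosen sat u (reverse (flat ts)) ʳ++ reverse (flat ts))) ≡ flat ((ts ++ ex ts) ++ end false ∷ [])
    next-table ts = begin
      (g ʳ++ reverse (flat ts)) ʳ++ (false ∷ false ∷ [])        ≡⟨ ʳ++-ʳ++ g ⟩
      reverse (flat ts) ʳ++ (g ++ false ∷ false ∷ [])           ≡⟨ ʳ++-defn (reverse (flat ts)) ⟩
      reverse (reverse (flat ts)) ++ (g ++ false ∷ false ∷ [])  ≡⟨ cong (_++ (g ++ false ∷ false ∷ [])) (reverse-involutive (flat ts)) ⟩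
      flat ts ++ (g ++ false ∷ false ∷ [])                      ≡⟨ ++-assoc (flat ts) g (false ∷ false ∷ []) ⟨
      (flat ts ++ g) ++ false ∷ false ∷ []                      ≡⟨ cong (λ h → (flat ts ++ h) ++ false ∷ false ∷ []) (flat-ex ts) ⟨
      (flat ts ++ flat (ex ts)) ++ false ∷ false ∷ []           ≡⟨ cong (_++ false ∷ false ∷ []) (flat-++ ts (ex ts)) ⟨
      flat (ts ++ ex ts) ++ false ∷ false ∷ []                  ≡⟨ flat-++ (ts ++ ex ts) (end false ∷ []) ⟨
      flat ((ts ++ ex ts) ++ end false ∷ [])                    ∎
      where
      open ≡-Reasoning
      g = chosen sat u (reverse (flat ts))

    module _ (D : Lang) where
      roundOf : List Tok → List Tok
      roundOf = nextRound D ex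

      roundsOf : ℕ → List Tok → List Tok
      roundsOf = nthRound D ex

      round-length : ∀ ts → length (flat (roundOf ts)) ≡ length (flat ts) + (u + 2)
      round-length ts = begin
        length (flat (correct D [] us))              ≡⟨ flat-length (correct D [] us) ⟩
        length (correct D [] us) + length (correct D [] us) ≡⟨ cong₂ _+_ (length-correct D [] us) (length-correct D [] us) ⟩
        length us + length us                        ≡⟨ flat-length us ⟨
        length (flat us)                             ≡⟨ cong length (trans (flat-++ (ts ++ ex ts) _) (cong (_++ false ∷ false ∷ []) (trans (flat-++ ts (ex ts)) (cong (flat ts ++_) (flat-ex ts))))) ⟩
        length ((flat ts ++ g) ++ false ∷ false ∷ []) ≡⟨ trans (length-++ (flat ts ++ g)) (cong (_+ 2) (trans (length-++ (flat ts)) (cong (length (flat ts) +_) (chosen-length sat u _)))) ⟩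
        length (flat ts) + u + 2                     ≡⟨ +-assoc (length (flat ts)) u 2 ⟩
        length (flat ts) + (u + 2)                   ∎
        where
        open ≡-Reasoning
        us = (ts ++ ex ts) ++ end false ∷ []
        g = chosen sat u (reverse (flat ts))

      -- The length hypothesis reserves space for the remaining `c` rounds, so that one bound on the
      -- table serves for the cost of every round.
      rounds-run : ∀ c ts ω → c ≤ u → length (flat ts) + c * (u + 2) ≤ Λ →
        Run (SSem 9) program D round (full X (reverse (flat ts)) [] [] U (trues c) [] ω)
          (verdict (sat (reverse (flat (roundsOf c ts))) u)) (c * roundCost + finalCost)
      rounds-run zero ts ω c≤u le with decides x (reverse (flat ts)) u U [] [] ω z record
        { total = +-mono-≤ (≤-reflexive (length-reverse x)) (+-mono-≤ (≤-trans (≤-reflexive (length-reverse (flat ts))) (≤-trans (m≤m+n _ 0) le)) (≤-reflexive (length-replicate u)))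
        ; sizeU = ≤-trans (≤-reflexive (length-replicate u)) (≤-trans (m≤n+m u Λ) (m≤n+m (Λ + u) n))
        ; sizeC = z≤n }
      ... | ω₁ , d = finish (bind op (bind (weak (≤-reflexive (cong copyCost (length-replicate u))) (copy-r X (reverse (flat ts)) U [] [] ω)) (bind d ret)))
      rounds-run (suc c) ts ω c<u le with extend-exec u (reverse (flat ts)) (trues c) [] ω z
          (+-monoʳ-≤ n (+-monoˡ-≤ u (≤-trans (≤-reflexive (length-reverse (flat ts))) (≤-trans (m≤m+n _ _) le)))) (≤-trans (m≤n+m u Λ) (m≤n+m (Λ + u) n))
          (≤-trans (≤-reflexive (length-replicate c)) (≤-trans (≤-trans (n≤1+n c) c<u) (≤-trans (m≤n+m u Λ) (m≤n+m (Λ + u) n))))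
      ... | ω₁ , d = weaken bound (jump
          (bind op (bind (weak (≤-reflexive (cong copyCost (length-replicate u))) (copy-r X (reverse (flat ts)) U (trues c) [] ω)) (bind d (bind op (bind op (bind moved-table ret))))))
          (pass-run us [] [] (pending-++ [] (ts ++ ex ts) (end false ∷ [])) (rounds-run c (roundOf ts) ω₁ (≤-trans (n≤1+n c) c<u)
            (≤-trans (≤-reflexive (trans (cong (_+ c * (u + 2)) (round-length ts)) (+-assoc (length (flat ts)) (u + 2) (c * (u + 2))))) le))))
        where
        us = (ts ++ ex ts) ++ end false ∷ []
        t₁ = false ∷ false ∷ (chosen sat u (reverse (flat ts)) ʳ++ reverse (flat ts))
        len₁ : length (flat us) ≤ Λ
        len₁ = ≤-trans (≤-reflexive (trans (flat-length us) (trans (sym (cong₂ _+_ (length-correct D [] us) (length-correct D [] us))) (trans (sym (flat-length (correct D [] us))) (round-length ts)))))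
          (≤-trans (+-monoʳ-≤ (length (flat ts)) (m≤m+n (u + 2) (c * (u + 2)))) le)
        len-t₁ : length t₁ ≤ Λ
        len-t₁ = ≤-trans (≤-reflexive (trans (sym (length-reverse t₁)) (cong length (next-table ts)))) len₁
        moved-table : ExecS (moveStack tS vS) (full X t₁ [] [] U (trues c) [] ω₁) tt (full X [] (flat us) [] U (trues c) [] ω₁) (Λ * 3 + 2)
        moved-table = ends (cong (λ V → full X [] V [] U (trues c) [] ω₁) (next-table ts))
          (weak (+-monoˡ-≤ 2 (*-monoˡ-≤ 3 len-t₁)) (moveStack-exec tS vS (λ ()) t₁ (full X t₁ [] [] U (trues c) [] ω₁) refl))
        len-us : length us ≤ Λ
        len-us = ≤-trans (m≤m+n _ _) (≤-trans (≤-reflexive (sym (flat-length us))) len₁)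
        rest = c * roundCost + finalCost
        first = suc (1 + (copyCost u + ((u * extendStep z + 2) + (1 + (1 + ((Λ * 3 + 2) + 0))))))
        bound : first + (length us * 7 + (2 + rest)) ≤ (roundCost + c * roundCost) + finalCost
        bound = begin
          first + (length us * 7 + (2 + rest))          ≤⟨ +-monoʳ-≤ first (+-monoˡ-≤ (2 + rest) (*-monoˡ-≤ 7 len-us)) ⟩
          first + (Λ * 7 + (2 + rest))                  ≡⟨ cong (first +_) (+-assoc (Λ * 7) 2 rest) ⟨
          first + ((Λ * 7 + 2) + rest)                  ≡⟨ +-assoc first (Λ * 7 + 2) rest ⟨
          roundCost + rest                              ≡⟨ +-assoc roundCost (c * roundCost) finalCost ⟨
          (roundCost + c * roundCost) + finalCost       ∎
          where open ≤-Reasoning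

      run-total : ∀ ω → Run (SSem 9) program D init (initialS x ω) (verdict (sat (reverse (flat (roundsOf u []))) u)) (time n)
      run-total ω = jump (bind (setup-exec k x ω) ret) (rounds-run u [] ω ≤-refl ≤-refl)

-- The two implications

snoc-shift : ∀ (t : List Bool) b c → reverse (b ∷ t) ++ c ≡ reverse t ++ b ∷ c
snoc-shift t b c = trans (cong (_++ c) (unfold-reverse b t)) (++-assoc (reverse t) (b ∷ []) c)

module Greedy (N : NOTM) (x : Word) (sat : List Bool → ℕ → Bool)
              (sat-correct : ∀ t r → (sat t r ≡ true) ⇔ Certificates.Sat N x (reverse t) r) where
  open Certificates N x

  -- Search reduces to decision: if some extension exists and none begins with `true`, then one
  -- begins with `false`. So the greedy choice preserves extendability until no bits remain, and the
  -- table itself then has the path.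
  chosen-sat : ∀ r t → Sat (reverse t) r → AccPath (table (toks (reverse t ++ chosen sat r t)))
  chosen-sat zero t ([] , refl , path) = path
  chosen-sat (suc r) t s with sat (true ∷ t) r in e
  ... | true = subst (λ l → AccPath (table (toks l))) (snoc-shift t true _) (chosen-sat r (true ∷ t) (to (sat-correct (true ∷ t) r) e))
  ... | false = subst (λ l → AccPath (table (toks l))) (snoc-shift t false _) (chosen-sat r (false ∷ t) (with-false s))
    where
    true≢false : true ≢ false
    true≢false ()
    with-false : Sat (reverse t) (suc r) → Sat (reverse (false ∷ t)) r
    with-false (false ∷ g , refl , path) = g , refl , subst (λ l → AccPath (table (toks l))) (sym (snoc-shift t false g)) path
    with-false (true ∷ g , refl , path) = ⊥-elim (true≢false (trans (sym (from (sat-correct (true ∷ t) r)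
      (g , refl , subst (λ l → AccPath (table (toks l))) (sym (snoc-shift t true g)) path))) e))

module Reduction (P=NP : P≡NP) {A B : Lang} (N : NOTM) (pb : PolyBounded N)
  (over : RobustlyOverproductive N) (under : RobustlyUnderproductive N) (ac : Accepts N B A) where

  k = proj₁ pb
  open SatLanguage (satLanguage N pb)
  open RoundProgram (tableDecider (from (P=NP language) in-NP)) k
  open Implementation (implement program false)

  module _ (x : Word) where
    p = length x ^ k + k
    open Certificates N x using (Sat; AccPath)

    ex-sat : ∀ ts → Sat (flat ts) (p + p) → AccPath (table (ts ++ ex x ts))
    ex-sat ts s = subst (λ us → AccPath (table us)) split
      (Greedy.chosen-sat N x (sat x) (instances x) (p + p) (reverse (flat ts)) (subst (λ l → Sat l (p + p)) (sym (reverse-involutive (flat ts))) s))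
      where
      split : toks (reverse (reverse (flat ts)) ++ chosen (sat x) (p + p) (reverse (flat ts))) ≡ ts ++ ex x ts
      split = trans (cong₂ (λ l g → toks (l ++ g)) (reverse-involutive (flat ts)) (sym (flat-ex x ts)))
        (trans (cong toks (sym (flat-++ ts (ex x ts)))) (toks-flat (ts ++ ex x ts)))

    open Rounds N B x p (λ D → proj₂ pb D x _ _) using (rounds-sat; rounds-unsat)

    final : List Tok
    -- The unary counter of 2p measures both the bits of an extension and the rounds; for the
    -- rounds, `rounds-unsat` asks for at least p.
    final = nthRound B (ex x) (p + p) []

    final-sat : (sat x (reverse (flat final)) (p + p) ≡ true) ⇔ Sat (flat final) (p + p)
    final-sat = subst (λ l → (sat x (reverse (flat final)) (p + p) ≡ true) ⇔ Sat l (p + p)) (reverse-involutive (flat final)) (instances x (reverse (flat final)) (p + p))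

    accepted : A x ≡ true → sat x (reverse (flat final)) (p + p) ≡ true
    accepted e = from final-sat (rounds-sat (ex x) ex-sat (p + p) (to (ac x) e))

    accepted⁻ : sat x (reverse (flat final)) (p + p) ≡ true → A x ≡ true
    -- Overproductivity leaves two cases, and a rejecting path would contradict that the last table
    -- is extendable.
    accepted⁻ e with over B x
    ... | inj₁ pr = from (ac x) pr
    ... | inj₂ (_ , _ , ρ , h) = ⊥-elim (rounds-unsat (ex x) ex-sat under ρ h (p + p) (m≤m+n p p) (to final-sat e))

  verdict-acc : ∀ {b} → verdict b ≡ acc → b ≡ true
  verdict-acc {true} _ = refl

  accepts : Accepts machine B A
  accepts x = mk⇔ yes-acc acc-yes
    where
    yes-acc : A x ≡ true → Produces machine B x acc
    yes-acc e = subst (Produces machine B x) (cong verdict (accepted x e)) (run⇒produces {ω = []} (λ _ → refl) (run-total x B []))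
    acc-yes : Produces machine B x acc → A x ≡ true
    acc-yes pr = let ω , _ , only = produces⇒run pr in accepted⁻ x (verdict-acc (only (run-total x B ω)))

  reduces : A ≤pT B
  reduces = machine , deterministic refl , polyBounded poly-programTime (λ D x ω _ → _ , run-total x D ω) , accepts

P≡NP⇒RS≡pT : P≡NP → RS≡pT
P≡NP⇒RS≡pT P=NP A B = mk⇔ (λ (N , pb , over , under , ac) → Reduction.reduces P=NP N pb over under ac) pT⇒RS

theorem4p12 : (¬ RS≡pT → ¬ P≡NP) × (RS≡pT → P≡NP∩coNP)
theorem4p12 = (λ different P=NP → different (P≡NP⇒RS≡pT P=NP)) , RS≡pT⇒P≡NP∩coNP
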